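{- For every fixed $k\ge2$ and $\ell\ge1$, every with-high-probability successful fixed-support canonical sketch family $\mathcal A$ (with parameters $k,\ell$) satisfies $$\liminf_{d\to\infty}\frac{\mathfrak C_{\mathcal A}(d)}{d}\ \ge\ \frac{\ell}{\rho_{k,\ell}}\ >\ 1,$$ where $\rho_{k,\ell}\in(0,\ell)$ is the unique positive root of the equation $$\rho=\mathbb E\big[\min\{\ell,\operatorname{Pois}(k\rho)\}\big].$$
   Context: **Universe.** $\mathcal U=\mathbb F_p$ with $p$ prime, $V=p$, $\mathcal U^*=\mathcal U\setminus\{0\}$; limits $V\to\infty$ are over primes; $o_V(1)$ means tending to $0$ as $V\to\infty$ for fixed $d$; $[n]=\{1,\dots,n\}$. $\operatorname{Pois}(\lambda)$ denotes a Poisson random variable with mean $\lambda$. **Fixed-support canonical sketch family** (fixed constants $k,\ell\ge1$). For every $d,V$, a family $\mathcal A$ samples public randomness $\omega$; after fixing $\omega$, encoding and decoding are deterministic. It maintains $M_d$ persistent cells ($M_d$ depends on $d$ only, not on $V$), which hold all persistent information; each cell has at most $V^{\ell+r_d(V)}$ possible states, where $r_d(V)=o_V(1)$ for each fixed $d$. Put $\mathfrak C_{\mathcal A}(d):=\ell M_d$. For each $\omega$ there are an encoding map $\mathsf{Enc}^\omega_{d,V}$ from subsets of $\mathcal U^*$ to sketch states and, for each $x\in\mathcal U^*$, an update map $\mathsf{Upd}^\omega_{d,V,x}$ on sketch states such that: (1) *Fixed support*: each $x\in\mathcal U^*$ has a predetermined write support $S^\omega_{d,V}(x)\subseteq[M_d]$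 with $|S^\omega_{d,V}(x)|\le k$; $\mathsf{Upd}^\omega_{d,V,x}$ may depend on the whole state but changes only cells in $S^\omega_{d,V}(x)$. (2) *Canonicality*: for all $A\subseteq\mathcal U^*$ and $x\in\mathcal U^*\setminus A$, $\mathsf{Enc}^\omega_{d,V}(A\cup\{x\})=\mathsf{Upd}^\omega_{d,V,x}(\mathsf{Enc}^\omega_{d,V}(A))$. The decoder $\mathsf{Dec}^\omega_{d,V}$ is an arbitrary function of a pair of sketch states; on $(\mathsf{Enc}(A),\mathsf{Enc}(B))$ it aims to output $(A\setminus B,B\setminus A)$. With $D$ uniform among the $d$-subsets of $\mathcal U^*$, $\operatorname{Succ}^\omega_{d,V}(\mathcal A):=\Pr_D[\mathsf{Dec}^\omega_{d,V}(\mathsf{Enc}^\omega_{d,V}(D),\mathsf{Enc}^\omega_{d,V}(\varnothing))=(D,\varnothing)]$ and $\operatorname{Succ}_{d,V}(\mathcal A):=\mathbb E_\omega[\operatorname{Succ}^\omega_{d,V}(\mathcal A)]$. $\mathcal A$ is *with-high-probability successful* if $\lim_{d\to\infty}\liminf_{V\to\infty}\operatorname{Succ}_{d,V}(\mathcal A)=1$. -}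

module Defs where

open import Level using (0ℓ)
open import Data.Bool.Properties using () renaming (_≟_ to _≟ᵇ_)
open import Data.Bool.Base using (true; false)
open import Data.Fin.Base using (Fin)
open import Data.Fin.Subset using (Subset; _∈_; _∉_; _∪_; ⁅_⁆; ⊥) renaming (∣_∣ to card)
open import Data.Integer.Base using (+_)
open import Data.List.Base using (List; []; _∷_; map; _++_; filter; length)
open import Data.Nat.Base as ℕ using (ℕ; zero; suc; _⊓_; _⊔_; _!)
import Data.Nat.Properties as ℕP
open import Data.Nat.Primality using (Prime)
open import Data.Product.Base using (Σ; ∃; _×_; _,_; proj₁; proj₂)
open import Data.Product.Properties using () renaming (≡-dec to ×-≡-dec)
open import Data.Rational.Base as ℚ using (ℚ; 0ℚ; 1ℚ; ½; ∣_∣)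
import Data.Rational.Properties as ℚP
open import Data.Rational.Solver using (module +-*-Solver)
open import Data.Vec.Base as Vec using (Vec; []; _∷_)
open import Data.Vec.Properties using () renaming (≡-dec to Vec-≡-dec)
open import Data.Vec.Relation.Unary.All using (All)
open import Data.Vec.Relation.Unary.All.Properties using (lookup⁺)
open import Relation.Binary.Definitions using (DecidableEquality)
open import Relation.Binary.PropositionalEquality
  using (_≡_; _≢_; refl; sym; trans; cong; cong₂; subst; module ≡-Reasoning)
open import Relation.Nullary using (¬_)
open import Relation.Unary using (Pred; _≐_; _∩_; ∁; U; ∅; ⋃)

------------------------------------------------------------------------
-- Real numbers: Cauchy sequences of rationals, compared up to _≈_

IsCauchy : (ℕ → ℚ) → Set
IsCauchy s = ∀ ε → 0ℚ ℚ.< ε →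
  ∃ λ N → ∀ m n → N ℕ.≤ m → N ℕ.≤ n → ∣ s m ℚ.- s n ∣ ℚ.< ε

record ℝ : Set where
  constructor mkℝ
  field
    seq    : ℕ → ℚ
    cauchy : IsCauchy seq
open ℝ public

infix 4 _≤_ _<_ _≈_

_≤_ _<_ _≈_ : ℝ → ℝ → Set
x ≤ y = ∀ ε → 0ℚ ℚ.< ε → ∃ λ N → ∀ n → N ℕ.≤ n → seq x n ℚ.≤ seq y n ℚ.+ ε
x < y = ∃ λ ε → 0ℚ ℚ.< ε × ∃ λ N → ∀ n → N ℕ.≤ n → seq x n ℚ.+ ε ℚ.≤ seq y n
x ≈ y = x ≤ y × y ≤ x

private
  open +-*-Solver using (solve; _:+_; _:*_; _:-_; :-_; _:=_; con)

  half>0 : ∀ {ε} → 0ℚ ℚ.< ε → 0ℚ ℚ.< ½ ℚ.* ε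
  half>0 {ε} p = subst (ℚ._< ½ ℚ.* ε) (ℚP.*-zeroʳ ½) (ℚP.*-monoʳ-<-pos ½ p)

  halves : ∀ ε → ½ ℚ.* ε ℚ.+ ½ ℚ.* ε ≡ ε
  halves ε = trans (sym (ℚP.*-distribʳ-+ ε ½ ½)) (ℚP.*-identityˡ ε)

  *>0 : ∀ {p q} → 0ℚ ℚ.< p → 0ℚ ℚ.< q → 0ℚ ℚ.< p ℚ.* q
  *>0 {p} {q} hp hq = ℚP.positive⁻¹ (p ℚ.* q)
    {{ℚP.pos*pos⇒pos p {{ℚ.positive hp}} q {{ℚ.positive hq}}}}

  swap- : ∀ a b → ∣ a ℚ.- b ∣ ≡ ∣ b ℚ.- a ∣
  swap- a b = trans (cong ∣_∣ (solve 2 (λ a b → a :- b := :- (b :- a)) refl a b))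
                    (ℚP.∣-p∣≡∣p∣ (b ℚ.- a))

  eventual-bound : ∀ s → IsCauchy s →
    ∃ λ B → 0ℚ ℚ.< B × ∃ λ N → ∀ n → N ℕ.≤ n → ∣ s n ∣ ℚ.≤ B
  eventual-bound s cs with cs 1ℚ (ℚP.positive⁻¹ 1ℚ)
  ... | N , h = 1ℚ ℚ.+ ∣ s N ∣
      , ℚP.+-mono-<-≤ (ℚP.positive⁻¹ 1ℚ) (ℚP.0≤∣p∣ (s N))
      , N , λ n N≤n → let open ℚP.≤-Reasoning in begin
        ∣ s n ∣                         ≡⟨ cong ∣_∣ (solve 2 (λ a b → a := (a :- b) :+ b) refl (s n) (s N)) ⟩
        ∣ (s n ℚ.- s N) ℚ.+ s N ∣        ≤⟨ ℚP.∣p+q∣≤∣p∣+∣q∣ (s n ℚ.- s N) (s N) ⟩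
        ∣ s n ℚ.- s N ∣ ℚ.+ ∣ s N ∣      ≤⟨ ℚP.+-monoˡ-≤ ∣ s N ∣ (ℚP.<⇒≤ (h n N N≤n ℕP.≤-refl)) ⟩
        1ℚ ℚ.+ ∣ s N ∣                   ∎

  scale-< : ∀ {u v a b} → 0ℚ ℚ.< b → ∣ u ∣ ℚ.≤ b → ∣ v ∣ ℚ.< a → ∣ u ℚ.* v ∣ ℚ.< b ℚ.* a
  scale-< {u} {v} {a} {b} b>0 hu hv = let open ℚP.≤-Reasoning in begin-strict
    ∣ u ℚ.* v ∣        ≡⟨ ℚP.∣p*q∣≡∣p∣*∣q∣ u v ⟩
    ∣ u ∣ ℚ.* ∣ v ∣    ≤⟨ ℚP.*-monoʳ-≤-nonNeg ∣ v ∣ {{ℚP.∣-∣-nonNeg v}} hu ⟩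
    b ℚ.* ∣ v ∣        <⟨ ℚP.*-monoʳ-<-pos b {{ℚ.positive b>0}} hv ⟩
    b ℚ.* a            ∎

private
  module Shrink (B c : ℚ) (B>0 : 0ℚ ℚ.< B) (c>0 : 0ℚ ℚ.< c) where
    instance
      nzB : ℚ.NonZero B
      nzB = ℚP.pos⇒nonZero B {{ℚ.positive B>0}}
    δ : ℚ
    δ = ℚ.1/ B ℚ.* c
    δ>0 : 0ℚ ℚ.< δ
    δ>0 = *>0 (ℚP.positive⁻¹ (ℚ.1/ B) {{ℚP.1/pos⇒pos B {{ℚ.positive B>0}}}}) c>0
    Bδ≡c : B ℚ.* δ ≡ c
    Bδ≡c = trans (sym (ℚP.*-assoc B (ℚ.1/ B) c))
             (trans (cong (ℚ._* c) (ℚP.*-inverseʳ B)) (ℚP.*-identityˡ c))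

-- Abstract because unfolding these proofs makes typechecking very slow.
abstract
  const-cauchy : ∀ q → IsCauchy (λ _ → q)
  const-cauchy q ε ε>0 = 0 , λ _ _ _ _ →
    subst (ℚ._< ε) (sym (cong ∣_∣ (ℚP.+-inverseʳ q))) ε>0

  neg-cauchy : ∀ x → IsCauchy (λ n → ℚ.- seq x n)
  neg-cauchy x = λ ε ε>0 → let (N , h) = cauchy x ε ε>0 in
    N , λ m n N≤m N≤n → subst (ℚ._< ε)
      (trans (swap- (seq x m) (seq x n))
        (cong ∣_∣ (solve 2 (λ a b → b :- a := (:- a) :- (:- b)) refl (seq x m) (seq x n))))
      (h m n N≤m N≤n)

  +-cauchy : ∀ x y → IsCauchy (λ n → seq x n ℚ.+ seq y n)
  +-cauchy x y = λ ε ε>0 →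
    let (N , h) = cauchy x (½ ℚ.* ε) (half>0 ε>0)
        (M , g) = cauchy y (½ ℚ.* ε) (half>0 ε>0)
    in N ⊔ M , λ m n l₁ l₂ → let open ℚP.≤-Reasoning in begin-strict
      ∣ (seq x m ℚ.+ seq y m) ℚ.- (seq x n ℚ.+ seq y n) ∣
        ≡⟨ cong ∣_∣ (solve 4 (λ a b c d → (a :+ b) :- (c :+ d) := (a :- c) :+ (b :- d)) refl
             (seq x m) (seq y m) (seq x n) (seq y n)) ⟩
      ∣ (seq x m ℚ.- seq x n) ℚ.+ (seq y m ℚ.- seq y n) ∣
        ≤⟨ ℚP.∣p+q∣≤∣p∣+∣q∣ (seq x m ℚ.- seq x n) (seq y m ℚ.- seq y n) ⟩
      ∣ seq x m ℚ.- seq x n ∣ ℚ.+ ∣ seq y m ℚ.- seq y n ∣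
        <⟨ ℚP.+-mono-< (h m n (ℕP.m⊔n≤o⇒m≤o N M l₁) (ℕP.m⊔n≤o⇒m≤o N M l₂))
                       (g m n (ℕP.m⊔n≤o⇒n≤o N M l₁) (ℕP.m⊔n≤o⇒n≤o N M l₂)) ⟩
      ½ ℚ.* ε ℚ.+ ½ ℚ.* ε
        ≡⟨ halves ε ⟩
      ε ∎

  *-cauchy : ∀ x y → IsCauchy (λ n → seq x n ℚ.* seq y n)
  *-cauchy x y = λ ε ε>0 →
    let (B , B>0 , K , b) = eventual-bound (seq x) (cauchy x)
        (C , C>0 , L , c) = eventual-bound (seq y) (cauchy y)
        module X = Shrink C (½ ℚ.* ε) C>0 (half>0 ε>0)
        module Y = Shrink B (½ ℚ.* ε) B>0 (half>0 ε>0)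
        (N , h) = cauchy x X.δ X.δ>0
        (M , g) = cauchy y Y.δ Y.δ>0
    in (K ⊔ L) ⊔ (N ⊔ M) , λ m n l₁ l₂ →
    let K≤ : ∀ {i} → (K ⊔ L) ⊔ (N ⊔ M) ℕ.≤ i → K ℕ.≤ i
        K≤ l = ℕP.m⊔n≤o⇒m≤o K L (ℕP.m⊔n≤o⇒m≤o (K ⊔ L) (N ⊔ M) l)
        L≤ : ∀ {i} → (K ⊔ L) ⊔ (N ⊔ M) ℕ.≤ i → L ℕ.≤ i
        L≤ l = ℕP.m⊔n≤o⇒n≤o K L (ℕP.m⊔n≤o⇒m≤o (K ⊔ L) (N ⊔ M) l)
        N≤ : ∀ {i} → (K ⊔ L) ⊔ (N ⊔ M) ℕ.≤ i → N ℕ.≤ i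
        N≤ l = ℕP.m⊔n≤o⇒m≤o N M (ℕP.m⊔n≤o⇒n≤o (K ⊔ L) (N ⊔ M) l)
        M≤ : ∀ {i} → (K ⊔ L) ⊔ (N ⊔ M) ℕ.≤ i → M ℕ.≤ i
        M≤ l = ℕP.m⊔n≤o⇒n≤o N M (ℕP.m⊔n≤o⇒n≤o (K ⊔ L) (N ⊔ M) l)
        open ℚP.≤-Reasoning
    in begin-strict
      ∣ seq x m ℚ.* seq y m ℚ.- seq x n ℚ.* seq y n ∣
        ≡⟨ cong ∣_∣ (solve 4 (λ a b c d → a :* b :- c :* d := a :* (b :- d) :+ d :* (a :- c)) refl
             (seq x m) (seq y m) (seq x n) (seq y n)) ⟩
      ∣ seq x m ℚ.* (seq y m ℚ.- seq y n) ℚ.+ seq y n ℚ.* (seq x m ℚ.- seq x n) ∣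
        ≤⟨ ℚP.∣p+q∣≤∣p∣+∣q∣ (seq x m ℚ.* (seq y m ℚ.- seq y n)) (seq y n ℚ.* (seq x m ℚ.- seq x n)) ⟩
      ∣ seq x m ℚ.* (seq y m ℚ.- seq y n) ∣ ℚ.+ ∣ seq y n ℚ.* (seq x m ℚ.- seq x n) ∣
        <⟨ ℚP.+-mono-<
             (scale-< {seq x m} {seq y m ℚ.- seq y n} B>0 (b m (K≤ l₁)) (g m n (M≤ l₁) (M≤ l₂)))
             (scale-< {seq y n} {seq x m ℚ.- seq x n} C>0 (c n (L≤ l₂)) (h m n (N≤ l₁) (N≤ l₂))) ⟩
      B ℚ.* Y.δ ℚ.+ C ℚ.* X.δ
        ≡⟨ cong₂ ℚ._+_ Y.Bδ≡c X.Bδ≡c ⟩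
      ½ ℚ.* ε ℚ.+ ½ ℚ.* ε
        ≡⟨ halves ε ⟩
      ε ∎

infixl 6 _+_ _-_
infixl 7 _*_
infix  8 -_
infixr 8 _^_

fromℚ : ℚ → ℝ
fromℚ q = mkℝ (λ _ → q) (const-cauchy q)

fromℕ : ℕ → ℝ
fromℕ n = fromℚ (+ n ℚ./ 1)

0ℝ 1ℝ : ℝ
0ℝ = fromℚ 0ℚ
1ℝ = fromℚ 1ℚ

-_ : ℝ → ℝ
- x = mkℝ (λ n → ℚ.- seq x n) (neg-cauchy x)

_+_ _-_ _*_ : ℝ → ℝ → ℝ
x + y = mkℝ (λ n → seq x n ℚ.+ seq y n) (+-cauchy x y)
x - y = x + - y
x * y = mkℝ (λ n → seq x n ℚ.* seq y n) (*-cauchy x y)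

private
  inverse-diff : ∀ a b p q → p ℚ.* a ≡ 1ℚ → q ℚ.* b ≡ 1ℚ →
                 a ℚ.- b ≡ a ℚ.* (b ℚ.* (q ℚ.- p))
  inverse-diff a b p q pa qb = sym (let open ≡-Reasoning in begin
    a ℚ.* (b ℚ.* (q ℚ.- p))
      ≡⟨ solve 4 (λ a b p q → a :* (b :* (q :- p)) := (q :* b) :* a :- (p :* a) :* b) refl a b p q ⟩
    (q ℚ.* b) ℚ.* a ℚ.- (p ℚ.* a) ℚ.* b
      ≡⟨ cong₂ (λ x y → x ℚ.* a ℚ.- y ℚ.* b) qb pa ⟩
    1ℚ ℚ.* a ℚ.- 1ℚ ℚ.* b
      ≡⟨ cong₂ ℚ._-_ (ℚP.*-identityˡ a) (ℚP.*-identityˡ b) ⟩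
    a ℚ.- b ∎)

  inverse-≤ : ∀ {c d t u} → 0ℚ ℚ.< d → 0ℚ ℚ.< u →
              c ℚ.* d ≡ 1ℚ → t ℚ.* u ≡ 1ℚ → c ℚ.≤ t → u ℚ.≤ d
  inverse-≤ {c} {d} {t} {u} d>0 u>0 cd tu c≤t = let open ℚP.≤-Reasoning in begin
    u                  ≡⟨ sym (ℚP.*-identityˡ u) ⟩
    1ℚ ℚ.* u           ≡⟨ cong (ℚ._* u) (sym cd) ⟩
    (c ℚ.* d) ℚ.* u    ≡⟨ solve 3 (λ c d u → (c :* d) :* u := d :* (c :* u)) refl c d u ⟩
    d ℚ.* (c ℚ.* u)    ≤⟨ ℚP.*-monoˡ-≤-nonNeg d {{ℚ.nonNegative (ℚP.<⇒≤ d>0)}}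
                           (ℚP.*-monoʳ-≤-nonNeg u {{ℚ.nonNegative (ℚP.<⇒≤ u>0)}} c≤t) ⟩
    d ℚ.* (t ℚ.* u)    ≡⟨ cong (d ℚ.*_) tu ⟩
    d ℚ.* 1ℚ           ≡⟨ ℚP.*-identityʳ d ⟩
    d                  ∎

  inverse-cauchy : ∀ {d} (t u : ℕ → ℚ) → IsCauchy t → 0ℚ ℚ.< d →
                   (∀ n → ∣ u n ∣ ℚ.≤ d) → (∀ n → t n ℚ.* u n ≡ 1ℚ) → IsCauchy u
  inverse-cauchy {d} t u ct d>0 u≤d tu ε ε>0 =
    let module S₁ = Shrink d ε d>0 ε>0
        module S₂ = Shrink d S₁.δ d>0 S₁.δ>0
        (M , h) = ct S₂.δ S₂.δ>0
    in M , λ m n l₁ l₂ → let open ℚP.≤-Reasoning in begin-strict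
      ∣ u m ℚ.- u n ∣
        ≡⟨ cong ∣_∣ (inverse-diff (u m) (u n) (t m) (t n) (tu m) (tu n)) ⟩
      ∣ u m ℚ.* (u n ℚ.* (t n ℚ.- t m)) ∣
        <⟨ scale-< {u m} {u n ℚ.* (t n ℚ.- t m)} d>0 (u≤d m)
             (scale-< {u n} {t n ℚ.- t m} d>0 (u≤d n) (h n m l₂ l₁)) ⟩
      d ℚ.* (d ℚ.* S₂.δ)
        ≡⟨ trans (cong (d ℚ.*_) S₂.Bδ≡c) S₁.Bδ≡c ⟩
      ε ∎

1/⁺ : ∀ q → 0ℚ ℚ.< q → ℚ
1/⁺ q q>0 = (ℚ.1/ q) {{ℚP.pos⇒nonZero q {{ℚ.positive q>0}}}}

1/⁺-inverse : ∀ q q>0 → q ℚ.* 1/⁺ q q>0 ≡ 1ℚ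
1/⁺-inverse q q>0 = ℚP.*-inverseʳ q {{ℚP.pos⇒nonZero q {{ℚ.positive q>0}}}}

1/⁺>0 : ∀ q q>0 → 0ℚ ℚ.< 1/⁺ q q>0
1/⁺>0 q q>0 = ℚP.positive⁻¹ (1/⁺ q q>0) {{ℚP.1/pos⇒pos q {{ℚ.positive q>0}}}}

-- x is bounded below by c from index N on; the shift makes every
-- denominator positive.
module Reciprocal (x : ℝ) (x>0 : 0ℝ < x) where
  private
    c : ℚ
    c = proj₁ x>0

    c>0 : 0ℚ ℚ.< c
    c>0 = proj₁ (proj₂ x>0)

    N : ℕ
    N = proj₁ (proj₂ (proj₂ x>0))

  shifted : ℕ → ℚ
  shifted n = seq x (N ℕ.+ n)

  abstract
    c≤shifted : ∀ n → c ℚ.≤ shifted n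
    c≤shifted n = subst (ℚ._≤ shifted n) (ℚP.+-identityˡ c)
      (proj₂ (proj₂ (proj₂ x>0)) (N ℕ.+ n) (ℕP.m≤m+n N n))

    shifted>0 : ∀ n → 0ℚ ℚ.< shifted n
    shifted>0 n = ℚP.<-≤-trans c>0 (c≤shifted n)

  inverse : ℕ → ℚ
  inverse n = 1/⁺ (shifted n) (shifted>0 n)

  abstract
    inverse-isCauchy : IsCauchy inverse
    inverse-isCauchy = inverse-cauchy shifted inverse ct (1/⁺>0 c c>0) ∣u∣≤
                         (λ n → 1/⁺-inverse (shifted n) (shifted>0 n))
      where
      ∣u∣≤ : ∀ n → ∣ inverse n ∣ ℚ.≤ 1/⁺ c c>0
      ∣u∣≤ n = subst (ℚ._≤ 1/⁺ c c>0)
        (sym (ℚP.0≤p⇒∣p∣≡p (ℚP.<⇒≤ (1/⁺>0 (shifted n) (shifted>0 n)))))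
        (inverse-≤ {c} {1/⁺ c c>0} {shifted n} {inverse n}
          (1/⁺>0 c c>0) (1/⁺>0 (shifted n) (shifted>0 n))
          (1/⁺-inverse c c>0) (1/⁺-inverse (shifted n) (shifted>0 n)) (c≤shifted n))

      ct : IsCauchy shifted
      ct ε ε>0 = let (K , g) = cauchy x ε ε>0 in K , λ m n l₁ l₂ →
        g (N ℕ.+ m) (N ℕ.+ n) (ℕP.≤-trans l₁ (ℕP.m≤n+m m N)) (ℕP.≤-trans l₂ (ℕP.m≤n+m n N))

recip : (x : ℝ) → 0ℝ < x → ℝ
recip x x>0 = mkℝ inverse inverse-isCauchy
  where open Reciprocal x x>0

_^_ : ℝ → ℕ → ℝ
x ^ zero  = 1ℝ
x ^ suc n = x * x ^ n

-- The value at denominator 0 is junk; it only ever occurs outside the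
-- ranges over which limits are taken.
_÷_ : ℕ → ℕ → ℝ
a ÷ zero  = 0ℝ
a ÷ suc b = fromℚ (+ a ℚ./ suc b)

sum : ℕ → (ℕ → ℝ) → ℝ
sum zero    f = 0ℝ
sum (suc n) f = sum n f + f n

------------------------------------------------------------------------
-- Limits along an index set I, "i → ∞" meaning ∥ i ∥ → ∞

module Limit {I : Set} (∥_∥ : I → ℕ) where

  Eventually Frequently : (I → Set) → Set
  Eventually P = ∃ λ N → ∀ i → N ℕ.≤ ∥ i ∥ → P i
  Frequently P = ∀ N → ∃ λ i → N ℕ.≤ ∥ i ∥ × P i

  Converges : (I → ℝ) → ℝ → Set
  Converges f a = ∀ ε → 0ℚ ℚ.< ε →
    Eventually λ i → a - fromℚ ε < f i × f i < a + fromℚ ε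

  -- These two also make sense when the lower limit is infinite.
  liminf≥ liminf≤ : (I → ℝ) → ℝ → Set
  liminf≥ f a = ∀ ε → 0ℚ ℚ.< ε → Eventually λ i → a - fromℚ ε < f i
  liminf≤ f a = ∀ ε → 0ℚ ℚ.< ε → Frequently λ i → f i < a + fromℚ ε

  IsLiminf : (I → ℝ) → ℝ → Set
  IsLiminf f a = liminf≥ f a × liminf≤ f a

ℙ : Set
ℙ = Σ ℕ Prime

module Limℕ = Limit {ℕ} (λ n → n)
module Limℙ = Limit {ℙ} proj₁

HasSum : (ℕ → ℝ) → ℝ → Set
HasSum f s = Limℕ.Converges (λ n → sum n f) s

------------------------------------------------------------------------
-- Exponentials, real powers, Poisson variables

-- y = eˣ
IsExp : ℝ → ℝ → Set
IsExp x y = HasSum (λ j → (1 ÷ (j !)) * x ^ j) y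

-- z = nʸ = exp (y · log n), where L = log n is determined by e^L = n
IsPower : ℕ → ℝ → ℝ → Set
IsPower n y z = ∃ λ L → IsExp L (fromℕ n) × IsExp (y * L) z

IsPoisson : ℝ → (ℕ → ℝ) → Set
IsPoisson mean π = ∃ λ e →
  IsExp (- mean) e × (∀ j → π j ≈ e * ((1 ÷ (j !)) * mean ^ j))

-- m = 𝔼 [min {ℓ , Pois mean}]
IsTruncatedMean : ℕ → ℝ → ℝ → Set
IsTruncatedMean ℓ mean m = ∃ λ π →
  IsPoisson mean π × HasSum (λ j → fromℕ (ℓ ⊓ j) * π j) m

IsRoot : ℕ → ℕ → ℝ → Set
IsRoot k ℓ ρ = IsTruncatedMean ℓ (fromℕ k * ρ) ρ

------------------------------------------------------------------------
-- Probability spaces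

-- In ⋃-event the summability premise is classically automatic (the partial
-- sums are monotone and bounded by 1), so classically these are exactly the
-- countably additive probability measures on σ-algebras.  Without the
-- premise even a one-point space would require the limited principle of
-- omniscience.
record ProbabilitySpace : Set₂ where
  field
    Ω           : Set
    Event       : Pred Ω 0ℓ → Set₁
    ℙr          : (A : Pred Ω 0ℓ) → Event A → ℝ
    Event-resp  : ∀ {A B} → A ≐ B → Event A → Event B
    U-event     : Event U
    ∅-event     : Event ∅
    ∁-event     : ∀ {A} → Event A → Event (∁ A)
    ∩-event     : ∀ {A B} → Event A → Event B → Event (A ∩ B)
    ℙr-cong     : ∀ {A B} (a : Event A) (b : Event B) → A ≐ B → ℙr A a ≈ ℙr B b
    ℙr-nonneg   : ∀ {A} (a : Event A) → 0ℝ ≤ ℙr A a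
    ℙr-U        : ℙr U U-event ≈ 1ℝ
    ℙr-∅        : ℙr ∅ ∅-event ≈ 0ℝ
    ⋃-event     : (A : ℕ → Pred Ω 0ℓ) (a : ∀ n → Event (A n)) →
                  (∀ {m n} → m ≢ n → ∀ ω → A m ω → ¬ A n ω) →
                  ∀ s → HasSum (λ n → ℙr (A n) (a n)) s →
                  Σ (Event (⋃ ℕ A)) λ e → ℙr (⋃ ℕ A) e ≈ s

------------------------------------------------------------------------
-- Sketches

-- i : Fin (p ∸ 1) stands for the nonzero residue i + 1 modulo p.
∣𝒰*∣ : ℙ → ℕ
∣𝒰*∣ (p , _) = p ℕ.∸ 1

𝒰* : ℙ → Set
𝒰* V = Fin (∣𝒰*∣ V)

Set* : ℙ → Set
Set* V = Subset (∣𝒰*∣ V)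

subsets : ∀ n → List (Subset n)
subsets zero    = [] ∷ []
subsets (suc n) = map (false ∷_) (subsets n) ++ map (true ∷_) (subsets n)

subsetsOfSize : ∀ n → ℕ → List (Subset n)
subsetsOfSize n d = filter (λ A → card A ℕP.≟ d) (subsets n)

_≟ᵒ_ : ∀ {n} → DecidableEquality (Subset n × Subset n)
_≟ᵒ_ = ×-≡-dec (Vec-≡-dec _≟ᵇ_) (Vec-≡-dec _≟ᵇ_)

-- The scheme used for a single pair (d , V), with M cells.
record Sketch (k M d : ℕ) (V : ℙ) : Set₂ where
  field
    space : ProbabilitySpace
    size  : Vec ℕ M
  open ProbabilitySpace space public

  State : Set
  State = All Fin size

  cell : State → (i : Fin M) → Fin (Vec.lookup size i)
  cell = lookup⁺

  field
    Enc     : Ω → Set* V → State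
    Upd     : Ω → 𝒰* V → State → State
    Dec     : Ω → State → State → Set* V × Set* V
    support : Ω → 𝒰* V → Subset M

    support-size  : ∀ ω x → card (support ω x) ℕ.≤ k
    fixed-support : ∀ ω x σ i → i ∉ support ω x → cell (Upd ω x σ) i ≡ cell σ i
    canonical     : ∀ ω A x → x ∉ A → Enc ω (A ∪ ⁅ x ⁆) ≡ Upd ω x (Enc ω A)

  total : ℕ
  total = length (subsetsOfSize (∣𝒰*∣ V) d)

  successes : Ω → ℕ
  successes ω = length (filter (λ D → Dec ω (Enc ω D) (Enc ω ⊥) ≟ᵒ (D , ⊥))
                               (subsetsOfSize (∣𝒰*∣ V) d))

  Succ^ : Ω → ℝ
  Succ^ ω = successes ω ÷ total

  field
    -- Succ^ is a random variable
    successes-event : ∀ j → Event (λ ω → successes ω ≡ j)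

  -- 𝔼 Succ^, as Succ^ takes only the values j / total with j ≤ total
  Succ : ℝ
  Succ = sum (suc total) λ j → (j ÷ total) * ℙr _ (successes-event j)

record Family (k ℓ : ℕ) : Set₂ where
  field
    M      : ℕ → ℕ
    sketch : ∀ d V → Sketch k (M d) d V
    r      : ℕ → ℙ → ℝ
    r→0    : ∀ d → Limℙ.Converges (r d) 0ℝ
    size≤  : (d : ℕ) (V : ℙ) (i : Fin (M d)) → ∃ λ z → IsPower (proj₁ V) (fromℕ ℓ + r d V) z ×
             fromℕ (Vec.lookup (Sketch.size (sketch d V)) i) ≤ z

  cost : ℕ → ℕ
  cost d = ℓ ℕ.* M d

  Succ : ℕ → ℙ → ℝ
  Succ d V = Sketch.Succ (sketch d V)

  WHPSuccessful : Set
  WHPSuccessful = ∃ λ s →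
    (∀ d → Limℙ.IsLiminf (Succ d) (s d)) × Limℕ.Converges s 1ℝ

-- Fix the randomness and let N_i be the number of elements of D that may write
-- to cell i.  By canonicality the elements of D may be inserted in any order;
-- inserting last those that do not write to cell i shows that this cell only
-- depends on the other N_i elements.  It therefore takes at most
-- V^{min {ℓ , N_i} + o(1)} values, and since decoding inverts the encoding on the
-- successful sets, all but a vanishing fraction of these satisfy
-- Σ_i min {ℓ , N_i} ≥ d.  For random D the sum has mean at most M 𝔼 min {ℓ , N}
-- up to o(d), where N is Poisson of mean k d / M: the variables N_i are nearly
-- binomial, their means add up to at most k d, and the mean of a concave function
-- of a binomial variable lies below its tangent in the success probability.
-- By Markov's inequality the success probability is bounded away from 1 if
-- M 𝔼 min {ℓ , N} ≤ (1 - δ) d.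
--
-- The root equation says that Σ_j (min {ℓ , j} - j / k) t^j / j! vanishes at
-- t = k ρ.  The coefficients are positive for 0 < j < k ℓ and negative for
-- j > k ℓ, so that the sum divided by t^{k ℓ} is strictly decreasing: this gives
-- existence and uniqueness of ρ, and negativity of the sum beyond k ρ.
module Submission where

open import Data.Nat.Base as ℕ using (ℕ; zero; suc; _!)
import Data.Nat.Properties as ℕP
open import Data.Product.Base using (Σ; ∃; _×_; _,_; proj₁; proj₂)
import Data.Rational.Base as ℚ
import Data.Rational.Properties as ℚP
open import Data.Sum.Base using (_⊎_; inj₁; inj₂)
open import Function.Base using (_∘_)
open import Level using (0ℓ)
open import Relation.Binary.PropositionalEquality hiding (J; [_])
open import Relation.Nullary.Decidable.Core using (yes; no; does; _×-dec_; dec⇒maybe)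
open import Relation.Nullary.Negation using (¬_; contradiction)
open import Relation.Unary using (Pred; Decidable)
open import Tactic.RingSolver using (solve-∀)
import Defs as ℝ
open import Defs using (ℝ; mkℝ; seq; cauchy; IsCauchy; HasSum; IsExp; IsPower; IsRoot; fromℕ; fromℚ; _÷_; 1/⁺; 1/⁺-inverse;
  recip; module Reciprocal; subsets; subsetsOfSize; _≟ᵒ_; ProbabilitySpace; Sketch; Family; module Limℕ; module Limℙ)

-- Signs of reals are undecidable, so the root is located on rational grids for truncated series,
-- and real statements are read off their approximations. Strict decrease is needed in quantitative
-- form: `separation` bounds the distance between near-zeros, which yields convergence, uniqueness
-- and negativity beyond the root.
--
-- For random D the N_i are hypergeometric. Sampling the d elements with repetition makes them
-- binomial: every d-set arises from d! tuples, so d! times a sum over d-sets is at most the sum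
-- over tuples, and for large V there are hardly more than d! tuples per d-set.
--
-- Cells may be written with different probabilities q_i, of which only Σ q_i ≤ k is known. One line
-- a + b q above all binomial means suffices, as it sums to at most M a + b k. It is the tangent at
-- odds t / d for a t slightly above kρ, where strict negativity leaves room for all errors.
--
-- As M does not depend on V, the exponent error of a cell can be made at most 1 / (2M + 1). All M
-- cells together then lose a factor O(√V), whereas a total load of at most d - 1 leaves a whole
-- factor V to spare.

module Rationals where

  open import Agda.Builtin.Int using () renaming (pos to ι)
  open import Data.Integer.Base as ℤ using ()
  import Data.Integer.Properties as ℤP
  open import Data.Rational.Base
  open import Data.Rational.Properties
  import Data.Rational.Unnormalised.Base as ℚᵘ
  import Data.Rational.Unnormalised.Properties as ℚᵘP
  open import Tactic.RingSolver.Core.AlmostCommutativeRing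
    using (AlmostCommutativeRing; fromCommutativeRing)

  ℚ-ring : AlmostCommutativeRing 0ℓ 0ℓ
  ℚ-ring = fromCommutativeRing +-*-commutativeRing λ x → dec⇒maybe (0ℚ ≟ x)

  0<1 : 0ℚ < 1ℚ
  0<1 = positive⁻¹ 1ℚ

  0≤1 : 0ℚ ≤ 1ℚ
  0≤1 = <⇒≤ 0<1

  0<½ : 0ℚ < ½
  0<½ = positive⁻¹ ½

  -- The form in which polynomial inequalities are proved: a visibly nonnegative difference `e` is
  -- supplied, and the ring solver checks the identity.
  ≤-cert : ∀ {p q} e → 0ℚ ≤ e → q ≡ p + e → p ≤ q
  ≤-cert {p} {q} e e≥0 q≡ = subst₂ _≤_ (+-identityʳ p) (sym q≡) (+-monoʳ-≤ p e≥0)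

  <-cert : ∀ {p q} e → 0ℚ < e → q ≡ p + e → p < q
  <-cert {p} {q} e e>0 q≡ = subst₂ _<_ (+-identityʳ p) (sym q≡) (+-monoʳ-< p e>0)

  diff≥0 : ∀ {p q} → p ≤ q → 0ℚ ≤ q - p
  diff≥0 {p} {q} p≤q = subst (_≤ q - p) (+-inverseʳ p) (+-monoˡ-≤ (- p) p≤q)

  diff>0 : ∀ {p q} → p < q → 0ℚ < q - p
  diff>0 {p} {q} p<q = subst (_< q - p) (+-inverseʳ p) (+-monoˡ-< (- p) p<q)

  neg≥0 : ∀ {p} → p ≤ 0ℚ → 0ℚ ≤ - p
  neg≥0 p≤0 = neg-antimono-≤ p≤0

  +≥0 : ∀ {p q} → 0ℚ ≤ p → 0ℚ ≤ q → 0ℚ ≤ p + q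
  +≥0 p≥0 q≥0 = +-mono-≤ p≥0 q≥0

  *≥0 : ∀ {p q} → 0ℚ ≤ p → 0ℚ ≤ q → 0ℚ ≤ p * q
  *≥0 {p} {q} p≥0 q≥0 = nonNegative⁻¹ (p * q)
    {{nonNeg*nonNeg⇒nonNeg p {{nonNegative p≥0}} q {{nonNegative q≥0}}}}

  *>0 : ∀ {p q} → 0ℚ < p → 0ℚ < q → 0ℚ < p * q
  *>0 {p} {q} p>0 q>0 = positive⁻¹ (p * q)
    {{pos*pos⇒pos p {{positive p>0}} q {{positive q>0}}}}

  +>0 : ∀ {p q} → 0ℚ < p → 0ℚ ≤ q → 0ℚ < p + q
  +>0 p>0 q≥0 = +-mono-<-≤ p>0 q≥0

  *-monoˡ : ∀ {p q} r → 0ℚ ≤ r → p ≤ q → r * p ≤ r * q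
  *-monoˡ r r≥0 = *-monoˡ-≤-nonNeg r {{nonNegative r≥0}}

  *-monoʳ : ∀ {p q} r → 0ℚ ≤ r → p ≤ q → p * r ≤ q * r
  *-monoʳ r r≥0 = *-monoʳ-≤-nonNeg r {{nonNegative r≥0}}

  *-mono : ∀ {p q r s} → 0ℚ ≤ p → 0ℚ ≤ s → p ≤ q → r ≤ s → p * r ≤ q * s
  *-mono {p} {q} {r} {s} p≥0 s≥0 p≤q r≤s = ≤-trans (*-monoˡ p p≥0 r≤s) (*-monoʳ s s≥0 p≤q)

  *-cancelˡ-≤ : ∀ {p q} r → 0ℚ < r → r * p ≤ r * q → p ≤ q
  *-cancelˡ-≤ r r>0 = *-cancelˡ-≤-pos r {{positive r>0}}

  *-monoˡ-< : ∀ {p q} r → 0ℚ < r → p < q → r * p < r * q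
  *-monoˡ-< r r>0 = *-monoʳ-<-pos r {{positive r>0}}

  *-cancelˡ-< : ∀ {p q} r → 0ℚ ≤ r → r * p < r * q → p < q
  *-cancelˡ-< r r≥0 = *-cancelˡ-<-nonNeg r {{nonNegative r≥0}}

  *-cancelˡ-≡ : ∀ {p q} r → 0ℚ < r → r * p ≡ r * q → p ≡ q
  *-cancelˡ-≡ r r>0 e = ≤-antisym (*-cancelˡ-≤ r r>0 (≤-reflexive e))
                                  (*-cancelˡ-≤ r r>0 (≤-reflexive (sym e)))

  square≥0 : ∀ p → 0ℚ ≤ p * p
  square≥0 p with ≤-total 0ℚ p
  ... | inj₁ p≥0 = *≥0 p≥0 p≥0
  ... | inj₂ p≤0 = subst (0ℚ ≤_) (eq p) (*≥0 (neg≥0 p≤0) (neg≥0 p≤0))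
    where
    eq : ∀ p → - p * - p ≡ p * p
    eq = solve-∀ ℚ-ring

  p≤∣p∣ : ∀ p → p ≤ ∣ p ∣
  p≤∣p∣ p with ≤-total 0ℚ p
  ... | inj₁ p≥0 = ≤-reflexive (sym (0≤p⇒∣p∣≡p p≥0))
  ... | inj₂ p≤0 = ≤-trans p≤0 (0≤∣p∣ p)

  -p≤∣p∣ : ∀ p → - p ≤ ∣ p ∣
  -p≤∣p∣ p = subst (- p ≤_) (∣-p∣≡∣p∣ p) (p≤∣p∣ (- p))

  ∣∣≤-intro : ∀ {p b} → p ≤ b → - p ≤ b → ∣ p ∣ ≤ b
  ∣∣≤-intro {p} h₁ h₂ with ∣p∣≡p∨∣p∣≡-p p
  ... | inj₁ e = subst (_≤ _) (sym e) h₁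
  ... | inj₂ e = subst (_≤ _) (sym e) h₂

  ∣p-q∣≡∣q-p∣ : ∀ p q → ∣ p - q ∣ ≡ ∣ q - p ∣
  ∣p-q∣≡∣q-p∣ p q = trans (cong ∣_∣ (eq p q)) (∣-p∣≡∣p∣ (q - p))
    where
    eq : ∀ p q → p - q ≡ - (q - p)
    eq = solve-∀ ℚ-ring

  ∣p-r∣≤ : ∀ p q r → ∣ p - r ∣ ≤ ∣ p - q ∣ + ∣ q - r ∣
  ∣p-r∣≤ p q r = subst (λ x → ∣ x ∣ ≤ ∣ p - q ∣ + ∣ q - r ∣) (eq p q r) (∣p+q∣≤∣p∣+∣q∣ (p - q) (q - r))
    where
    eq : ∀ p q r → (p - q) + (q - r) ≡ p - r
    eq = solve-∀ ℚ-ring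

  -- Unlike + n / 1, this computes on suc, so the ring solver can see through it.
  nat : ℕ → ℚ
  nat zero    = 0ℚ
  nat (suc n) = 1ℚ + nat n

  nat≥0 : ∀ n → 0ℚ ≤ nat n
  nat≥0 zero    = ≤-refl
  nat≥0 (suc n) = +≥0 0≤1 (nat≥0 n)

  nat>0 : ∀ n → 0ℚ < nat (suc n)
  nat>0 n = +>0 0<1 (nat≥0 n)

  nat-+ : ∀ m n → nat (m ℕ.+ n) ≡ nat m + nat n
  nat-+ zero    n = sym (+-identityˡ (nat n))
  nat-+ (suc m) n = trans (cong (1ℚ +_) (nat-+ m n)) (sym (+-assoc 1ℚ (nat m) (nat n)))

  nat-* : ∀ m n → nat (m ℕ.* n) ≡ nat m * nat n
  nat-* zero    n = sym (*-zeroˡ (nat n))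
  nat-* (suc m) n = trans (nat-+ n (m ℕ.* n)) (trans (cong (_+_ (nat n)) (nat-* m n)) (eq (nat m) (nat n)))
    where
    eq : ∀ a b → b + a * b ≡ (1ℚ + a) * b
    eq = solve-∀ ℚ-ring

  nat-mono : ∀ {m n} → m ℕ.≤ n → nat m ≤ nat n
  nat-mono {n = n} ℕ.z≤n = nat≥0 n
  nat-mono (ℕ.s≤s l) = +-monoʳ-≤ 1ℚ (nat-mono l)

  nat-mono-< : ∀ {m n} → m ℕ.< n → nat m < nat n
  nat-mono-< {m} l = <-≤-trans (<-cert 1ℚ 0<1 (+-comm 1ℚ (nat m))) (nat-mono l)

  nat-cancel-≤ : ∀ {m n} → nat m ≤ nat n → m ℕ.≤ n
  nat-cancel-≤ {m} {n} l = ℕP.≮⇒≥ λ n<m → <-irrefl refl (<-≤-trans (nat-mono-< n<m) l)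

  1≤nat : ∀ n → 1ℚ ≤ nat (suc n)
  1≤nat n = ≤-cert (nat n) (nat≥0 n) refl

  private
    toℚᵘ-nat : ∀ n → toℚᵘ (nat n) ℚᵘ.≃ (ι n) ℚᵘ./ 1
    toℚᵘ-nat zero    = ℚᵘ.*≡* refl
    toℚᵘ-nat (suc n) = ℚᵘP.≃-trans (toℚᵘ-homo-+ 1ℚ (nat n))
      (ℚᵘP.≃-trans (ℚᵘP.+-cong (ℚᵘP.≃-refl {toℚᵘ 1ℚ}) (toℚᵘ-nat n))
        (ℚᵘ.*≡* (cong (ℤ._* ι 1) (cong (ℤ._+_ (ι 1)) (ℤP.*-identityʳ (ι n))))))

    toℚᵘ-/ : ∀ i d .{{_ : ℕ.NonZero d}} → toℚᵘ (i / d) ℚᵘ.≃ i ℚᵘ./ d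
    toℚᵘ-/ i (suc d) = toℚᵘ-fromℚᵘ (i ℚᵘ./ suc d)

  nat≡ : ∀ n → ι n / 1 ≡ nat n
  nat≡ n = toℚᵘ-injective (ℚᵘP.≃-trans (toℚᵘ-/ (ι n) 1) (ℚᵘP.≃-sym (toℚᵘ-nat n)))

  nat-/ : ∀ a b → nat (suc b) * (ι a / suc b) ≡ nat a
  nat-/ a b = toℚᵘ-injective (ℚᵘP.≃-trans (toℚᵘ-homo-* (nat (suc b)) (ι a / suc b))
    (ℚᵘP.≃-trans (ℚᵘP.*-cong (toℚᵘ-nat (suc b)) (toℚᵘ-/ (ι a) (suc b)))
      (ℚᵘP.≃-trans (ℚᵘ.*≡* (trans (ℤP.*-identityʳ (ι (suc b) ℤ.* ι a))
          (trans (ℤP.*-comm (ι (suc b)) (ι a)) (cong (λ n → ι a ℤ.* ι n) (sym (ℕP.*-identityˡ (suc b)))))))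
        (ℚᵘP.≃-sym (toℚᵘ-nat a)))))

  inv : ℕ → ℚ
  inv n = ι 1 / suc n

  nat-inv : ∀ n → nat (suc n) * inv n ≡ 1ℚ
  nat-inv n = nat-/ 1 n

  inv>0 : ∀ n → 0ℚ < inv n
  inv>0 n = *-cancelˡ-< (nat (suc n)) (<⇒≤ (nat>0 n))
    (subst₂ _<_ (sym (*-zeroʳ (nat (suc n)))) (sym (nat-inv n)) 0<1)

  -- Opaque because unfolding these witnesses makes conversion checking very slow.
  opaque
    archimedean : ∀ p → ∃ λ n → p ≤ nat n
    archimedean (mkℚ (ι n) d-1 c) = n , ≤-trans (≤-cert {q = nat (suc d-1) * p} (nat d-1 * p) (*≥0 (nat≥0 d-1) p≥0) (eq (nat d-1) p)) (≤-reflexive lem)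
      where
      p : ℚ
      p = mkℚ (ι n) d-1 c
      p≡ : p ≡ ι n / suc d-1
      p≡ = sym (↥p/↧p≡p p)
      lem : nat (suc d-1) * p ≡ nat n
      lem = trans (cong (nat (suc d-1) *_) p≡) (nat-/ n d-1)
      p≥0 : 0ℚ ≤ p
      p≥0 = nonNegative⁻¹ p
      eq : ∀ d p → (1ℚ + d) * p ≡ p + d * p
      eq = solve-∀ ℚ-ring
    archimedean p@(mkℚ ℤ.-[1+ _ ] _ _) = 0 , <⇒≤ (negative⁻¹ p)

    archimedean-* : ∀ p ε → 0ℚ < ε → ∃ λ n → p ≤ nat n * ε
    archimedean-* p ε ε>0 = let (n , h) = archimedean (p * i) in
      n , subst (_≤ nat n * ε) (trans (*-assoc p i ε) (trans (cong (p *_) (*-inverseˡ ε)) (*-identityʳ p)))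
            (*-monoʳ ε (<⇒≤ ε>0) h)
      where
      instance
        ε≢0 : NonZero ε
        ε≢0 = pos⇒nonZero ε {{positive ε>0}}
      i : ℚ
      i = 1/ ε

    small-inv : ∀ ε → 0ℚ < ε → ∃ λ n → inv n ≤ ε
    small-inv ε ε>0 = let (n , h) = archimedean-* 1ℚ ε ε>0 in
      n , *-cancelˡ-≤ (nat (suc n)) (nat>0 n)
        (subst (_≤ nat (suc n) * ε) (sym (nat-inv n))
          (≤-trans h (*-monoʳ {nat n} {nat (suc n)} ε (<⇒≤ ε>0) (≤-cert 1ℚ 0≤1 (+-comm 1ℚ (nat n))))))

    quotient : ∀ b ε → 0ℚ < b → 0ℚ < ε → ∃ λ δ → 0ℚ < δ × b * δ ≡ ε
    quotient b ε b>0 ε>0 = i * ε , *>0 i>0 ε>0 ,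
      trans (sym (*-assoc b i ε)) (trans (cong (_* ε) (*-inverseʳ b)) (*-identityˡ ε))
      where
      instance
        b≢0 : NonZero b
        b≢0 = pos⇒nonZero b {{positive b>0}}
      i : ℚ
      i = 1/ b
      i>0 : 0ℚ < i
      i>0 = positive⁻¹ i {{1/pos⇒pos b {{positive b>0}}}}

  infixr 8 _^_
  _^_ : ℚ → ℕ → ℚ
  x ^ zero  = 1ℚ
  x ^ suc n = x * x ^ n

  ^≥0 : ∀ {x} → 0ℚ ≤ x → ∀ n → 0ℚ ≤ x ^ n
  ^≥0 x≥0 zero    = 0≤1
  ^≥0 x≥0 (suc n) = *≥0 x≥0 (^≥0 x≥0 n)

  ^>0 : ∀ {x} → 0ℚ < x → ∀ n → 0ℚ < x ^ n
  ^>0 x>0 zero    = 0<1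
  ^>0 x>0 (suc n) = *>0 x>0 (^>0 x>0 n)

  ^-mono : ∀ {x y} → 0ℚ ≤ x → x ≤ y → ∀ n → x ^ n ≤ y ^ n
  ^-mono x≥0 x≤y zero    = ≤-refl
  ^-mono x≥0 x≤y (suc n) = *-mono x≥0 (^≥0 (≤-trans x≥0 x≤y) n) x≤y (^-mono x≥0 x≤y n)

  ^-+ : ∀ x m n → x ^ (m ℕ.+ n) ≡ x ^ m * x ^ n
  ^-+ x zero    n = sym (*-identityˡ (x ^ n))
  ^-+ x (suc m) n = trans (cong (x *_) (^-+ x m n)) (sym (*-assoc x (x ^ m) (x ^ n)))

  nat-^ : ∀ a n → nat (a ℕ.^ n) ≡ nat a ^ n
  nat-^ a zero    = refl
  nat-^ a (suc n) = trans (nat-* a (a ℕ.^ n)) (cong (nat a *_) (nat-^ a n))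

  ∑ : ℕ → (ℕ → ℚ) → ℚ
  ∑ zero    f = 0ℚ
  ∑ (suc n) f = ∑ n f + f n

  ∑-cong : ∀ n {f g} → (∀ j → j ℕ.< n → f j ≡ g j) → ∑ n f ≡ ∑ n g
  ∑-cong zero    h = refl
  ∑-cong (suc n) h = cong₂ _+_ (∑-cong n λ j l → h j (ℕP.m<n⇒m<1+n l)) (h n ℕP.≤-refl)

  ∑-mono : ∀ n {f g} → (∀ j → j ℕ.< n → f j ≤ g j) → ∑ n f ≤ ∑ n g
  ∑-mono zero    h = ≤-refl
  ∑-mono (suc n) h = +-mono-≤ (∑-mono n λ j l → h j (ℕP.m<n⇒m<1+n l)) (h n ℕP.≤-refl)

  ∑-+ : ∀ n f g → ∑ n (λ j → f j + g j) ≡ ∑ n f + ∑ n g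
  ∑-+ zero    f g = refl
  ∑-+ (suc n) f g = trans (cong (_+ (f n + g n)) (∑-+ n f g)) (eq (∑ n f) (∑ n g) (f n) (g n))
    where
    eq : ∀ a b c d → (a + b) + (c + d) ≡ (a + c) + (b + d)
    eq = solve-∀ ℚ-ring

  ∑-*ˡ : ∀ n a f → ∑ n (λ j → a * f j) ≡ a * ∑ n f
  ∑-*ˡ zero    a f = sym (*-zeroʳ a)
  ∑-*ˡ (suc n) a f = trans (cong (_+ a * f n) (∑-*ˡ n a f)) (sym (*-distribˡ-+ a (∑ n f) (f n)))

  ∑≥0 : ∀ n {f} → (∀ j → j ℕ.< n → 0ℚ ≤ f j) → 0ℚ ≤ ∑ n f
  ∑≥0 zero    h = ≤-refl
  ∑≥0 (suc n) h = +≥0 (∑≥0 n λ j l → h j (ℕP.m<n⇒m<1+n l)) (h n ℕP.≤-refl)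

  ∣∑∣≤ : ∀ n f → ∣ ∑ n f ∣ ≤ ∑ n (λ j → ∣ f j ∣)
  ∣∑∣≤ zero    f = ≤-refl
  ∣∑∣≤ (suc n) f = ≤-trans (∣p+q∣≤∣p∣+∣q∣ (∑ n f) (f n)) (+-monoˡ-≤ ∣ f n ∣ (∣∑∣≤ n f))

  ∑-extend : ∀ n i f → (∀ j → n ℕ.≤ j → 0ℚ ≤ f j) → ∑ n f ≤ ∑ (i ℕ.+ n) f
  ∑-extend n zero    f h = ≤-refl
  ∑-extend n (suc i) f h = ≤-cert (∑ (i ℕ.+ n) f - ∑ n f + f (i ℕ.+ n))
    (+≥0 (diff≥0 (∑-extend n i f h)) (h (i ℕ.+ n) (ℕP.m≤n+m n i))) (eq (∑ (i ℕ.+ n) f) (∑ n f) (f (i ℕ.+ n)))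
    where
    eq : ∀ a b c → a + c ≡ b + (a - b + c)
    eq = solve-∀ ℚ-ring

  ∑-monoˡ : ∀ {m n} f → m ℕ.≤ n → (∀ j → m ℕ.≤ j → 0ℚ ≤ f j) → ∑ m f ≤ ∑ n f
  ∑-monoˡ {m} {n} f m≤n h = subst (λ x → ∑ m f ≤ ∑ x f) (ℕP.m∸n+n≡m m≤n) (∑-extend m (n ℕ.∸ m) f h)

  ∑-suc : ∀ n f → ∑ (suc n) f ≡ f 0 + ∑ n (λ j → f (suc j))
  ∑-suc zero    f = +-comm 0ℚ (f 0)
  ∑-suc (suc n) f = trans (cong (_+ f (suc n)) (∑-suc n f))
                          (+-assoc (f 0) (∑ n (λ j → f (suc j))) (f (suc n)))

-- Truncated exponential series: tails, Lipschitz bounds, functional equation.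

module ExponentialSums where

  open import Data.Rational.Base
  open import Data.Rational.Properties 
  open Rationals

  -- t^j / j!, generated by its ratios so that neither factorials nor divisions occur.
  term : ℚ → ℕ → ℚ
  term t zero    = 1ℚ
  term t (suc j) = term t j * (t * inv j)

  expSum : ℚ → ℕ → ℚ
  expSum t J = ∑ J (term t)

  series : (ℕ → ℚ) → ℚ → ℕ → ℚ
  series c t J = ∑ J λ j → c j * term t j

  term-suc : ∀ t j → nat (suc j) * term t (suc j) ≡ t * term t j
  term-suc t j = trans (eq (nat (suc j)) (term t j) t (inv j))
    (trans (cong (_* (t * term t j)) (nat-inv j)) (*-identityˡ (t * term t j)))
    where
    eq : ∀ n x t i → n * (x * (t * i)) ≡ n * i * (t * x)
    eq = solve-∀ ℚ-ring

  term≥0 : ∀ {t} → 0ℚ ≤ t → ∀ j → 0ℚ ≤ term t j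
  term≥0 t≥0 zero    = 0≤1
  term≥0 t≥0 (suc j) = *≥0 (term≥0 t≥0 j) (*≥0 t≥0 (<⇒≤ (inv>0 j)))

  term-mono : ∀ {s t} → 0ℚ ≤ s → s ≤ t → ∀ j → term s j ≤ term t j
  term-mono s≥0 s≤t zero    = ≤-refl
  term-mono s≥0 s≤t (suc j) = *-mono (term≥0 s≥0 j)
    (*≥0 (≤-trans s≥0 s≤t) (<⇒≤ (inv>0 j))) (term-mono s≥0 s≤t j) (*-monoʳ (inv j) (<⇒≤ (inv>0 j)) s≤t)

  ∣term∣ : ∀ t j → ∣ term t j ∣ ≡ term ∣ t ∣ j
  ∣term∣ t zero    = refl
  ∣term∣ t (suc j) = trans (∣p*q∣≡∣p∣*∣q∣ (term t j) (t * inv j)) (cong₂ _*_ (∣term∣ t j)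
    (trans (∣p*q∣≡∣p∣*∣q∣ t (inv j)) (cong (∣ t ∣ *_) (0≤p⇒∣p∣≡p (<⇒≤ (inv>0 j))))))

  term-scale : ∀ a t j → term (a * t) j ≡ a ^ j * term t j
  term-scale a t zero    = refl
  term-scale a t (suc j) = trans (cong (_* (a * t * inv j)) (term-scale a t j)) (eq (a ^ j) a (term t j) t (inv j))
    where
    eq : ∀ p a x t i → p * x * (a * t * i) ≡ a * p * (x * (t * i))
    eq = solve-∀ ℚ-ring

  term-unfold : ∀ t j → ∃ λ c → 0ℚ < c × term t j ≡ c * t ^ j
  term-unfold t zero    = 1ℚ , 0<1 , refl
  term-unfold t (suc j) = let (c , c>0 , e) = term-unfold t j in
    c * inv j , *>0 c>0 (inv>0 j) ,
    trans (cong (_* (t * inv j)) e) (eq c (t ^ j) t (inv j))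
    where
    eq : ∀ c p t i → c * p * (t * i) ≡ c * i * (t * p)
    eq = solve-∀ ℚ-ring

  expSum≥0 : ∀ {t} → 0ℚ ≤ t → ∀ J → 0ℚ ≤ expSum t J
  expSum≥0 t≥0 J = ∑≥0 J λ j _ → term≥0 t≥0 j

  1≤expSum : ∀ {t} → 0ℚ ≤ t → ∀ J → 1ℚ ≤ expSum t (suc J)
  1≤expSum {t} t≥0 J = subst (1ℚ ≤_) (sym (∑-suc J (term t)))
    (≤-cert (∑ J λ j → term t (suc j)) (∑≥0 J λ j _ → term≥0 t≥0 (suc j)) refl)

  expSum-mono : ∀ {s t} → 0ℚ ≤ s → s ≤ t → ∀ J → expSum s J ≤ expSum t J
  expSum-mono s≥0 s≤t J = ∑-mono J λ j _ → term-mono s≥0 s≤t j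

  expSum-monoʳ : ∀ {t} → 0ℚ ≤ t → ∀ {J K} → J ℕ.≤ K → expSum t J ≤ expSum t K
  expSum-monoʳ {t} t≥0 J≤K = ∑-monoˡ (term t) J≤K λ j _ → term≥0 t≥0 j

  tail-mono : ∀ f g → (∀ j → ∣ f j ∣ ≤ g j) → ∀ {J K} → J ℕ.≤ K → ∣ ∑ K f - ∑ J f ∣ ≤ ∑ K g - ∑ J g
  tail-mono f g h {J} {K} J≤K = subst (λ n → ∣ ∑ n f - ∑ J f ∣ ≤ ∑ n g - ∑ J g) (ℕP.m∸n+n≡m J≤K) (go (K ℕ.∸ J))
    where
    eq₁ : ∀ a b c → a + c - b ≡ a - b + c
    eq₁ = solve-∀ ℚ-ring
    go : ∀ i → ∣ ∑ (i ℕ.+ J) f - ∑ J f ∣ ≤ ∑ (i ℕ.+ J) g - ∑ J g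
    go zero    = subst₂ _≤_ (sym (cong ∣_∣ (+-inverseʳ (∑ J f)))) (sym (+-inverseʳ (∑ J g))) ≤-refl
    go (suc i) = subst₂ _≤_ (cong ∣_∣ (sym (eq₁ (∑ (i ℕ.+ J) f) (∑ J f) (f (i ℕ.+ J)))))
                            (sym (eq₁ (∑ (i ℕ.+ J) g) (∑ J g) (g (i ℕ.+ J))))
      (≤-trans (∣p+q∣≤∣p∣+∣q∣ (∑ (i ℕ.+ J) f - ∑ J f) (f (i ℕ.+ J))) (+-mono-≤ (go i) (h (i ℕ.+ J))))

  expSum-tail : ∀ {t B} → ∣ t ∣ ≤ B → ∀ {J K} → J ℕ.≤ K →
                ∣ expSum t K - expSum t J ∣ ≤ expSum B K - expSum B J
  expSum-tail {t} {B} h = tail-mono (term t) (term B) λ j →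
    subst (_≤ term B j) (sym (∣term∣ t j)) (term-mono (0≤∣p∣ t) h j)

  2ℚ : ℚ
  2ℚ = 1ℚ + 1ℚ

  0≤2 : 0ℚ ≤ 2ℚ
  0≤2 = +≥0 0≤1 0≤1

  -- This growth is absorbed by the argument, since 2^j B^j / j! = (2B)^j / j!; hence all bounds
  -- below are exponential sums at 2B.
  Moderate : (ℕ → ℚ) → Set
  Moderate c = ∀ j → ∣ c j ∣ ≤ 2ℚ ^ j

  coefficient-bound : ∀ c → Moderate c → ∀ {t B} → ∣ t ∣ ≤ B → ∀ j → ∣ c j * term t j ∣ ≤ term (2ℚ * B) j
  coefficient-bound c hc {t} {B} h j = subst₂ _≤_ (sym (∣p*q∣≡∣p∣*∣q∣ (c j) (term t j))) (sym (term-scale 2ℚ B j))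
    (*-mono (0≤∣p∣ (c j)) (term≥0 (≤-trans (0≤∣p∣ t) h) j) (hc j)
      (subst (_≤ term B j) (sym (∣term∣ t j)) (term-mono (0≤∣p∣ t) h j)))

  series-tail : ∀ c → Moderate c → ∀ {t B} → ∣ t ∣ ≤ B → ∀ {J K} → J ℕ.≤ K →
                ∣ series c t K - series c t J ∣ ≤ expSum (2ℚ * B) K - expSum (2ℚ * B) J
  series-tail c hc h = tail-mono _ _ (coefficient-bound c hc h)

  -- The derivative of t^(j+1) / (j+1)! is t^j / j!. The induction rests on (j+1) D_(j+1) = (x - y)
  -- y^j / j! + x D_j for the differences D_j of the terms.
  term-lipschitz : ∀ {x y B} → ∣ x ∣ ≤ B → ∣ y ∣ ≤ B → ∀ j →
                   ∣ term x (suc j) - term y (suc j) ∣ ≤ ∣ x - y ∣ * term B j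
  term-lipschitz {x} {y} {B} hx hy j = *-cancelˡ-≤ (nat (suc j)) (nat>0 j)
    (subst (_≤ nat (suc j) * (∣ x - y ∣ * term B j)) (sym lhs) (go j))
    where
    D : ℕ → ℚ
    D j = term x j - term y j
    n≥0 : ∀ j → ∣ nat (suc j) ∣ ≡ nat (suc j)
    n≥0 j = 0≤p⇒∣p∣≡p (nat≥0 (suc j))
    eq₁ : ∀ n a b → n * (a - b) ≡ n * a - n * b
    eq₁ = solve-∀ ℚ-ring
    eq₂ : ∀ x y a b → x * a - y * b ≡ (x - y) * b + x * (a - b)
    eq₂ = solve-∀ ℚ-ring
    scaled : ∀ j → nat (suc j) * D (suc j) ≡ (x - y) * term y j + x * D j
    scaled j = trans (eq₁ (nat (suc j)) (term x (suc j)) (term y (suc j)))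
      (trans (cong₂ _-_ (term-suc x j) (term-suc y j)) (eq₂ x y (term x j) (term y j)))
    lhs : nat (suc j) * ∣ D (suc j) ∣ ≡ ∣ (x - y) * term y j + x * D j ∣
    lhs = trans (cong (_* ∣ D (suc j) ∣) (sym (n≥0 j)))
      (trans (sym (∣p*q∣≡∣p∣*∣q∣ (nat (suc j)) (D (suc j)))) (cong ∣_∣ (scaled j)))
    B≥0 : 0ℚ ≤ B
    B≥0 = ≤-trans (0≤∣p∣ x) hx
    first : ∀ j → ∣ (x - y) * term y j ∣ ≤ ∣ x - y ∣ * term B j
    first j = subst (_≤ ∣ x - y ∣ * term B j) (sym (∣p*q∣≡∣p∣*∣q∣ (x - y) (term y j)))
      (*-monoˡ ∣ x - y ∣ (0≤∣p∣ (x - y)) (subst (_≤ term B j) (sym (∣term∣ y j)) (term-mono (0≤∣p∣ y) hy j)))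
    eq₅ : ∀ B d t → B * (d * t) ≡ d * (B * t)
    eq₅ = solve-∀ ℚ-ring
    eq₆ : ∀ m d t → d * t + d * (m * t) ≡ (1ℚ + m) * (d * t)
    eq₆ = solve-∀ ℚ-ring
    go : ∀ j → ∣ (x - y) * term y j + x * D j ∣ ≤ nat (suc j) * (∣ x - y ∣ * term B j)
    go zero    = subst₂ _≤_ (cong ∣_∣ (eq₇ (x - y) x)) (eq₈ ∣ x - y ∣) ≤-refl
      where
      eq₇ : ∀ d x → d ≡ d * 1ℚ + x * (1ℚ - 1ℚ)
      eq₇ = solve-∀ ℚ-ring
      eq₈ : ∀ d → d ≡ (1ℚ + 0ℚ) * (d * 1ℚ)
      eq₈ = solve-∀ ℚ-ring
    go (suc j) = ≤-trans (∣p+q∣≤∣p∣+∣q∣ ((x - y) * term y (suc j)) (x * D (suc j)))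
      (≤-trans (+-mono-≤ (first (suc j)) second) (≤-reflexive (eq₆ (nat (suc j)) ∣ x - y ∣ (term B (suc j)))))
      where
      second : ∣ x * D (suc j) ∣ ≤ ∣ x - y ∣ * (nat (suc j) * term B (suc j))
      second = subst₂ _≤_ (sym (∣p*q∣≡∣p∣*∣q∣ x (D (suc j))))
        (trans (eq₅ B ∣ x - y ∣ (term B j)) (cong (∣ x - y ∣ *_) (sym (term-suc B j))))
        (*-mono (0≤∣p∣ x) (*≥0 (0≤∣p∣ (x - y)) (term≥0 B≥0 j)) hx (term-lipschitz hx hy j))

  -- The constant term cancels, and the remaining terms lose one degree; the coefficient bound
  -- 2^(j+1) against degree j leaves the extra factor 2.
  series-lipschitz : ∀ c → Moderate c → ∀ {x y B} → ∣ x ∣ ≤ B → ∣ y ∣ ≤ B → ∀ J →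
    ∣ series c x J - series c y J ∣ ≤ ∣ x - y ∣ * (2ℚ * expSum (2ℚ * B) J)
  series-lipschitz c hc {x} {y} {B} hx hy zero = subst (0ℚ ≤_) (eq ∣ x - y ∣) ≤-refl
    where
    eq : ∀ d → 0ℚ ≡ d * (2ℚ * 0ℚ)
    eq = solve-∀ ℚ-ring
  series-lipschitz c hc {x} {y} {B} hx hy (suc J) = ≤-trans (go J)
    (*-monoˡ ∣ x - y ∣ (0≤∣p∣ (x - y)) (*-monoˡ 2ℚ 0≤2 (expSum-monoʳ 2B≥0 (ℕP.n≤1+n J))))
    where
    B≥0 : 0ℚ ≤ B
    B≥0 = ≤-trans (0≤∣p∣ x) hx
    2B≥0 : 0ℚ ≤ 2ℚ * B
    2B≥0 = *≥0 0≤2 B≥0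
    eq₁ : ∀ c → 0ℚ + c * 1ℚ - (0ℚ + c * 1ℚ) ≡ 0ℚ
    eq₁ = solve-∀ ℚ-ring
    eq₂ : ∀ d → 0ℚ ≡ d * (2ℚ * 0ℚ)
    eq₂ = solve-∀ ℚ-ring
    eq₃ : ∀ a b c s t → (a + c * s) - (b + c * t) ≡ (a - b) + c * (s - t)
    eq₃ = solve-∀ ℚ-ring
    eq₄ : ∀ p d t → (2ℚ * p) * (d * t) ≡ d * (2ℚ * (p * t))
    eq₄ = solve-∀ ℚ-ring
    eq₅ : ∀ d a b → d * (2ℚ * a) + d * (2ℚ * b) ≡ d * (2ℚ * (a + b))
    eq₅ = solve-∀ ℚ-ring
    go : ∀ J → ∣ series c x (suc J) - series c y (suc J) ∣ ≤ ∣ x - y ∣ * (2ℚ * expSum (2ℚ * B) J)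
    go zero = subst₂ _≤_ (sym (cong ∣_∣ (eq₁ (c 0)))) (eq₂ ∣ x - y ∣) ≤-refl
    go (suc j) = subst₂ _≤_
      (sym (cong ∣_∣ (eq₃ (series c x (suc j)) (series c y (suc j)) (c (suc j)) (term x (suc j)) (term y (suc j)))))
      (eq₅ ∣ x - y ∣ (expSum (2ℚ * B) j) (term (2ℚ * B) j))
      (≤-trans (∣p+q∣≤∣p∣+∣q∣ (series c x (suc j) - series c y (suc j)) (c (suc j) * (term x (suc j) - term y (suc j))))
        (+-mono-≤ (go j) last))
      where
      last : ∣ c (suc j) * (term x (suc j) - term y (suc j)) ∣ ≤ ∣ x - y ∣ * (2ℚ * term (2ℚ * B) j)
      last = subst₂ _≤_ (sym (∣p*q∣≡∣p∣*∣q∣ (c (suc j)) (term x (suc j) - term y (suc j))))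
        (trans (eq₄ (2ℚ ^ j) ∣ x - y ∣ (term B j)) (cong (λ z → ∣ x - y ∣ * (2ℚ * z)) (sym (term-scale 2ℚ B j))))
        (*-mono (0≤∣p∣ (c (suc j))) (*≥0 (0≤∣p∣ (x - y)) (term≥0 B≥0 j)) (hc (suc j)) (term-lipschitz hx hy j))

  term-halves : ∀ {t j₀ j} → 0ℚ ≤ t → 2ℚ * t ≤ nat j₀ → j₀ ℕ.≤ j → 2ℚ * term t (suc j) ≤ term t j
  term-halves {t} {j₀} {j} t≥0 h l = *-cancelˡ-≤ (nat (suc j)) (nat>0 j)
    (≤-trans (≤-reflexive (trans (eq (nat (suc j)) (term t (suc j))) (trans (cong (2ℚ *_) (term-suc t j)) (eq′ t (term t j)))))
      (*-monoʳ (term t j) (term≥0 t≥0 j) (≤-trans h (nat-mono (ℕP.≤-trans l (ℕP.n≤1+n j))))))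
    where
    eq : ∀ n x → n * (2ℚ * x) ≡ 2ℚ * (n * x)
    eq = solve-∀ ℚ-ring
    eq′ : ∀ t x → 2ℚ * (t * x) ≡ 2ℚ * t * x
    eq′ = solve-∀ ℚ-ring

  -- Halving would give 2^(-i); the weaker 1 / (i + 1) can be fed directly to the Archimedean
  -- property, and its induction needs only 2 (i + 1) ≥ i + 2.
  term-decay : ∀ {t j₀} → 0ℚ ≤ t → 2ℚ * t ≤ nat j₀ → ∀ i → nat (suc i) * term t (i ℕ.+ j₀) ≤ term t j₀
  term-decay t≥0 h zero = ≤-reflexive (*-identityˡ _)
  term-decay {t} {j₀} t≥0 h (suc i) = ≤-trans
    (≤-cert (nat (suc i) * (a - 2ℚ * b) + nat i * b)
      (+≥0 (*≥0 (nat≥0 (suc i)) (diff≥0 (term-halves t≥0 h (ℕP.m≤n+m j₀ i)))) (*≥0 (nat≥0 i) (term≥0 t≥0 (suc (i ℕ.+ j₀)))))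
      (eq (nat i) a b))
    (term-decay t≥0 h i)
    where
    a = term t (i ℕ.+ j₀)
    b = term t (suc (i ℕ.+ j₀))
    eq : ∀ i a b → (1ℚ + i) * a ≡ (1ℚ + (1ℚ + i)) * b + ((1ℚ + i) * (a - 2ℚ * b) + i * b)
    eq = solve-∀ ℚ-ring

  -- The tail plus twice the next term does not increase, because each term is at least twice its
  -- successor.
  tail≤2term : ∀ {t j₀} → 0ℚ ≤ t → 2ℚ * t ≤ nat j₀ → ∀ {J K} → j₀ ℕ.≤ J → J ℕ.≤ K →
               expSum t K - expSum t J ≤ 2ℚ * term t J
  tail≤2term {t} {j₀} t≥0 h {J} {K} l J≤K = ≤-trans
    (≤-cert (2ℚ * term t K) (*≥0 0≤2 (term≥0 t≥0 K)) refl)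
    (subst (λ n → expSum t n - expSum t J + 2ℚ * term t n ≤ 2ℚ * term t J) (ℕP.m∸n+n≡m J≤K) (go (K ℕ.∸ J)))
    where
    eq₁ : ∀ a b → a - a + b ≡ b
    eq₁ = solve-∀ ℚ-ring
    eq₂ : ∀ a b x y → (a - b) + 2ℚ * x ≡ a + x - b + 2ℚ * y + (x - 2ℚ * y)
    eq₂ = solve-∀ ℚ-ring
    go : ∀ i → expSum t (i ℕ.+ J) - expSum t J + 2ℚ * term t (i ℕ.+ J) ≤ 2ℚ * term t J
    go zero    = ≤-reflexive (eq₁ (expSum t J) (2ℚ * term t J))
    go (suc i) = ≤-trans (≤-cert (term t (i ℕ.+ J) - 2ℚ * term t (suc (i ℕ.+ J)))
        (diff≥0 (term-halves t≥0 h (ℕP.≤-trans l (ℕP.m≤n+m J i))))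
        (eq₂ (expSum t (i ℕ.+ J)) (expSum t J) (term t (i ℕ.+ J)) (term t (suc (i ℕ.+ J)))))
      (go i)

  private
    term→0′ : ∀ {t} → 0ℚ ≤ t → ∀ ε → 0ℚ < ε → ∃ λ J₀ →
      (∀ J → J₀ ℕ.≤ J → 2ℚ * term t J ≤ ε) ×
      (∀ J K → J₀ ℕ.≤ J → J ℕ.≤ K → expSum t K - expSum t J ≤ ε)
    term→0′ {t} t≥0 ε ε>0 = i₀ ℕ.+ j₀ , small , λ J K l J≤K →
      ≤-trans (tail≤2term t≥0 h (ℕP.≤-trans (ℕP.m≤n+m j₀ i₀) l) J≤K) (small J l)
      where
      j₀ = proj₁ (archimedean (2ℚ * t))
      h = proj₂ (archimedean (2ℚ * t))
      T = 2ℚ * term t j₀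
      i₀ = proj₁ (archimedean-* T ε ε>0)
      eq : ∀ n x → n * (2ℚ * x) ≡ 2ℚ * (n * x)
      eq = solve-∀ ℚ-ring
      bound : ∀ i → i₀ ℕ.≤ i → T ≤ nat (suc i) * ε
      bound i l = ≤-trans (proj₂ (archimedean-* T ε ε>0))
        (*-monoʳ ε (<⇒≤ ε>0) (nat-mono (ℕP.≤-trans l (ℕP.n≤1+n i))))
      small : ∀ J → i₀ ℕ.+ j₀ ℕ.≤ J → 2ℚ * term t J ≤ ε
      small J l = *-cancelˡ-≤ (nat (suc i)) (nat>0 i)
        (≤-trans (≤-reflexive (trans (eq (nat (suc i)) (term t J)) (cong (λ n → 2ℚ * (nat (suc i) * term t n)) (sym J≡))))
          (≤-trans (*-monoˡ 2ℚ 0≤2 (term-decay t≥0 h i)) (bound i (ℕP.≤-trans (ℕP.≤-reflexive (sym (ℕP.m+n∸n≡m i₀ j₀))) (ℕP.∸-monoˡ-≤ j₀ l)))))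
        where
        i = J ℕ.∸ j₀
        J≡ : i ℕ.+ j₀ ≡ J
        J≡ = ℕP.m∸n+n≡m (ℕP.≤-trans (ℕP.m≤n+m j₀ i₀) l)

  opaque
    term→0 : ∀ {t} → 0ℚ ≤ t → ∀ ε → 0ℚ < ε → ∃ λ J₀ →
      (∀ J → J₀ ℕ.≤ J → 2ℚ * term t J ≤ ε) ×
      (∀ J K → J₀ ℕ.≤ J → J ℕ.≤ K → expSum t K - expSum t J ≤ ε)
    term→0 = term→0′

  expSum-bounded : ∀ {t} → 0ℚ ≤ t → ∃ λ C → 0ℚ < C × ∀ J → expSum t J ≤ C
  expSum-bounded {t} t≥0 = 1ℚ + expSum t J₀ , +>0 0<1 (expSum≥0 t≥0 J₀) , bound
    where
    J₀ = proj₁ (term→0 t≥0 1ℚ 0<1)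
    eq : ∀ a b → 1ℚ + b ≡ a + (1ℚ - (a - b))
    eq = solve-∀ ℚ-ring
    bound : ∀ J → expSum t J ≤ 1ℚ + expSum t J₀
    bound J = go (ℕP.≤-total J J₀)
      where
      go : J ℕ.≤ J₀ ⊎ J₀ ℕ.≤ J → expSum t J ≤ 1ℚ + expSum t J₀
      go (inj₁ l) = ≤-trans (expSum-monoʳ t≥0 l) (≤-cert 1ℚ 0≤1 (+-comm 1ℚ (expSum t J₀)))
      go (inj₂ l) = ≤-cert (1ℚ - (expSum t J - expSum t J₀))
        (diff≥0 (proj₂ (proj₂ (term→0 t≥0 1ℚ 0<1)) J₀ J ℕP.≤-refl l)) (eq (expSum t J) (expSum t J₀))

  -- Cauchy products

  conv : (ℕ → ℚ) → (ℕ → ℚ) → ℕ → ℚ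
  conv f g zero    = f 0 * g 0
  conv f g (suc s) = f 0 * g (suc s) + conv (λ i → f (suc i)) g s

  private
    -- The coefficients of the formal derivative, so that `leibniz` is the product rule for power
    -- series.
    deriv : (ℕ → ℚ) → ℕ → ℚ
    deriv f j = nat (suc j) * f (suc j)

    conv-cong : ∀ {f f′ g g′} → (∀ i → f i ≡ f′ i) → (∀ i → g i ≡ g′ i) → ∀ s → conv f g s ≡ conv f′ g′ s
    conv-cong hf hg zero    = cong₂ _*_ (hf 0) (hg 0)
    conv-cong hf hg (suc s) = cong₂ _+_ (cong₂ _*_ (hf 0) (hg (suc s))) (conv-cong (λ i → hf (suc i)) hg s)

    conv-scaleˡ : ∀ a f g s → conv (λ i → a * f i) g s ≡ a * conv f g s
    conv-scaleˡ a f g zero    = *-assoc a (f 0) (g 0)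
    conv-scaleˡ a f g (suc s) = trans (cong (a * f 0 * g (suc s) +_) (conv-scaleˡ a (λ i → f (suc i)) g s))
      (eq a (f 0) (g (suc s)) (conv (λ i → f (suc i)) g s))
      where
      eq : ∀ a b c d → a * b * c + a * d ≡ a * (b * c + d)
      eq = solve-∀ ℚ-ring

    conv-scaleʳ : ∀ a f g s → conv f (λ i → a * g i) s ≡ a * conv f g s
    conv-scaleʳ a f g zero    = eq a (f 0) (g 0)
      where
      eq : ∀ a b c → b * (a * c) ≡ a * (b * c)
      eq = solve-∀ ℚ-ring
    conv-scaleʳ a f g (suc s) = trans (cong (f 0 * (a * g (suc s)) +_) (conv-scaleʳ a (λ i → f (suc i)) g s))
      (eq a (f 0) (g (suc s)) (conv (λ i → f (suc i)) g s))
      where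
      eq : ∀ a b c d → b * (a * c) + a * d ≡ a * (b * c + d)
      eq = solve-∀ ℚ-ring

    conv-addˡ : ∀ f f′ g s → conv (λ i → f i + f′ i) g s ≡ conv f g s + conv f′ g s
    conv-addˡ f f′ g zero    = *-distribʳ-+ (g 0) (f 0) (f′ 0)
    conv-addˡ f f′ g (suc s) = trans (cong ((f 0 + f′ 0) * g (suc s) +_) (conv-addˡ (λ i → f (suc i)) (λ i → f′ (suc i)) g s))
      (eq (f 0) (f′ 0) (g (suc s)) (conv (λ i → f (suc i)) g s) (conv (λ i → f′ (suc i)) g s))
      where
      eq : ∀ a a′ c d d′ → (a + a′) * c + (d + d′) ≡ a * c + d + (a′ * c + d′)
      eq = solve-∀ ℚ-ring

    leibniz : ∀ f g s → nat (suc s) * conv f g (suc s) ≡ conv (deriv f) g s + conv f (deriv g) s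
    leibniz f g zero = eq (f 0) (f 1) (g 0) (g 1)
      where
      eq : ∀ f₀ f₁ g₀ g₁ → (1ℚ + 0ℚ) * (f₀ * g₁ + f₁ * g₀) ≡ (1ℚ + 0ℚ) * f₁ * g₀ + f₀ * ((1ℚ + 0ℚ) * g₁)
      eq = solve-∀ ℚ-ring
    leibniz f g (suc s) =
      trans (eq₁ (nat (suc s)) (f 0 * g (suc (suc s))) (conv f′ g (suc s)))
        (trans (cong (λ z → (1ℚ + nat (suc s)) * (f 0 * g (suc (suc s))) + (conv f′ g (suc s) + z)) (leibniz f′ g s))
          (trans (eq₂ (nat (suc s)) (f 0) (g (suc (suc s))) (f 1 * g (suc s)) (conv f″ g s) (conv (deriv f′) g s) (conv f′ (deriv g) s))
            (cong₂ _+_ (cong₂ _+_ (eq₃ (f 1) (g (suc s))) split) refl)))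
      where
      f′ f″ : ℕ → ℚ
      f′ i = f (suc i)
      f″ i = f (suc (suc i))
      eq₁ : ∀ n a c → (1ℚ + n) * (a + c) ≡ (1ℚ + n) * a + (c + n * c)
      eq₁ = solve-∀ ℚ-ring
      eq₂ : ∀ n a b c d e h → (1ℚ + n) * (a * b) + (c + d + (e + h)) ≡ c + (d + e) + (a * ((1ℚ + n) * b) + h)
      eq₂ = solve-∀ ℚ-ring
      eq₃ : ∀ a b → a * b ≡ (1ℚ + 0ℚ) * a * b
      eq₃ = solve-∀ ℚ-ring
      eq₄ : ∀ n a → a + n * a ≡ (1ℚ + n) * a
      eq₄ = solve-∀ ℚ-ring
      split : conv f″ g s + conv (deriv f′) g s ≡ conv (λ i → deriv f (suc i)) g s
      split = trans (sym (conv-addˡ f″ (deriv f′) g s))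
        (conv-cong (λ i → eq₄ (nat (suc i)) (f (suc (suc i)))) (λ _ → refl) s)

  -- By the product rule both sides satisfy (s + 1) u_(s+1) = (x + y) u_s, and they agree at s = 0.
  conv-term : ∀ x y s → conv (term x) (term y) s ≡ term (x + y) s
  conv-term x y zero    = refl
  conv-term x y (suc s) = *-cancelˡ-≡ (nat (suc s)) (nat>0 s) (begin
    nat (suc s) * conv (term x) (term y) (suc s)  ≡⟨ leibniz (term x) (term y) s ⟩
    conv (deriv (term x)) (term y) s + conv (term x) (deriv (term y)) s
      ≡⟨ cong₂ _+_ (trans (conv-cong (term-suc x) (λ _ → refl) s) (conv-scaleˡ x (term x) (term y) s))
                   (trans (conv-cong (λ _ → refl) (term-suc y) s) (conv-scaleʳ y (term x) (term y) s)) ⟩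
    x * conv (term x) (term y) s + y * conv (term x) (term y) s  ≡⟨ sym (*-distribʳ-+ (conv (term x) (term y) s) x y) ⟩
    (x + y) * conv (term x) (term y) s  ≡⟨ cong ((x + y) *_) (conv-term x y s) ⟩
    (x + y) * term (x + y) s            ≡⟨ sym (term-suc (x + y) s) ⟩
    nat (suc s) * term (x + y) (suc s)  ∎)
    where open ≡-Reasoning

  private
    shift : (ℕ → ℚ) → ℕ → ℚ
    shift f i = f (suc i)

    ∑conv-suc : ∀ f g J → ∑ (suc J) (conv f g) ≡ f 0 * ∑ (suc J) g + ∑ J (conv (shift f) g)
    ∑conv-suc f g J = trans (∑-suc J (conv f g))
      (trans (cong (f 0 * g 0 +_) (trans (∑-+ J (λ s → f 0 * g (suc s)) (conv (shift f) g))
          (cong (_+ ∑ J (conv (shift f) g)) (∑-*ˡ J (f 0) (shift g)))))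
        (trans (eq (f 0) (g 0) (∑ J (shift g)) (∑ J (conv (shift f) g)))
          (cong (λ z → f 0 * z + ∑ J (conv (shift f) g)) (sym (∑-suc J g)))))
      where
      eq : ∀ a b c d → a * b + (a * c + d) ≡ a * (b + c) + d
      eq = solve-∀ ℚ-ring

    product-suc : ∀ f J z → ∑ (suc J) f * z ≡ f 0 * z + ∑ J (shift f) * z
    product-suc f J z = trans (cong (_* z) (∑-suc J f)) (*-distribʳ-+ z (f 0) (∑ J (shift f)))

    ∑conv≥0 : ∀ f g → (∀ i → 0ℚ ≤ f i) → (∀ i → 0ℚ ≤ g i) → ∀ J → 0ℚ ≤ ∑ J (conv f g)
    ∑conv≥0 f g hf hg zero    = ≤-refl
    ∑conv≥0 f g hf hg (suc J) = subst (0ℚ ≤_) (sym (∑conv-suc f g J))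
      (+≥0 (*≥0 (hf 0) (∑≥0 (suc J) λ j _ → hg j)) (∑conv≥0 (shift f) g (λ i → hf (suc i)) hg J))

    -- For nonnegative sequences, the triangle i + j < J lies in the J × K rectangle; in
    -- `product≤∑conv` this rectangle lies in the triangle i + j < J + K.
    ∑conv≤product : ∀ f g → (∀ i → 0ℚ ≤ f i) → (∀ i → 0ℚ ≤ g i) → ∀ J K → J ℕ.≤ K →
                    ∑ J (conv f g) ≤ ∑ J f * ∑ K g
    ∑conv≤product f g hf hg zero    K l = ≤-reflexive (sym (*-zeroˡ (∑ K g)))
    ∑conv≤product f g hf hg (suc J) K l = subst₂ _≤_ (sym (∑conv-suc f g J)) (sym (product-suc f J (∑ K g)))
      (+-mono-≤ (*-monoˡ (f 0) (hf 0) (∑-monoˡ g l λ j _ → hg j))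
        (∑conv≤product (shift f) g (λ i → hf (suc i)) hg J K (ℕP.≤-trans (ℕP.n≤1+n J) l)))

    product≤∑conv : ∀ f g → (∀ i → 0ℚ ≤ f i) → (∀ i → 0ℚ ≤ g i) → ∀ J K →
                    ∑ J f * ∑ K g ≤ ∑ (J ℕ.+ K) (conv f g)
    product≤∑conv f g hf hg zero    K = subst (_≤ ∑ K (conv f g)) (sym (*-zeroˡ (∑ K g))) (∑conv≥0 f g hf hg K)
    product≤∑conv f g hf hg (suc J) K = subst₂ _≤_ (sym (product-suc f J (∑ K g))) (sym (∑conv-suc f g (J ℕ.+ K)))
      (+-mono-≤ (*-monoˡ (f 0) (hf 0) (∑-monoˡ g (ℕP.m≤n+m K (suc J)) λ j _ → hg j))
        (product≤∑conv (shift f) g (λ i → hf (suc i)) hg J K))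

    -- The difference is a sum over the part of the rectangle outside the triangle, so termwise
    -- absolute values give the same difference for f′ and g′.
    ∣product-∑conv∣ : ∀ f g f′ g′ → (∀ i → ∣ f i ∣ ≡ f′ i) → (∀ i → ∣ g i ∣ ≡ g′ i) → ∀ J K → J ℕ.≤ K →
      ∣ ∑ J f * ∑ K g - ∑ J (conv f g) ∣ ≤ ∑ J f′ * ∑ K g′ - ∑ J (conv f′ g′)
    ∣product-∑conv∣ f g f′ g′ hf hg zero    K l = subst₂ _≤_ (sym (cong ∣_∣ (eq (∑ K g)))) (sym (eq (∑ K g′))) ≤-refl
      where
      eq : ∀ z → 0ℚ * z - 0ℚ ≡ 0ℚ
      eq = solve-∀ ℚ-ring
    ∣product-∑conv∣ f g f′ g′ hf hg (suc J) K l = subst₂ _≤_ (cong ∣_∣ (sym (split f g))) (sym (split f′ g′))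
      (≤-trans (∣p+q∣≤∣p∣+∣q∣ (f 0 * (∑ K g - ∑ (suc J) g)) (∑ J (shift f) * ∑ K g - ∑ J (conv (shift f) g)))
        (+-mono-≤ first (∣product-∑conv∣ (shift f) g (shift f′) g′ (λ i → hf (suc i)) hg J K (ℕP.≤-trans (ℕP.n≤1+n J) l))))
      where
      eq : ∀ a z y p c → a * z + p - (a * y + c) ≡ a * (z - y) + (p - c)
      eq = solve-∀ ℚ-ring
      split : ∀ f g → ∑ (suc J) f * ∑ K g - ∑ (suc J) (conv f g) ≡
              f 0 * (∑ K g - ∑ (suc J) g) + (∑ J (shift f) * ∑ K g - ∑ J (conv (shift f) g))
      split f g = trans (cong₂ _-_ (product-suc f J (∑ K g)) (∑conv-suc f g J))
        (eq (f 0) (∑ K g) (∑ (suc J) g) (∑ J (shift f) * ∑ K g) (∑ J (conv (shift f) g)))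
      first : ∣ f 0 * (∑ K g - ∑ (suc J) g) ∣ ≤ f′ 0 * (∑ K g′ - ∑ (suc J) g′)
      first = subst₂ _≤_ (sym (∣p*q∣≡∣p∣*∣q∣ (f 0) (∑ K g - ∑ (suc J) g))) (cong (_* (∑ K g′ - ∑ (suc J) g′)) (hf 0))
        (*-monoˡ ∣ f 0 ∣ (0≤∣p∣ (f 0)) (tail-mono g g′ (λ j → ≤-reflexive (hg j)) l))

  expSum-+-≤ : ∀ {x y} → 0ℚ ≤ x → 0ℚ ≤ y → ∀ J → expSum (x + y) J ≤ expSum x J * expSum y J
  expSum-+-≤ {x} {y} x≥0 y≥0 J = subst (_≤ expSum x J * expSum y J) (∑-cong J λ j _ → conv-term x y j)
    (∑conv≤product (term x) (term y) (term≥0 x≥0) (term≥0 y≥0) J J ℕP.≤-refl)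

  expSum-*-≤ : ∀ {x y} → 0ℚ ≤ x → 0ℚ ≤ y → ∀ J K → expSum x J * expSum y K ≤ expSum (x + y) (J ℕ.+ K)
  expSum-*-≤ {x} {y} x≥0 y≥0 J K = subst (expSum x J * expSum y K ≤_) (∑-cong (J ℕ.+ K) λ j _ → conv-term x y j)
    (product≤∑conv (term x) (term y) (term≥0 x≥0) (term≥0 y≥0) J K)

  -- The functional equation for arguments of any sign: passing to absolute values turns the error
  -- into a tail of the exponential series at ∣x∣ + ∣y∣.
  expSum-homomorphic : ∀ {x y B} → ∣ x ∣ + ∣ y ∣ ≤ B → ∀ J →
    ∣ expSum x J * expSum y J - expSum (x + y) J ∣ ≤ expSum B (J ℕ.+ J) - expSum B J
  expSum-homomorphic {x} {y} {B} h J = begin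
    ∣ expSum x J * expSum y J - expSum (x + y) J ∣
      ≡⟨ cong (λ z → ∣ expSum x J * expSum y J - z ∣) (sym (∑-cong J λ j _ → conv-term x y j)) ⟩
    ∣ expSum x J * expSum y J - ∑ J (conv (term x) (term y)) ∣
      ≤⟨ ∣product-∑conv∣ (term x) (term y) (term a) (term b) (∣term∣ x) (∣term∣ y) J J ℕP.≤-refl ⟩
    expSum a J * expSum b J - ∑ J (conv (term a) (term b))
      ≡⟨ cong (λ z → expSum a J * expSum b J - z) (∑-cong J λ j _ → conv-term a b j) ⟩
    expSum a J * expSum b J - expSum (a + b) J
      ≤⟨ +-monoˡ-≤ (- expSum (a + b) J) (expSum-*-≤ (0≤∣p∣ x) (0≤∣p∣ y) J J) ⟩
    expSum (a + b) (J ℕ.+ J) - expSum (a + b) J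
      ≤⟨ p≤∣p∣ (expSum (a + b) (J ℕ.+ J) - expSum (a + b) J) ⟩
    ∣ expSum (a + b) (J ℕ.+ J) - expSum (a + b) J ∣
      ≤⟨ expSum-tail (subst (_≤ B) (sym (0≤p⇒∣p∣≡p (+≥0 (0≤∣p∣ x) (0≤∣p∣ y)))) h) (ℕP.m≤m+n J J) ⟩
    expSum B (J ℕ.+ J) - expSum B J ∎
    where
    open ≤-Reasoning
    a b : ℚ
    a = ∣ x ∣
    b = ∣ y ∣

-- Power series whose coefficients change sign once.

module SignChanges where

  open import Data.Rational.Base
  open import Data.Rational.Properties
  open Rationals
  open ExponentialSums

  ^-exchange : ∀ {s t} → 0ℚ ≤ s → s ≤ t → ∀ {i j} → i ℕ.≤ j → s ^ j * t ^ i ≤ t ^ j * s ^ i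
  ^-exchange {s} {t} s≥0 s≤t {i} {j} i≤j = subst (λ n → s ^ n * t ^ i ≤ t ^ n * s ^ i) (ℕP.m∸n+n≡m i≤j)
    (subst₂ _≤_ (trans (eq (s ^ d) (s ^ i) (t ^ i)) (cong (_* t ^ i) (sym (^-+ s d i))))
                (trans (eq′ (t ^ d) (s ^ i) (t ^ i)) (cong (_* s ^ i) (sym (^-+ t d i))))
      (*-monoʳ (s ^ i * t ^ i) (*≥0 (^≥0 s≥0 i) (^≥0 (≤-trans s≥0 s≤t) i)) (^-mono s≥0 s≤t d)))
    where
    d = j ℕ.∸ i
    eq : ∀ a b c → a * (b * c) ≡ a * b * c
    eq = solve-∀ ℚ-ring
    eq′ : ∀ a b c → a * (b * c) ≡ a * c * b
    eq′ = solve-∀ ℚ-ring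

  -- Both sign conditions include m, which makes c m zero. The bound on c 1 is the source of all
  -- strictness: degree 1 lies below m and contributes a definite decrease.
  record SignChange (c : ℕ → ℚ) (m : ℕ) : Set where
    field
      2≤m      : 2 ℕ.≤ m
      before   : ∀ j → j ℕ.≤ m → 0ℚ ≤ c j
      after    : ∀ j → m ℕ.≤ j → c j ≤ 0ℚ
      linear   : ½ ≤ c 1

  module _ {c : ℕ → ℚ} {m : ℕ} (C : SignChange c m) where
    open SignChange C

    private
      -- The cross-multiplied form of: c_j t^(j - m) does not increase with t. Before m the exponent
      -- is nonpositive, after m the coefficient is.
      term-crossing : ∀ {s t} → 0ℚ ≤ s → s ≤ t → ∀ j → s ^ m * (c j * term t j) ≤ t ^ m * (c j * term s j)
      term-crossing {s} {t} s≥0 s≤t j = subst₂ _≤_ (unfold s t) (unfold t s) main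
        where
        f = term 1ℚ j
        f≥0 : 0ℚ ≤ f
        f≥0 = term≥0 0≤1 j
        eq : ∀ a b c f → a * b * (c * f) ≡ a * (c * (b * f))
        eq = solve-∀ ℚ-ring
        unfold : ∀ s t → s ^ m * t ^ j * (c j * f) ≡ s ^ m * (c j * term t j)
        unfold s t = trans (eq (s ^ m) (t ^ j) (c j) f)
          (cong (λ z → s ^ m * (c j * z)) (trans (sym (term-scale t 1ℚ j)) (cong (λ z → term z j) (*-identityʳ t))))
        eq″ : ∀ x y c f → y * (c * f) ≡ x * (c * f) + (x - y) * - c * f
        eq″ = solve-∀ ℚ-ring
        main : s ^ m * t ^ j * (c j * f) ≤ t ^ m * s ^ j * (c j * f)
        main with ℕP.≤-total j m
        ... | inj₁ j≤m = *-monoʳ (c j * f) (*≥0 (before j j≤m) f≥0) (^-exchange s≥0 s≤t j≤m)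
        ... | inj₂ m≤j = ≤-cert ((s ^ m * t ^ j - t ^ m * s ^ j) * - c j * f)
          (*≥0 (*≥0 (diff≥0 (subst₂ _≤_ (*-comm (s ^ j) (t ^ m)) (*-comm (t ^ j) (s ^ m)) (^-exchange s≥0 s≤t m≤j)))
                    (neg≥0 (after j m≤j))) f≥0)
          (eq″ (s ^ m * t ^ j) (t ^ m * s ^ j) (c j) f)

    -- Every degree except 1 is estimated by monotonicity alone; the linear terms are kept exactly,
    -- and their difference is the gain on the left.
    crossing : ∀ {s t} → 0ℚ ≤ s → s ≤ t → ∀ J →
      s ^ m * series c t (suc (suc J)) + c 1 * (t ^ m * s - s ^ m * t) ≤ t ^ m * series c s (suc (suc J))
    crossing {s} {t} s≥0 s≤t zero = ≤-cert (c 0 * (t ^ m - s ^ m))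
      (*≥0 (before 0 ℕ.z≤n) (diff≥0 (^-mono s≥0 s≤t m))) (eq (s ^ m) (t ^ m) (c 0) (c 1) s t)
      where
      eq : ∀ S T c₀ c₁ s t → T * (0ℚ + c₀ * 1ℚ + c₁ * (1ℚ * (s * 1ℚ))) ≡
           S * (0ℚ + c₀ * 1ℚ + c₁ * (1ℚ * (t * 1ℚ))) + c₁ * (T * s - S * t) + c₀ * (T - S)
      eq = solve-∀ ℚ-ring
    crossing {s} {t} s≥0 s≤t (suc J) = subst₂ _≤_
      (eq (s ^ m) (series c t (suc (suc J))) (c (suc (suc J)) * term t (suc (suc J))) (c 1 * (t ^ m * s - s ^ m * t)))
      (sym (*-distribˡ-+ (t ^ m) (series c s (suc (suc J))) (c (suc (suc J)) * term s (suc (suc J)))))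
      (+-mono-≤ (crossing s≥0 s≤t J) (term-crossing s≥0 s≤t (suc (suc J))))
      where
      eq : ∀ S a b d → S * a + d + S * b ≡ S * (a + b) + d
      eq = solve-∀ ℚ-ring

    -- A quantitative form of strict decrease: values nearly on the wrong side of zero at a ≤ b
    -- force b - a to be of order η. Of the factor 4, one 2 comes from the two end values, the other
    -- from c 1 ≥ ½.
    separation : ∀ {α β a b η} → 0ℚ < α → α ≤ a → a ≤ b → b ≤ β → 0ℚ ≤ η → ∀ J →
      series c a (suc (suc J)) ≤ η → - η ≤ series c b (suc (suc J)) →
      α ^ m * (b - a) ≤ 2ℚ * 2ℚ * β ^ m * η
    separation {α} {β} {a} {b} {η} α>0 α≤a a≤b b≤β η≥0 J Ha Hb = *-cancelˡ-≤ ½ 0<½ (begin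
      ½ * (α ^ m * (b - a))
        ≤⟨ *-monoˡ ½ (<⇒≤ 0<½) (*-monoʳ (b - a) (diff≥0 a≤b) power) ⟩
      ½ * (a ^ m′ * a * b * (b - a))
        ≤⟨ *-mono (<⇒≤ 0<½) gap≥0 linear ≤-refl ⟩
      c 1 * (a ^ m′ * a * b * (b - a))
        ≤⟨ *-monoˡ (c 1) (before 1 (ℕP.≤-trans (ℕP.n≤1+n 1) 2≤m)) gap ⟩
      c 1 * (b ^ m * a - a ^ m * b)
        ≤⟨ ≤-cert (b ^ m * η - b ^ m * Sa + (a ^ m * Sb - a ^ m * - η) + (b ^ m * Sa - (a ^ m * Sb + c 1 * (b ^ m * a - a ^ m * b))))
             (+≥0 (+≥0 (diff≥0 (*-monoˡ (b ^ m) (^≥0 b≥0 m) Ha)) (diff≥0 (*-monoˡ (a ^ m) (^≥0 a≥0 m) Hb)))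
                  (diff≥0 (crossing a≥0 a≤b J)))
             (eq₁ (b ^ m) (a ^ m) η Sa Sb (c 1 * (b ^ m * a - a ^ m * b))) ⟩
      b ^ m * η + a ^ m * η
        ≤⟨ +-mono-≤ (*-monoʳ η η≥0 (^-mono b≥0 b≤β m)) (*-monoʳ η η≥0 (^-mono a≥0 (≤-trans a≤b b≤β) m)) ⟩
      β ^ m * η + β ^ m * η
        ≡⟨ eq₂ (β ^ m) η ⟩
      ½ * (2ℚ * 2ℚ * β ^ m * η) ∎)
      where
      open ≤-Reasoning
      m′ = m ℕ.∸ 2
      m≡ : suc (suc m′) ≡ m
      m≡ = ℕP.m+[n∸m]≡n 2≤m
      Sa = series c a (suc (suc J))
      Sb = series c b (suc (suc J))
      a≥0 : 0ℚ ≤ a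
      a≥0 = ≤-trans (<⇒≤ α>0) α≤a
      b≥0 : 0ℚ ≤ b
      b≥0 = ≤-trans a≥0 a≤b
      gap≥0 : 0ℚ ≤ a ^ m′ * a * b * (b - a)
      gap≥0 = *≥0 (*≥0 (*≥0 (^≥0 a≥0 m′) a≥0) b≥0) (diff≥0 a≤b)
      eq₁ : ∀ B A η x y g → B * η + A * η ≡ g + (B * η - B * x + (A * y - A * - η) + (B * x - (A * y + g)))
      eq₁ = solve-∀ ℚ-ring
      eq₂ : ∀ B η → B * η + B * η ≡ ½ * (2ℚ * 2ℚ * B * η)
      eq₂ = solve-∀ ℚ-ring
      eq₃ : ∀ x a → a * (a * x) ≡ x * a * a
      eq₃ = solve-∀ ℚ-ring
      power : α ^ m ≤ a ^ m′ * a * b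
      power = begin
        α ^ m               ≤⟨ ^-mono (<⇒≤ α>0) α≤a m ⟩
        a ^ m               ≡⟨ cong (a ^_) (sym m≡) ⟩
        a * (a * a ^ m′)    ≡⟨ eq₃ (a ^ m′) a ⟩
        a ^ m′ * a * a      ≤⟨ *-monoˡ (a ^ m′ * a) (*≥0 (^≥0 a≥0 m′) a≥0) a≤b ⟩
        a ^ m′ * a * b      ∎
      eq₄ : ∀ A B a b → b * (b * B) * a - a * (a * A) * b ≡ A * a * b * (b - a) + b * b * a * (B - A)
      eq₄ = solve-∀ ℚ-ring
      -- b^m a - a^m b = ab (b^(m-1) - a^(m-1)), from which a factor b - a is split off; this is
      -- where m ≥ 2 enters.
      gap : a ^ m′ * a * b * (b - a) ≤ b ^ m * a - a ^ m * b
      gap = subst (λ n → a ^ m′ * a * b * (b - a) ≤ b ^ n * a - a ^ n * b) m≡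
        (≤-cert (b * b * a * (b ^ m′ - a ^ m′)) (*≥0 (*≥0 (*≥0 b≥0 b≥0) a≥0) (diff≥0 (^-mono a≥0 a≤b m′)))
          (eq₄ (a ^ m′) (b ^ m′) a b))

    -- Otherwise `separation` with η = 0 would force b ≤ a.
    negative-beyond : ∀ {a b} → 0ℚ < a → a < b → ∀ J →
      series c a (suc (suc J)) ≤ 0ℚ → series c b (suc (suc J)) < 0ℚ
    negative-beyond {a} {b} a>0 a<b J Ha = ≰⇒> λ Hb → <-irrefl refl (<-≤-trans
      (*>0 (^>0 a>0 m) (diff>0 a<b))
      (≤-trans (separation a>0 ≤-refl (<⇒≤ a<b) ≤-refl ≤-refl J Ha Hb)
        (≤-reflexive (*-zeroʳ (2ℚ * 2ℚ * b ^ m)))))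

  search : ∀ (f : ℕ → ℚ) n → 0ℚ ≤ f 0 → f (suc n) ≤ 0ℚ →
           ∃ λ i → i ℕ.≤ n × 0ℚ ≤ f i × f (suc i) ≤ 0ℚ
  search f zero    h₀ h₁ = 0 , ℕ.z≤n , h₀ , h₁
  search f (suc n) h₀ h₁ with 0ℚ ≤? f (suc n)
  ... | yes h = suc n , ℕP.≤-refl , h , h₁
  ... | no ¬h = let (i , i≤n , h) = search f n h₀ (<⇒≤ (≰⇒> ¬h)) in i , ℕP.m≤n⇒m≤1+n i≤n , h

-- Rational approximations of the Poisson mean kρ at the root.

module RationalRoot where

  open import Data.Rational.Base
  open import Data.Rational.Properties
  open Rationals
  open ExponentialSums
  open SignChanges

  nat≤2^ : ∀ j → nat j ≤ 2ℚ ^ j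
  nat≤2^ zero    = 0≤1
  nat≤2^ (suc j) = ≤-cert (2ℚ ^ j - nat j + (2ℚ ^ j - 1ℚ)) (+≥0 (diff≥0 (nat≤2^ j)) (diff≥0 (1≤2^ j)))
    (eq (nat j) (2ℚ ^ j))
    where
    eq : ∀ n p → 2ℚ * p ≡ 1ℚ + n + (p - n + (p - 1ℚ))
    eq = solve-∀ ℚ-ring
    1≤2^ : ∀ j → 1ℚ ≤ 2ℚ ^ j
    1≤2^ zero    = ≤-refl
    1≤2^ (suc j) = ≤-trans (1≤2^ j) (≤-cert (2ℚ ^ j) (^≥0 0≤2 j) (eq′ (2ℚ ^ j)))
      where
      eq′ : ∀ p → 2ℚ * p ≡ p + p
      eq′ = solve-∀ ℚ-ring

  series-nat : ∀ t J → series nat t (suc J) ≡ t * expSum t J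
  series-nat t zero    = eq t
    where
    eq : ∀ t → 0ℚ + 0ℚ * 1ℚ ≡ t * 0ℚ
    eq = solve-∀ ℚ-ring
  series-nat t (suc J) = trans (cong₂ _+_ (series-nat t J) (term-suc t J)) (sym (*-distribˡ-+ t (expSum t J) (term t J)))

  expSum-half : ∀ J → expSum ½ J ≤ 1ℚ + 1ℚ
  expSum-half zero    = 0≤2
  expSum-half (suc J) = ≤-cert (2ℚ * term ½ 1 - (expSum ½ (suc J) - expSum ½ 1))
    (diff≥0 (tail≤2term (<⇒≤ 0<½) ≤-refl {1} {suc J} ℕP.≤-refl (ℕ.s≤s ℕ.z≤n))) (eq (expSum ½ (suc J)))
    where
    eq : ∀ x → 1ℚ + 1ℚ ≡ x + (2ℚ * (1ℚ * (½ * 1ℚ)) - (x - (0ℚ + 1ℚ)))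
    eq = solve-∀ ℚ-ring

  series-converges : ∀ c → Moderate c → ∀ {B} → 0ℚ ≤ B → ∀ ε → 0ℚ < ε → ∃ λ N →
    ∀ t → ∣ t ∣ ≤ B → ∀ J K → N ℕ.≤ J → N ℕ.≤ K → ∣ series c t K - series c t J ∣ ≤ ε
  series-converges c hc {B} B≥0 ε ε>0 = proj₁ vanish , λ t h J K N≤J N≤K → go t h J K N≤J N≤K (ℕP.≤-total J K)
    where
    vanish = term→0 {2ℚ * B} (*≥0 0≤2 B≥0) ε ε>0
    go : ∀ t → ∣ t ∣ ≤ B → ∀ J K → proj₁ vanish ℕ.≤ J → proj₁ vanish ℕ.≤ K → _ →
         ∣ series c t K - series c t J ∣ ≤ ε
    go t h J K N≤J N≤K (inj₁ l) = ≤-trans (series-tail c hc h l) (proj₂ (proj₂ vanish) J K N≤J l)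
    go t h J K N≤J N≤K (inj₂ l) = subst (_≤ ε) (∣p-q∣≡∣q-p∣ (series c t J) (series c t K))
      (≤-trans (series-tail c hc h l) (proj₂ (proj₂ vanish) K J N≤K l))

  -- The mean of min {ℓ , N} − N / k for N Poisson of mean t is, up to the factor
  -- e^{-t}, the series with coefficients excess; its sign change makes the root unique.
  module Excess (k ℓ : ℕ) (2≤k : 2 ℕ.≤ k) (1≤ℓ : 1 ℕ.≤ ℓ) where

    m : ℕ
    m = k ℕ.* ℓ

    -- 1 / k; the predecessor compensates for `inv` n being 1 / (n + 1).
    κ : ℚ
    κ = inv (ℕ.pred k)

    κ≥0 : 0ℚ ≤ κ
    κ≥0 = <⇒≤ (inv>0 (ℕ.pred k))

    0<nat-k : 0ℚ < nat k
    0<nat-k = nat-mono-< (ℕP.≤-trans (ℕP.n≤1+n 1) 2≤k)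

    1≤nat-ℓ : 1ℚ ≤ nat ℓ
    1≤nat-ℓ = nat-mono 1≤ℓ

    kκ≡1 : nat k * κ ≡ 1ℚ
    kκ≡1 = subst (λ n → nat n * κ ≡ 1ℚ) (ℕP.suc-pred k {{ℕ.>-nonZero (ℕP.≤-trans (ℕP.n≤1+n 1) 2≤k)}}) (nat-inv (ℕ.pred k))

    κ≤½ : κ ≤ ½
    κ≤½ = *-cancelˡ-≤ (nat k) 0<nat-k (≤-trans (≤-reflexive kκ≡1) (*-monoʳ ½ (<⇒≤ 0<½) (nat-mono {2} 2≤k)))

    excess : ℕ → ℚ
    excess j = nat (ℓ ℕ.⊓ j) - κ * nat j

    H : ℚ → ℕ → ℚ
    H = series excess

    2≤m : 2 ℕ.≤ m
    2≤m = ℕP.≤-trans 2≤k (ℕP.m≤m*n k ℓ {{ℕ.>-nonZero 1≤ℓ}})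

    κm≡ℓ : κ * nat m ≡ nat ℓ
    κm≡ℓ = trans (cong (κ *_) (nat-* k ℓ)) (trans (eq κ (nat k) (nat ℓ)) (trans (cong (_* nat ℓ) kκ≡1) (*-identityˡ (nat ℓ))))
      where
      eq : ∀ a b c → a * (b * c) ≡ b * a * c
      eq = solve-∀ ℚ-ring

    κ*j≤j : ∀ j → κ * nat j ≤ nat j
    κ*j≤j j = subst (κ * nat j ≤_) (*-identityˡ (nat j))
      (*-monoʳ (nat j) (nat≥0 j) (≤-trans κ≤½ (≤-cert ½ (<⇒≤ 0<½) refl)))

    excess-moderate : Moderate excess
    excess-moderate j = ∣∣≤-intro
      (≤-trans (≤-cert (κ * nat j) (*≥0 κ≥0 (nat≥0 j)) (eq₁ (nat (ℓ ℕ.⊓ j)) (κ * nat j)))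
        (≤-trans (nat-mono (ℕP.m⊓n≤n ℓ j)) (nat≤2^ j)))
      (≤-trans (≤-cert (nat (ℓ ℕ.⊓ j)) (nat≥0 (ℓ ℕ.⊓ j)) (eq₂ (nat (ℓ ℕ.⊓ j)) (κ * nat j)))
        (≤-trans (κ*j≤j j) (nat≤2^ j)))
      where
      eq₁ : ∀ a b → a ≡ a - b + b
      eq₁ = solve-∀ ℚ-ring
      eq₂ : ∀ a b → b ≡ - (a - b) + a
      eq₂ = solve-∀ ℚ-ring

    -- Up to j = kℓ both ℓ and j are at least j / k; from there on ℓ ≤ j / k. The linear coefficient
    -- 1 - 1 / k is at least ½ because k ≥ 2.
    excess-signChange : SignChange excess m
    excess-signChange = record
      { 2≤m = 2≤m ; before = before ; after = after ; linear = linear }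
      where
      before : ∀ j → j ℕ.≤ m → 0ℚ ≤ excess j
      before j j≤m with ℕP.⊓-sel ℓ j
      ... | inj₁ e = subst (λ n → 0ℚ ≤ nat n - κ * nat j) (sym e)
        (diff≥0 (subst (κ * nat j ≤_) κm≡ℓ (*-monoˡ κ κ≥0 (nat-mono j≤m))))
      ... | inj₂ e = subst (λ n → 0ℚ ≤ nat n - κ * nat j) (sym e) (diff≥0 (κ*j≤j j))
      after : ∀ j → m ℕ.≤ j → excess j ≤ 0ℚ
      after j m≤j = subst (excess j ≤_) (+-inverseʳ (κ * nat j)) (+-monoˡ-≤ (- (κ * nat j))
        (≤-trans (nat-mono (ℕP.m⊓n≤m ℓ j)) (subst (_≤ κ * nat j) κm≡ℓ (*-monoˡ κ κ≥0 (nat-mono m≤j)))))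
      linear : ½ ≤ excess 1
      linear = subst (λ n → ½ ≤ nat n - κ * nat 1) (sym (ℕP.m≥n⇒m⊓n≡n {ℓ} {1} 1≤ℓ))
        (≤-cert (½ - κ) (diff≥0 κ≤½) (eq κ))
        where
        eq : ∀ κ → 1ℚ + 0ℚ - κ * (1ℚ + 0ℚ) ≡ ½ + (½ - κ)
        eq = solve-∀ ℚ-ring

    truncated : ℚ → ℕ → ℚ
    truncated = series (λ j → nat (ℓ ℕ.⊓ j))

    -- From Σ j t^j / j! = t Σ t^j / j!: the part j / k of `excess` sums to t / k times an
    -- exponential sum with one term less.
    truncated-H : ∀ t J → truncated t (suc J) ≡ H t (suc J) + κ * t * expSum t J
    truncated-H t J = trans (∑-cong (suc J) λ j _ → eq₁ (nat (ℓ ℕ.⊓ j)) κ (nat j) (term t j))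
      (trans (∑-+ (suc J) (λ j → excess j * term t j) (λ j → κ * (nat j * term t j)))
        (cong (H t (suc J) +_) (trans (∑-*ˡ (suc J) κ (λ j → nat j * term t j))
          (trans (cong (κ *_) (series-nat t J)) (sym (*-assoc κ t (expSum t J)))))))
      where
      eq₁ : ∀ a κ n x → a * x ≡ (a - κ * n) * x + κ * (n * x)
      eq₁ = solve-∀ ℚ-ring

    truncated-deficit : ∀ t J → truncated t J + series (λ j → nat (ℓ ℕ.∸ j)) t J ≡ nat ℓ * expSum t J
    truncated-deficit t J = trans (sym (∑-+ J (λ j → nat (ℓ ℕ.⊓ j) * term t j) (λ j → nat (ℓ ℕ.∸ j) * term t j)))
      (trans (∑-cong J λ j _ → trans (sym (*-distribʳ-+ (term t j) (nat (ℓ ℕ.⊓ j)) (nat (ℓ ℕ.∸ j))))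
          (cong (_* term t j) (trans (sym (nat-+ (ℓ ℕ.⊓ j) (ℓ ℕ.∸ j)))
            (cong nat (trans (cong (ℕ._+ (ℓ ℕ.∸ j)) (ℕP.⊓-comm ℓ j)) (ℕP.m⊓n+n∸m≡n j ℓ))))))
        (∑-*ˡ J (nat ℓ) (term t)))

    -- At t = kℓ the mean t / k equals ℓ, so the series is -Σ max {ℓ - j , 0} t^j / j! up to the
    -- boundary term ℓ t^J / J!, and the deficit at j = 0 alone is ℓ. This gives the right end of
    -- the search interval.
    H-at-m : ∀ J → 2ℚ * term (nat m) J ≤ 1ℚ → H (nat m) (suc J) ≤ - ½
    H-at-m J h = ≤-cert
      (nat ℓ * ½ * (1ℚ - 2ℚ * term t J) + (series deficit t (suc J) - nat ℓ) + ½ * (nat ℓ - 1ℚ))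
      (+≥0 (+≥0 (*≥0 (*≥0 (nat≥0 ℓ) (<⇒≤ 0<½)) (diff≥0 h)) (diff≥0 deficit≥)) (*≥0 (<⇒≤ 0<½) (diff≥0 1≤nat-ℓ)))
      (trans (eq (nat ℓ) (term t J) (series deficit t (suc J)))
        (cong (_+ (nat ℓ * ½ * (1ℚ - 2ℚ * term t J) + (series deficit t (suc J) - nat ℓ) + ½ * (nat ℓ - 1ℚ))) (sym H≡)))
      where
      t = nat m
      deficit : ℕ → ℚ
      deficit j = nat (ℓ ℕ.∸ j)
      eq₁ : ∀ h p T s l → h ≡ ((h + l * p) + s) - s - l * p
      eq₁ = solve-∀ ℚ-ring
      eq₂ : ∀ p T s l → l * (p + T) - s - l * p ≡ l * T - s
      eq₂ = solve-∀ ℚ-ring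
      H≡ : H t (suc J) ≡ nat ℓ * term t J - series deficit t (suc J)
      H≡ = trans (eq₁ (H t (suc J)) (expSum t J) (term t J) (series deficit t (suc J)) (nat ℓ))
        (trans (cong (λ z → z - series deficit t (suc J) - nat ℓ * expSum t J)
          (trans (cong (_+ series deficit t (suc J))
              (sym (trans (truncated-H t J) (cong (λ z → H t (suc J) + z * expSum t J) κm≡ℓ))))
            (truncated-deficit t (suc J))))
          (eq₂ (expSum t J) (term t J) (series deficit t (suc J)) (nat ℓ)))
      deficit≥ : nat ℓ ≤ series deficit t (suc J)
      deficit≥ = subst (nat ℓ ≤_) (sym (∑-suc J (λ j → deficit j * term t j)))
        (≤-cert (∑ J (λ j → deficit (suc j) * term t (suc j)))
          (∑≥0 J λ j _ → *≥0 (nat≥0 (ℓ ℕ.∸ suc j)) (term≥0 (nat≥0 m) (suc j)))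
          (cong (_+ ∑ J (λ j → deficit (suc j) * term t (suc j))) (*-identityʳ (nat ℓ))))
      eq : ∀ l T s → - ½ ≡ l * T - s + (l * ½ * (1ℚ - 2ℚ * T) + (s - l) + ½ * (l - 1ℚ))
      eq = solve-∀ ℚ-ring

    -- For j ≥ 1 the coefficient is at least 1 - j / 2, so the series at ½ is at least ½ minus a
    -- quarter of a truncation of e^½, and such truncations are at most 2. This gives the left end
    -- of the search interval.
    H-at-½ : ∀ J → 0ℚ ≤ H ½ (suc (suc J))
    H-at-½ J = begin
      0ℚ ≤⟨ ≤-cert (∑ J (λ j → term ½ (suc (suc j))) + ½ * ½ * (1ℚ + 1ℚ - expSum ½ (suc J)))
               (+≥0 (∑≥0 J λ j _ → term≥0 (<⇒≤ 0<½) (suc (suc j)))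
                    (*≥0 (*≥0 (<⇒≤ 0<½) (<⇒≤ 0<½)) (diff≥0 (expSum-half (suc J)))))
               (eq₁ (∑ J (λ j → term ½ (suc (suc j)))) (expSum ½ (suc J))) ⟩
      (½ + ∑ J (λ j → term ½ (suc (suc j)))) + (- (½ * ½)) * expSum ½ (suc J)
        ≡⟨ cong₂ _+_ (sym (∑-suc J (λ j → term ½ (suc j)))) (sym (∑-*ˡ (suc J) (- (½ * ½)) (term ½))) ⟩
      ∑ (suc J) (λ j → term ½ (suc j)) + ∑ (suc J) (λ j → - (½ * ½) * term ½ j)
        ≡⟨ sym (∑-+ (suc J) (λ j → term ½ (suc j)) (λ j → - (½ * ½) * term ½ j)) ⟩
      ∑ (suc J) (λ j → term ½ (suc j) + - (½ * ½) * term ½ j)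
        ≤⟨ ∑-mono (suc J) (λ j _ → termwise j) ⟩
      ∑ (suc J) (λ j → excess (suc j) * term ½ (suc j))
        ≡⟨ trans (eq₂ κ (∑ (suc J) (λ j → excess (suc j) * term ½ (suc j))))
             (cong (λ n → (nat n - κ * 0ℚ) * 1ℚ + ∑ (suc J) (λ j → excess (suc j) * term ½ (suc j))) (sym (ℕP.⊓-zeroʳ ℓ))) ⟩
      excess 0 * 1ℚ + ∑ (suc J) (λ j → excess (suc j) * term ½ (suc j))
        ≡⟨ sym (∑-suc (suc J) (λ j → excess j * term ½ j)) ⟩
      H ½ (suc (suc J)) ∎
      where
      open ≤-Reasoning
      eq₁ : ∀ x p → (½ + x) + (- (½ * ½)) * p ≡ 0ℚ + (x + ½ * ½ * (1ℚ + 1ℚ - p))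
      eq₁ = solve-∀ ℚ-ring
      eq₂ : ∀ κ x → x ≡ (0ℚ - κ * 0ℚ) * 1ℚ + x
      eq₂ = solve-∀ ℚ-ring
      eq₃ : ∀ a κ n T → (a - κ * n) * T ≡ T + (- ½) * (n * T) + ((a - 1ℚ) * T + (½ - κ) * (n * T))
      eq₃ = solve-∀ ℚ-ring
      eq₄ : ∀ T → - ½ * (½ * T) ≡ - (½ * ½) * T
      eq₄ = solve-∀ ℚ-ring
      termwise : ∀ j → term ½ (suc j) + - (½ * ½) * term ½ j ≤ excess (suc j) * term ½ (suc j)
      termwise j = ≤-cert
        ((nat (ℓ ℕ.⊓ suc j) - 1ℚ) * T + (½ - κ) * (nat (suc j) * T))
        (+≥0 (*≥0 (diff≥0 (nat-mono {1} (ℕP.⊓-glb {1} {ℓ} {suc j} 1≤ℓ (ℕ.s≤s ℕ.z≤n)))) T≥0) (*≥0 (diff≥0 κ≤½) (*≥0 (nat≥0 (suc j)) T≥0)))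
        (trans (eq₃ (nat (ℓ ℕ.⊓ suc j)) κ (nat (suc j)) T)
          (cong (λ z → T + z + ((nat (ℓ ℕ.⊓ suc j) - 1ℚ) * T + (½ - κ) * (nat (suc j) * T)))
            (trans (cong (- ½ *_) (term-suc ½ j)) (eq₄ (term ½ j)))))
        where
        T = term ½ (suc j)
        T≥0 : 0ℚ ≤ T
        T≥0 = term≥0 (<⇒≤ 0<½) (suc j)

    β A : ℚ
    β = nat m
    A = ½ ^ m

    β≥½ : ½ ≤ β
    β≥½ = ≤-trans (≤-cert ½ (<⇒≤ 0<½) refl) (nat-mono {1} (ℕP.≤-trans (ℕP.n≤1+n 1) 2≤m))

    A>0 : 0ℚ < A
    A>0 = ^>0 0<½ m

    -- The mesh of the grid that cuts the interval from ½ to kℓ into n + 1 parts.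
    δ : ℕ → ℚ
    δ n = (β - ½) * inv n

    δ≥0 : ∀ n → 0ℚ ≤ δ n
    δ≥0 n = *≥0 (diff≥0 β≥½) (<⇒≤ (inv>0 n))

    δ→0 : ∀ ε → 0ℚ < ε → ∃ λ N → ∀ n → N ℕ.≤ n → δ n ≤ ε
    δ→0 ε ε>0 = let (N , h) = archimedean-* (β - ½) ε ε>0 in N , λ n l →
      *-cancelˡ-≤ (nat (suc n)) (nat>0 n) (≤-trans
        (≤-reflexive (trans (eq (nat (suc n)) (β - ½) (inv n)) (trans (cong ((β - ½) *_) (nat-inv n)) (*-identityʳ (β - ½)))))
        (≤-trans h (*-monoʳ ε (<⇒≤ ε>0) (nat-mono (ℕP.≤-trans l (ℕP.n≤1+n n))))))
      where
      eq : ∀ n w i → n * (w * i) ≡ w * (n * i)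
      eq = solve-∀ ℚ-ring

    -- The shift goes past the index from which 2 (kℓ)^J / J! ≤ 1, so that `H-at-m` applies at every
    -- depth.
    level : ℕ → ℕ
    level n = n ℕ.+ proj₁ (term→0 (nat≥0 m) 1ℚ 0<1)

    depth : ℕ → ℕ
    depth n = suc (suc (level n))

    n≤depth : ∀ n → n ℕ.≤ depth n
    n≤depth n = ℕP.≤-trans (ℕP.m≤m+n n _) (ℕP.≤-trans (ℕP.n≤1+n _) (ℕP.n≤1+n _))

    abstract
      bracket : ∀ n → ∃ λ s → ½ ≤ s × s + δ n ≤ β × 0ℚ ≤ H s (depth n) × H (s + δ n) (depth n) ≤ 0ℚ
      bracket n = let (i , i≤n , h₀ , h₁) = search (λ i → H (x i) (depth n)) n start end in
        x i , ≤-cert (nat i * δ n) (*≥0 (nat≥0 i) (δ≥0 n)) refl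
        , subst (_≤ β) (next i) (subst (x (suc i) ≤_) last
            (+-monoʳ-≤ ½ (*-monoʳ (δ n) (δ≥0 n) (nat-mono (ℕ.s≤s i≤n)))))
        , h₀ , subst (λ z → H z (depth n) ≤ 0ℚ) (next i) h₁
        where
        x : ℕ → ℚ
        x i = ½ + nat i * δ n
        eq₁ : ∀ d → ½ ≡ ½ + 0ℚ * d
        eq₁ = solve-∀ ℚ-ring
        eq₂ : ∀ n w i → ½ + n * ((w - ½) * i) ≡ ½ + (w - ½) * (n * i)
        eq₂ = solve-∀ ℚ-ring
        eq₃ : ∀ w → ½ + (w - ½) * 1ℚ ≡ w
        eq₃ = solve-∀ ℚ-ring
        eq₄ : ∀ i d → ½ + (1ℚ + i) * d ≡ ½ + i * d + d
        eq₄ = solve-∀ ℚ-ring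
        next : ∀ i → x (suc i) ≡ x i + δ n
        next i = eq₄ (nat i) (δ n)
        last : x (suc n) ≡ β
        last = trans (eq₂ (nat (suc n)) β (inv n)) (trans (cong (λ z → ½ + (β - ½) * z) (nat-inv n)) (eq₃ β))
        start : 0ℚ ≤ H (x 0) (depth n)
        start = subst (λ z → 0ℚ ≤ H z (depth n)) (eq₁ (δ n)) (H-at-½ (level n))
        end : H (x (suc n)) (depth n) ≤ 0ℚ
        end = subst (λ z → H z (depth n) ≤ 0ℚ) (sym last)
          (≤-trans (H-at-m (suc (level n)) (proj₁ (proj₂ (term→0 (nat≥0 m) 1ℚ 0<1)) (suc (level n))
              (ℕP.≤-trans (ℕP.m≤n+m _ n) (ℕP.n≤1+n _))))
            (neg-antimono-≤ (<⇒≤ 0<½)))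

    -- The right end of the bracket serves as the approximation because the truncated series is
    -- nonpositive there, as `negative-beyond` requires.
    lower root : ℕ → ℚ
    lower n = proj₁ (bracket n)
    root n  = lower n + δ n

    lower≥½ : ∀ n → ½ ≤ lower n
    lower≥½ n = proj₁ (proj₂ (bracket n))

    root≤β : ∀ n → root n ≤ β
    root≤β n = proj₁ (proj₂ (proj₂ (bracket n)))

    H-lower : ∀ n → 0ℚ ≤ H (lower n) (depth n)
    H-lower n = proj₁ (proj₂ (proj₂ (proj₂ (bracket n))))

    H-root : ∀ n → H (root n) (depth n) ≤ 0ℚ
    H-root n = proj₂ (proj₂ (proj₂ (proj₂ (bracket n))))

    lower≤root : ∀ n → lower n ≤ root n
    lower≤root n = ≤-cert (δ n) (δ≥0 n) refl

    root≥½ : ∀ n → ½ ≤ root n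
    root≥½ n = ≤-trans (lower≥½ n) (lower≤root n)

    0<root : ∀ n → 0ℚ < root n
    0<root n = <-≤-trans 0<½ (root≥½ n)

    ∣root∣≤β : ∀ n → ∣ root n ∣ ≤ β
    ∣root∣≤β n = subst (_≤ β) (sym (0≤p⇒∣p∣≡p (<⇒≤ (0<root n)))) (root≤β n)

    ∣lower∣≤β : ∀ n → ∣ lower n ∣ ≤ β
    ∣lower∣≤β n = subst (_≤ β) (sym (0≤p⇒∣p∣≡p (≤-trans (<⇒≤ 0<½) (lower≥½ n)))) (≤-trans (lower≤root n) (root≤β n))

    H-converges : ∀ ε → 0ℚ < ε → ∃ λ N → ∀ t → ∣ t ∣ ≤ β → ∀ J K → N ℕ.≤ J → N ℕ.≤ K → ∣ H t K - H t J ∣ ≤ ε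
    H-converges = series-converges excess excess-moderate (nat≥0 m)

    private
      upper-tail : ∀ {x y τ} → ∣ x - y ∣ ≤ τ → y ≤ 0ℚ → x ≤ τ
      upper-tail {x} {y} {τ} h y≤0 = ≤-cert (τ - (x - y) + - y)
        (+≥0 (diff≥0 (≤-trans (p≤∣p∣ (x - y)) h)) (neg≥0 y≤0)) (eq x y τ)
        where
        eq : ∀ x y t → t ≡ x + (t - (x - y) + - y)
        eq = solve-∀ ℚ-ring

      lower-tail : ∀ {x y τ} → ∣ x - y ∣ ≤ τ → 0ℚ ≤ y → - τ ≤ x
      lower-tail {x} {y} {τ} h y≥0 = ≤-cert (τ - - (x - y) + y)
        (+≥0 (diff≥0 (≤-trans (-p≤∣p∣ (x - y)) h)) y≥0) (eq x y τ)
        where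
        eq : ∀ x y t → x ≡ - t + (t - - (x - y) + y)
        eq = solve-∀ ℚ-ring

    -- Either the brackets force root n′ ≤ root n + δ n′, or lower n′ lies beyond root n. In the
    -- latter case the signs at the two points are the wrong way round up to τ at a common depth,
    -- and `separation` applies.
    overshoot : ∀ {τ} → 0ℚ ≤ τ → ∀ n n′ J →
      ∣ H (root n) (suc (suc J)) - H (root n) (depth n) ∣ ≤ τ →
      ∣ H (lower n′) (suc (suc J)) - H (lower n′) (depth n′) ∣ ≤ τ →
      A * (root n′ - root n) ≤ A * δ n′ + 2ℚ * 2ℚ * β ^ m * τ
    overshoot {τ} τ≥0 n n′ J h h′ = go (≤-total (lower n′) (root n))
      where
      eq₁ : ∀ A s d r x → A * d + x ≡ A * (s + d - r) + (A * (r - s) + x)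
      eq₁ = solve-∀ ℚ-ring
      eq₂ : ∀ A s d r → A * (s + d - r) ≡ A * d + A * (s - r)
      eq₂ = solve-∀ ℚ-ring
      Kτ : ℚ
      Kτ = 2ℚ * 2ℚ * β ^ m * τ
      Kτ≥0 : 0ℚ ≤ Kτ
      Kτ≥0 = *≥0 (*≥0 (*≥0 0≤2 0≤2) (^≥0 (nat≥0 m) m)) τ≥0
      go : lower n′ ≤ root n ⊎ root n ≤ lower n′ → A * (root n′ - root n) ≤ A * δ n′ + Kτ
      go (inj₁ l) = ≤-cert (A * (root n - lower n′) + Kτ) (+≥0 (*≥0 (<⇒≤ A>0) (diff≥0 l)) Kτ≥0)
        (eq₁ A (lower n′) (δ n′) (root n) Kτ)
      go (inj₂ l) = ≤-trans (≤-reflexive (eq₂ A (lower n′) (δ n′) (root n)))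
        (+-monoʳ-≤ (A * δ n′) (separation excess-signChange 0<½ (root≥½ n) l
          (≤-trans (lower≤root n′) (root≤β n′)) τ≥0 J (upper-tail h (H-root n)) (lower-tail h′ (H-lower n′))))

    precision : ∀ ε → 0ℚ < ε → ∃ λ τ → 0ℚ < τ × 2ℚ * 2ℚ * β ^ m * τ ≡ A * ε
    precision ε ε>0 = quotient (2ℚ * 2ℚ * β ^ m) (A * ε)
      (*>0 (*>0 0<2 0<2) (^>0 (<-≤-trans 0<½ β≥½) m)) (*>0 A>0 ε>0)
      where
      0<2 : 0ℚ < 2ℚ
      0<2 = +>0 0<1 0≤1

    root-cauchy : ∀ ε → 0ℚ < ε → ∃ λ N → ∀ n n′ → N ℕ.≤ n → N ℕ.≤ n′ → ∣ root n - root n′ ∣ < ε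
    root-cauchy ε ε>0 = N₁ ℕ.+ N₂ , λ n n′ l l′ → ≤-<-trans
        (∣∣≤-intro (close n′ n l′ l) (subst (_≤ ½ * ε) (eq₁ (root n) (root n′)) (close n n′ l l′)))
        (<-cert (½ * ε) ½ε>0 (eq₂ ε))
      where
      eq₁ : ∀ a b → b - a ≡ - (a - b)
      eq₁ = solve-∀ ℚ-ring
      eq₂ : ∀ e → e ≡ ½ * e + ½ * e
      eq₂ = solve-∀ ℚ-ring
      eq₃ : ∀ A e → A * (½ * (½ * e)) + A * (½ * (½ * e)) ≡ A * (½ * e)
      eq₃ = solve-∀ ℚ-ring
      ½ε>0 : 0ℚ < ½ * ε
      ½ε>0 = *>0 0<½ ε>0
      ¼ε = ½ * (½ * ε)
      ¼ε>0 : 0ℚ < ¼ε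
      ¼ε>0 = *>0 0<½ ½ε>0
      τ = proj₁ (precision ¼ε ¼ε>0)
      τ>0 : 0ℚ < τ
      τ>0 = proj₁ (proj₂ (precision ¼ε ¼ε>0))
      N₁ = proj₁ (H-converges τ τ>0)
      N₂ = proj₁ (δ→0 ¼ε ¼ε>0)
      tail = proj₂ (H-converges τ τ>0)
      close : ∀ n n′ → N₁ ℕ.+ N₂ ℕ.≤ n → N₁ ℕ.+ N₂ ℕ.≤ n′ → root n′ - root n ≤ ½ * ε
      close n n′ l l′ = *-cancelˡ-≤ A A>0 (≤-trans
        -- Both values are compared at the depth of n; changing the depth costs at most τ each.
        (overshoot (<⇒≤ τ>0) n n′ (level n)
          (tail (root n) (∣root∣≤β n) (depth n) (depth n) (deep n l) (deep n l))
          (tail (lower n′) (∣lower∣≤β n′) (depth n′) (depth n) (deep n′ l′) (deep n l)))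
        (≤-trans (+-mono-≤ (*-monoˡ A (<⇒≤ A>0) (proj₂ (δ→0 ¼ε ¼ε>0) n′ (ℕP.≤-trans (ℕP.m≤n+m N₂ N₁) l′)))
                           (≤-reflexive (proj₂ (proj₂ (precision ¼ε ¼ε>0)))))
          (≤-reflexive (eq₃ A ε))))
        where
        deep : ∀ n → N₁ ℕ.+ N₂ ℕ.≤ n → N₁ ℕ.≤ depth n
        deep n l = ℕP.≤-trans (ℕP.m≤m+n N₁ N₂) (ℕP.≤-trans l (n≤depth n))

    -- The series is nonpositive at `root` n and nonnegative at `lower` n, which is only δ n away,
    -- so the Lipschitz bound makes it small; changing the depth then costs a tail.
    root-residual : ∀ ε → 0ℚ < ε → ∃ λ N → ∀ n J → N ℕ.≤ n → N ℕ.≤ J → ∣ H (root n) J ∣ ≤ ε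
    root-residual ε ε>0 = N₁ ℕ.+ N₂ , λ n J l l′ → ≤-trans
        (subst (λ z → ∣ z ∣ ≤ ∣ H (root n) J - H (root n) (depth n) ∣ + ∣ H (root n) (depth n) ∣) (eq₁ (H (root n) J) (H (root n) (depth n)))
          (∣p+q∣≤∣p∣+∣q∣ (H (root n) J - H (root n) (depth n)) (H (root n) (depth n))))
        (≤-trans (+-mono-≤
            (proj₂ (H-converges (½ * ε) ½ε>0) (root n) (∣root∣≤β n) (depth n) J
              (ℕP.≤-trans (ℕP.m≤m+n N₁ N₂) (ℕP.≤-trans l (n≤depth n))) (ℕP.≤-trans (ℕP.m≤m+n N₁ N₂) l′))
            (residual n (ℕP.≤-trans (ℕP.m≤n+m N₂ N₁) l)))
          (≤-reflexive (eq₂ ε)))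
      where
      eq₁ : ∀ a b → a - b + b ≡ a
      eq₁ = solve-∀ ℚ-ring
      eq₂ : ∀ e → ½ * e + ½ * e ≡ e
      eq₂ = solve-∀ ℚ-ring
      ½ε>0 : 0ℚ < ½ * ε
      ½ε>0 = *>0 0<½ ε>0
      C = proj₁ (expSum-bounded {2ℚ * β} (*≥0 0≤2 (nat≥0 m)))
      C>0 = proj₁ (proj₂ (expSum-bounded {2ℚ * β} (*≥0 0≤2 (nat≥0 m))))
      C-bound = proj₂ (proj₂ (expSum-bounded {2ℚ * β} (*≥0 0≤2 (nat≥0 m))))
      2C>0 : 0ℚ < 2ℚ * C
      2C>0 = *>0 (+>0 0<1 0≤1) C>0
      η = quotient (2ℚ * C) (½ * ε) 2C>0 ½ε>0
      N₁ = proj₁ (H-converges (½ * ε) ½ε>0)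
      N₂ = proj₁ (δ→0 (proj₁ η) (proj₁ (proj₂ η)))
      residual : ∀ n → N₂ ℕ.≤ n → ∣ H (root n) (depth n) ∣ ≤ ½ * ε
      residual n l = ∣∣≤-intro (≤-trans (H-root n) (<⇒≤ ½ε>0)) (begin
        - H (root n) (depth n)
          ≤⟨ ≤-cert (H (lower n) (depth n)) (H-lower n) (eq₃ (H (lower n) (depth n)) (H (root n) (depth n))) ⟩
        H (lower n) (depth n) - H (root n) (depth n)
          ≤⟨ p≤∣p∣ (H (lower n) (depth n) - H (root n) (depth n)) ⟩
        ∣ H (lower n) (depth n) - H (root n) (depth n) ∣
          ≤⟨ series-lipschitz excess excess-moderate (∣lower∣≤β n) (∣root∣≤β n) (depth n) ⟩
        ∣ lower n - root n ∣ * (2ℚ * expSum (2ℚ * β) (depth n))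
          ≡⟨ cong (_* (2ℚ * expSum (2ℚ * β) (depth n))) (trans (cong ∣_∣ (eq₄ (lower n) (δ n)))
               (trans (∣-p∣≡∣p∣ (δ n)) (0≤p⇒∣p∣≡p (δ≥0 n)))) ⟩
        δ n * (2ℚ * expSum (2ℚ * β) (depth n))
          ≤⟨ *-mono (δ≥0 n) (<⇒≤ 2C>0) (proj₂ (δ→0 (proj₁ η) (proj₁ (proj₂ η))) n l) (*-monoˡ 2ℚ 0≤2 (C-bound (depth n))) ⟩
        proj₁ η * (2ℚ * C)
          ≡⟨ trans (*-comm (proj₁ η) (2ℚ * C)) (proj₂ (proj₂ η)) ⟩
        ½ * ε ∎)
        where
        open ≤-Reasoning
        eq₃ : ∀ a b → a - b ≡ - b + a
        eq₃ = solve-∀ ℚ-ring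
        eq₄ : ∀ s d → s - (s + d) ≡ - d
        eq₄ = solve-∀ ℚ-ring

-- Means of functions of binomial variables.

module BinomialMeans where

  open import Data.Rational.Base
  open import Data.Rational.Properties
  open Rationals
  open ExponentialSums
  open SignChanges
  open RationalRoot

  -- The expectation operator of one trial. Treating trials as operators on functions turns facts on
  -- binomial means into inductions on the number of trials.
  draw : ℚ → (ℕ → ℚ) → ℕ → ℚ
  draw q v c = q * v (suc c) + (1ℚ - q) * v c

  -- 𝔼 [v (c + Bin (d , q))]
  draws : ℚ → ℕ → (ℕ → ℚ) → ℕ → ℚ
  draws q zero    v = v
  draws q (suc d) v = draws q d (draw q v)

  Δ : (ℕ → ℚ) → ℕ → ℚ
  Δ v c = v (suc c) - v c

  draw-cong : ∀ q {v w} → (∀ c → v c ≡ w c) → ∀ c → draw q v c ≡ draw q w c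
  draw-cong q h c = cong₂ (λ x y → q * x + (1ℚ - q) * y) (h (suc c)) (h c)

  draws-cong : ∀ q d {v w} → (∀ c → v c ≡ w c) → ∀ c → draws q d v c ≡ draws q d w c
  draws-cong q zero    h = h
  draws-cong q (suc d) h = draws-cong q d (draw-cong q h)

  draws-linear : ∀ q d a v w c → draws q d (λ c → v c + a * w c) c ≡ draws q d v c + a * draws q d w c
  draws-linear q zero    a v w c = refl
  draws-linear q (suc d) a v w c = trans (draws-cong q d (λ c → eq q a (v (suc c)) (w (suc c)) (v c) (w c)) c)
    (draws-linear q d a (draw q v) (draw q w) c)
    where
    eq : ∀ q a x y z u → q * (x + a * y) + (1ℚ - q) * (z + a * u) ≡ q * x + (1ℚ - q) * z + a * (q * y + (1ℚ - q) * u)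
    eq = solve-∀ ℚ-ring

  draws-zero : ∀ d v c → draws 0ℚ d v c ≡ v c
  draws-zero zero    v c = refl
  draws-zero (suc d) v c = trans (draws-cong 0ℚ d (λ c → eq (v (suc c)) (v c)) c) (draws-zero d v c)
    where
    eq : ∀ x y → 0ℚ * x + (1ℚ - 0ℚ) * y ≡ y
    eq = solve-∀ ℚ-ring

  draws-const : ∀ q d a c → draws q d (λ _ → a) c ≡ a
  draws-const q zero    a c = refl
  draws-const q (suc d) a c = trans (draws-cong q d (λ _ → eq q a) c) (draws-const q d a c)
    where
    eq : ∀ q a → q * a + (1ℚ - q) * a ≡ a
    eq = solve-∀ ℚ-ring

  draws-nat : ∀ q d c → draws q d nat c ≡ nat c + nat d * q
  draws-nat q zero    c = eq (nat c) q
    where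
    eq : ∀ c q → c ≡ c + 0ℚ * q
    eq = solve-∀ ℚ-ring
  draws-nat q (suc d) c = trans (draws-cong q d (λ c → eq q (nat c)) c)
    (trans (draws-linear q d q nat (λ _ → 1ℚ) c)
      (trans (cong₂ (λ x y → x + q * y) (draws-nat q d c) (draws-const q d 1ℚ c)) (eq′ (nat c) (nat d) q)))
    where
    eq : ∀ q c → q * (1ℚ + c) + (1ℚ - q) * c ≡ c + q * 1ℚ
    eq = solve-∀ ℚ-ring
    eq′ : ∀ c d q → c + d * q + q * 1ℚ ≡ c + (1ℚ + d) * q
    eq′ = solve-∀ ℚ-ring

  Probability : ℚ → Set
  Probability q = 0ℚ ≤ q × q ≤ 1ℚ

  draws≥0 : ∀ {q} → Probability q → ∀ d {v} → (∀ c → 0ℚ ≤ v c) → ∀ c → 0ℚ ≤ draws q d v c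
  draws≥0 p zero    h = h
  draws≥0 p (suc d) h = draws≥0 p d λ c → +≥0 (*≥0 (proj₁ p) (h (suc c))) (*≥0 (diff≥0 (proj₂ p)) (h c))

  draws≤0 : ∀ {q} → Probability q → ∀ d {v} → (∀ c → v c ≤ 0ℚ) → ∀ c → draws q d v c ≤ 0ℚ
  draws≤0 p zero    h = h
  draws≤0 {q} p (suc d) {v} h = draws≤0 p d λ c → ≤-cert (q * - v (suc c) + (1ℚ - q) * - v c)
    (+≥0 (*≥0 (proj₁ p) (neg≥0 (h (suc c)))) (*≥0 (diff≥0 (proj₂ p)) (neg≥0 (h c)))) (eq q (v (suc c)) (v c))
    where
    eq : ∀ q x y → 0ℚ ≡ q * x + (1ℚ - q) * y + (q * - x + (1ℚ - q) * - y)
    eq = solve-∀ ℚ-ring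

  Δ-draw : ∀ q v c → Δ (draw q v) c ≡ draw q (Δ v) c
  Δ-draw q v c = eq q (v (suc (suc c))) (v (suc c)) (v c)
    where
    eq : ∀ q x y z → q * x + (1ℚ - q) * y - (q * y + (1ℚ - q) * z) ≡ q * (x - y) + (1ℚ - q) * (y - z)
    eq = solve-∀ ℚ-ring

  draw-change : ∀ q r v c → draw q v c ≡ draw r v c + (q - r) * Δ v c
  draw-change q r v c = eq q r (v (suc c)) (v c)
    where
    eq : ∀ q r x y → q * x + (1ℚ - q) * y ≡ r * x + (1ℚ - r) * y + (q - r) * (x - y)
    eq = solve-∀ ℚ-ring

  -- A single trial changes its probability from q to r; the other d trials stay at q.
  draws-change : ∀ q r d v c → draws q (suc d) v c ≡ draws q d (draw r v) c + (q - r) * draws q d (Δ v) c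
  draws-change q r d v c = trans (draws-cong q d (draw-change q r v) c) (draws-linear q d (q - r) (draw r v) (Δ v) c)

  Decreasing Concave : (ℕ → ℚ) → Set
  Decreasing w = ∀ c → Δ w c ≤ 0ℚ
  Concave v = Decreasing (Δ v)

  draw-decreasing : ∀ {r} → Probability r → ∀ {w} → Decreasing w → Decreasing (draw r w)
  draw-decreasing {r} p {w} h c = subst (_≤ 0ℚ) (sym (Δ-draw r w c)) (draws≤0 p 1 h c)

  -- The mean of a decreasing function decreases with the success probability. The factor q - r
  -- covers both orders of q and r: changing one trial produces the square (q - r)².
  draws-antimono : ∀ {q r} → Probability q → Probability r → ∀ d {w} → Decreasing w → ∀ c →
                   (q - r) * draws q d w c ≤ (q - r) * draws r d w c
  draws-antimono pq pr zero    h c = ≤-refl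
  draws-antimono {q} {r} pq pr (suc d) {w} h c = ≤-trans
    (≤-cert ((q - r) * (q - r) * - draws q d (Δ w) c) (*≥0 (square≥0 (q - r)) (neg≥0 (draws≤0 pq d h c)))
      (trans (eq (q - r) (draws q d (draw r w) c) (draws q d (Δ w) c))
        (cong (λ z → (q - r) * z + (q - r) * (q - r) * - draws q d (Δ w) c) (sym (draws-change q r d w c)))))
    (draws-antimono pq pr d (draw-decreasing pr h) c)
    where
    eq : ∀ e x y → e * x ≡ e * (x + e * y) + e * e * - y
    eq = solve-∀ ℚ-ring

  -- Trials are changed from q to r one at a time; concavity lets `draws-antimono` replace each
  -- increment by its value at r. The slope, d + 1 times the mean increment over d trials, is the
  -- derivative of the mean at r.
  tangent : ∀ {q r} → Probability q → Probability r → ∀ d {v} → Concave v → ∀ c →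
            draws q (suc d) v c ≤ draws r (suc d) v c + nat (suc d) * ((q - r) * draws r d (Δ v) c)
  tangent {q} {r} pq pr zero {v} h c = ≤-reflexive (trans (draw-change q r v c)
    (cong (draw r v c +_) (sym (*-identityˡ ((q - r) * Δ v c)))))
  tangent {q} {r} pq pr (suc d) {v} h c = begin
    draws q (suc (suc d)) v c
      ≡⟨ draws-change q r (suc d) v c ⟩
    draws q (suc d) (draw r v) c + (q - r) * draws q (suc d) (Δ v) c
      ≤⟨ +-mono-≤ (tangent pq pr d concave c) (draws-antimono pq pr (suc d) h c) ⟩
    draws r (suc d) (draw r v) c + nat (suc d) * ((q - r) * draws r d (Δ (draw r v)) c) + (q - r) * draws r (suc d) (Δ v) c
      ≡⟨ cong (λ z → draws r (suc d) (draw r v) c + nat (suc d) * ((q - r) * z) + (q - r) * draws r (suc d) (Δ v) c)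
           (draws-cong r d (Δ-draw r v) c) ⟩
    draws r (suc d) (draw r v) c + nat (suc d) * ((q - r) * draws r (suc d) (Δ v) c) + (q - r) * draws r (suc d) (Δ v) c
      ≡⟨ eq (draws r (suc d) (draw r v) c) (nat (suc d)) ((q - r) * draws r (suc d) (Δ v) c) ⟩
    draws r (suc (suc d)) v c + nat (suc (suc d)) * ((q - r) * draws r (suc d) (Δ v) c) ∎
    where
    open ≤-Reasoning
    eq : ∀ x n y → x + n * y + y ≡ x + (1ℚ + n) * y
    eq = solve-∀ ℚ-ring
    concave : Concave (draw r v)
    concave c = subst (_≤ 0ℚ) (cong₂ _-_ (sym (Δ-draw r v (suc c))) (sym (Δ-draw r v c))) (draw-decreasing pr {Δ v} h c)

  -- binomial d j = C(d , j) μʲ, the binomial weights in terms of the odds μ.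
  module Odds (μ : ℚ) (μ≥0 : 0ℚ ≤ μ) where

    binomial : ℕ → ℕ → ℚ
    binomial zero    zero    = 1ℚ
    binomial zero    (suc j) = 0ℚ
    binomial (suc d) zero    = binomial d zero
    binomial (suc d) (suc j) = binomial d (suc j) + μ * binomial d j

    binomial≥0 : ∀ d j → 0ℚ ≤ binomial d j
    binomial≥0 zero    zero    = 0≤1
    binomial≥0 zero    (suc j) = ≤-refl
    binomial≥0 (suc d) zero    = binomial≥0 d zero
    binomial≥0 (suc d) (suc j) = +≥0 (binomial≥0 d (suc j)) (*≥0 μ≥0 (binomial≥0 d j))

    binomial-zero : ∀ d → binomial d 0 ≡ 1ℚ
    binomial-zero zero    = refl
    binomial-zero (suc d) = binomial-zero d

    binomial-beyond : ∀ d j → d ℕ.< j → binomial d j ≡ 0ℚ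
    binomial-beyond zero    (suc j) l = refl
    binomial-beyond (suc d) (suc j) (ℕ.s≤s l) = trans
      (cong₂ (λ x y → x + μ * y) (binomial-beyond d (suc j) (ℕP.m<n⇒m<1+n l)) (binomial-beyond d j l)) (eq μ)
      where
      eq : ∀ μ → 0ℚ + μ * 0ℚ ≡ 0ℚ
      eq = solve-∀ ℚ-ring

    -- (j + 1) C(d , j + 1) = (d - j) C(d , j), multiplied by μ^(j+1) and freed of the subtraction.
    binomial-step : ∀ d j → nat (suc j) * binomial d (suc j) + μ * nat j * binomial d j ≡ nat d * μ * binomial d j
    binomial-step zero zero = eq μ
      where
      eq : ∀ μ → (1ℚ + 0ℚ) * 0ℚ + μ * 0ℚ * 1ℚ ≡ 0ℚ * μ * 1ℚ
      eq = solve-∀ ℚ-ring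
    binomial-step zero (suc j) = eq μ (nat j)
      where
      eq : ∀ μ j → (1ℚ + (1ℚ + j)) * 0ℚ + μ * (1ℚ + j) * 0ℚ ≡ 0ℚ * μ * 0ℚ
      eq = solve-∀ ℚ-ring
    binomial-step (suc d) zero = trans (eq₁ (binomial d 1) μ (binomial d 0))
      (trans (cong (_+ μ * binomial d 0) (binomial-step d 0)) (eq₂ μ (nat d) (binomial d 0)))
      where
      eq₁ : ∀ x μ y → (1ℚ + 0ℚ) * (x + μ * y) + μ * 0ℚ * y ≡ (1ℚ + 0ℚ) * x + μ * 0ℚ * y + μ * y
      eq₁ = solve-∀ ℚ-ring
      eq₂ : ∀ μ d y → d * μ * y + μ * y ≡ (1ℚ + d) * μ * y
      eq₂ = solve-∀ ℚ-ring
    binomial-step (suc d) (suc j) =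
      trans (eq₁ (nat j) μ (binomial d (suc (suc j))) (binomial d (suc j)) (binomial d j))
        (trans (cong₂ (λ x y → x + μ * y + μ * binomial d (suc j) + μ * μ * binomial d j)
            (binomial-step d (suc j)) (binomial-step d j))
          (eq₂ (nat d) μ (binomial d (suc j)) (binomial d j)))
      where
      eq₁ : ∀ j μ x y z → (1ℚ + (1ℚ + j)) * (x + μ * y) + μ * (1ℚ + j) * (y + μ * z) ≡
        (1ℚ + (1ℚ + j)) * x + μ * (1ℚ + j) * y + μ * ((1ℚ + j) * y + μ * j * z) + μ * y + μ * μ * z
      eq₁ = solve-∀ ℚ-ring
      eq₂ : ∀ d μ y z → d * μ * y + μ * (d * μ * z) + μ * y + μ * μ * z ≡ (1ℚ + d) * μ * (y + μ * z)
      eq₂ = solve-∀ ℚ-ring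

    weighted : ℕ → (ℕ → ℚ) → ℚ
    weighted d v = ∑ (suc d) λ j → binomial d j * v j

    weighted-suc : ∀ d v → weighted d (λ j → v j + μ * v (suc j)) ≡ weighted (suc d) v
    weighted-suc d v = begin
      ∑ (suc d) (λ j → b j * (v j + μ * v (suc j)))
        ≡⟨ ∑-cong (suc d) (λ j _ → eq₁ (b j) (v j) μ (v (suc j))) ⟩
      ∑ (suc d) (λ j → b j * v j + μ * b j * v (suc j))
        ≡⟨ ∑-+ (suc d) (λ j → b j * v j) (λ j → μ * b j * v (suc j)) ⟩
      ∑ (suc d) (λ j → b j * v j) + Y
        ≡⟨ cong (_+ Y) (trans (sym (trans (cong (λ z → ∑ (suc d) (λ j → b j * v j) + z * v (suc d))
                                             (binomial-beyond d (suc d) ℕP.≤-refl))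
                                           (eq₂ (∑ (suc d) (λ j → b j * v j)) (v (suc d)))))
                       (∑-suc (suc d) (λ j → b j * v j))) ⟩
      b 0 * v 0 + ∑ (suc d) (λ j → b (suc j) * v (suc j)) + Y
        ≡⟨ +-assoc (b 0 * v 0) (∑ (suc d) (λ j → b (suc j) * v (suc j))) Y ⟩
      b 0 * v 0 + (∑ (suc d) (λ j → b (suc j) * v (suc j)) + Y)
        ≡⟨ cong (b 0 * v 0 +_) (trans (sym (∑-+ (suc d) (λ j → b (suc j) * v (suc j)) (λ j → μ * b j * v (suc j))))
             (∑-cong (suc d) λ j _ → sym (*-distribʳ-+ (v (suc j)) (b (suc j)) (μ * b j)))) ⟩
      b 0 * v 0 + ∑ (suc d) (λ j → binomial (suc d) (suc j) * v (suc j))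
        ≡⟨ sym (∑-suc (suc d) (λ j → binomial (suc d) j * v j)) ⟩
      weighted (suc d) v ∎
      where
      open ≡-Reasoning
      b : ℕ → ℚ
      b = binomial d
      Y : ℚ
      Y = ∑ (suc d) λ j → μ * b j * v (suc j)
      eq₁ : ∀ b x μ y → b * (x + μ * y) ≡ b * x + μ * b * y
      eq₁ = solve-∀ ℚ-ring
      eq₂ : ∀ s x → s + 0ℚ * x ≡ s
      eq₂ = solve-∀ ℚ-ring

    weighted-cong : ∀ d {v w} → (∀ j → v j ≡ w j) → weighted d v ≡ weighted d w
    weighted-cong d h = ∑-cong (suc d) λ j _ → cong (binomial d j *_) (h j)

    weighted-scale : ∀ d a v → weighted d (λ j → a * v j) ≡ a * weighted d v
    weighted-scale d a v = trans (∑-cong (suc d) λ j _ → eq (binomial d j) a (v j)) (∑-*ˡ (suc d) a (λ j → binomial d j * v j))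
      where
      eq : ∀ b a x → b * (a * x) ≡ a * (b * x)
      eq = solve-∀ ℚ-ring

    -- For q = μ / (1 + μ) the binomial probabilities are the weights C(d , j) μ^j divided by (1 +
    -- μ)^d.
    weighted-draws : ∀ {q} → q * (1ℚ + μ) ≡ μ → ∀ d v → weighted d v ≡ (1ℚ + μ) ^ d * draws q d v 0
    weighted-draws e zero    v = +-identityˡ (1ℚ * v 0)
    weighted-draws {q} e (suc d) v = begin
      weighted (suc d) v                                  ≡⟨ sym (weighted-suc d v) ⟩
      weighted d (λ j → v j + μ * v (suc j))              ≡⟨ weighted-cong d (λ j → step (v j) (v (suc j))) ⟩
      weighted d (λ j → (1ℚ + μ) * draw q v j)            ≡⟨ weighted-scale d (1ℚ + μ) (draw q v) ⟩
      (1ℚ + μ) * weighted d (draw q v)                    ≡⟨ cong ((1ℚ + μ) *_) (weighted-draws e d (draw q v)) ⟩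
      (1ℚ + μ) * ((1ℚ + μ) ^ d * draws q d (draw q v) 0)  ≡⟨ sym (*-assoc (1ℚ + μ) ((1ℚ + μ) ^ d) (draws q d (draw q v) 0)) ⟩
      (1ℚ + μ) ^ suc d * draws q (suc d) v 0              ∎
      where
      open ≡-Reasoning
      eq₁ : ∀ q μ x y → (1ℚ + μ) * (q * y + (1ℚ - q) * x) ≡ q * (1ℚ + μ) * y + (1ℚ + μ - q * (1ℚ + μ)) * x
      eq₁ = solve-∀ ℚ-ring
      eq₂ : ∀ μ x y → μ * y + (1ℚ + μ - μ) * x ≡ x + μ * y
      eq₂ = solve-∀ ℚ-ring
      step : ∀ x y → x + μ * y ≡ (1ℚ + μ) * (q * y + (1ℚ - q) * x)
      step x y = sym (trans (eq₁ q μ x y) (trans (cong (λ z → z * y + (1ℚ + μ - z) * x) e) (eq₂ μ x y)))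

    module _ (d : ℕ) {t : ℚ} (t≡ : nat d * μ ≡ t) where

      private
        t≥0 : 0ℚ ≤ t
        t≥0 = subst (0ℚ ≤_) t≡ (*≥0 (nat≥0 d) μ≥0)

        step : ∀ j → nat (suc j) * binomial d (suc j) + μ * nat j * binomial d j ≡ t * binomial d j
        step j = trans (binomial-step d j) (cong (_* binomial d j) t≡)

      binomial≤term : ∀ j → binomial d j ≤ term t j
      binomial≤term zero    = ≤-reflexive (binomial-zero d)
      binomial≤term (suc j) = *-cancelˡ-≤ (nat (suc j)) (nat>0 j) (≤-trans
        (≤-cert (μ * nat j * binomial d j) (*≥0 (*≥0 μ≥0 (nat≥0 j)) (binomial≥0 d j)) (sym (step j)))
        (≤-trans (*-monoˡ t t≥0 (binomial≤term j)) (≤-reflexive (sym (term-suc t j)))))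

      -- The relative error of the Poisson approximation is at most j J / d. Each step of the
      -- recurrence neglects j μ times a binomial weight, and μ = t / d.
      term-binomial : ∀ J j → j ℕ.≤ J → nat d * (term t j - binomial d j) ≤ nat j * nat J * term t j
      term-binomial J zero    l = ≤-reflexive (trans (cong (λ z → nat d * (1ℚ - z)) (binomial-zero d)) (eq (nat d) (nat J)))
        where
        eq : ∀ d J → d * (1ℚ - 1ℚ) ≡ 0ℚ * J * 1ℚ
        eq = solve-∀ ℚ-ring
      term-binomial J (suc j) l = *-cancelˡ-≤ (nat (suc j)) (nat>0 j) (begin
        nat (suc j) * (nat d * (term t (suc j) - binomial d (suc j)))
          ≡⟨ eq₁ (nat (suc j)) (nat d) (term t (suc j)) (binomial d (suc j)) μ (nat j) (binomial d j) ⟩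
        nat d * (nat (suc j) * term t (suc j) - (nat (suc j) * binomial d (suc j) + μ * nat j * binomial d j)) + nat d * μ * (nat j * binomial d j)
          ≡⟨ cong₂ _+_ (cong₂ (λ x y → nat d * (x - y)) (term-suc t j) (step j)) (cong (_* (nat j * binomial d j)) t≡) ⟩
        nat d * (t * term t j - t * binomial d j) + t * (nat j * binomial d j)
          ≡⟨ eq₂ (nat d) t (term t j) (binomial d j) (nat j) ⟩
        t * (nat d * (term t j - binomial d j) + nat j * binomial d j)
          ≤⟨ *-monoˡ t t≥0 (+-mono-≤ (term-binomial J j j≤J) (*-mono (nat≥0 j) (term≥0 t≥0 j) (nat-mono j≤J) (binomial≤term j))) ⟩
        t * (nat j * nat J * term t j + nat J * term t j)
          ≡⟨ eq₃ t (nat j) (nat J) (term t j) ⟩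
        nat (suc j) * nat J * (t * term t j)
          ≡⟨ cong (nat (suc j) * nat J *_) (sym (term-suc t j)) ⟩
        nat (suc j) * nat J * (nat (suc j) * term t (suc j))
          ≡⟨ eq₄ (nat (suc j)) (nat J) (term t (suc j)) ⟩
        nat (suc j) * (nat (suc j) * nat J * term t (suc j)) ∎)
        where
        open ≤-Reasoning
        j≤J : j ℕ.≤ J
        j≤J = ℕP.≤-trans (ℕP.n≤1+n j) l
        eq₁ : ∀ s d x y μ j b → s * (d * (x - y)) ≡ d * (s * x - (s * y + μ * j * b)) + d * μ * (j * b)
        eq₁ = solve-∀ ℚ-ring
        eq₂ : ∀ d t x b j → d * (t * x - t * b) + t * (j * b) ≡ t * (d * (x - b) + j * b)
        eq₂ = solve-∀ ℚ-ring
        eq₃ : ∀ t j J x → t * (j * J * x + J * x) ≡ (1ℚ + j) * J * (t * x)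
        eq₃ = solve-∀ ℚ-ring
        eq₄ : ∀ s J x → s * J * (s * x) ≡ s * (s * J * x)
        eq₄ = solve-∀ ℚ-ring

      power≤expSum : ∀ {q} → q * (1ℚ + μ) ≡ μ → (1ℚ + μ) ^ d ≤ expSum t (suc d)
      power≤expSum {q} e = subst (_≤ expSum t (suc d))
        (trans (weighted-draws e d (λ _ → 1ℚ)) (trans (cong ((1ℚ + μ) ^ d *_) (draws-const q d 1ℚ 0)) (*-identityʳ ((1ℚ + μ) ^ d))))
        (∑-mono (suc d) λ j _ → subst (_≤ term t j) (sym (*-identityʳ (binomial d j))) (binomial≤term j))

      -- Binomial weights approach Poisson weights as d grows; beyond J the coefficients only help.
      weighted≤series : ∀ c → Moderate c → ∀ J → (∀ j → J ℕ.≤ j → c j ≤ 0ℚ) → J ℕ.≤ suc d →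
        nat d * weighted d c ≤ nat d * series c t J + nat J * nat J * expSum (2ℚ * t) J
      weighted≤series c hc J hJ J≤d = begin
        nat d * weighted d c
          ≤⟨ *-monoˡ (nat d) (nat≥0 d) dropTail ⟩
        nat d * ∑ J (λ j → binomial d j * c j)
          ≡⟨ sym (∑-*ˡ J (nat d) (λ j → binomial d j * c j)) ⟩
        ∑ J (λ j → nat d * (binomial d j * c j))
          ≤⟨ ∑-mono J termwise ⟩
        ∑ J (λ j → nat d * (c j * term t j) + nat J * nat J * term (2ℚ * t) j)
          ≡⟨ trans (∑-+ J (λ j → nat d * (c j * term t j)) (λ j → nat J * nat J * term (2ℚ * t) j))
               (cong₂ _+_ (∑-*ˡ J (nat d) (λ j → c j * term t j)) (∑-*ˡ J (nat J * nat J) (term (2ℚ * t)))) ⟩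
        nat d * series c t J + nat J * nat J * expSum (2ℚ * t) J ∎
        where
        open ≤-Reasoning
        flip : ∀ {x y} → - x ≤ - y → y ≤ x
        flip {x} {y} h = ≤-cert (- y - - x) (diff≥0 h) (eq x y)
          where
          eq : ∀ x y → x ≡ y + (- y - - x)
          eq = solve-∀ ℚ-ring
        dropTail : weighted d c ≤ ∑ J (λ j → binomial d j * c j)
        dropTail = flip (subst₂ _≤_ (negate J) (negate (suc d))
          (∑-monoˡ (λ j → (- 1ℚ) * (binomial d j * c j)) J≤d λ j l →
            subst (0ℚ ≤_) (eq (binomial d j) (c j)) (*≥0 (binomial≥0 d j) (neg≥0 (hJ j l)))))
          where
          eq : ∀ b c → b * - c ≡ (- 1ℚ) * (b * c)
          eq = solve-∀ ℚ-ring
          eq′ : ∀ x → (- 1ℚ) * x ≡ - x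
          eq′ = solve-∀ ℚ-ring
          negate : ∀ n → ∑ n (λ j → (- 1ℚ) * (binomial d j * c j)) ≡ - ∑ n (λ j → binomial d j * c j)
          negate n = trans (∑-*ˡ n (- 1ℚ) (λ j → binomial d j * c j)) (eq′ (∑ n (λ j → binomial d j * c j)))
        termwise : ∀ j → j ℕ.< J → nat d * (binomial d j * c j) ≤ nat d * (c j * term t j) + nat J * nat J * term (2ℚ * t) j
        -- With T_j the exponential term and b_j the binomial weight, c_j b_j = c_j T_j - c_j (T_j -
        -- b_j), where T_j ≥ b_j and -c_j ≤ 2^j.
        termwise j l = ≤-cert
          ((2ℚ ^ j + c j) * (nat d * (term t j - binomial d j)) + (nat J * nat J * (2ℚ ^ j * term t j) - 2ℚ ^ j * (nat d * (term t j - binomial d j))))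
          (+≥0 (*≥0 (subst (0ℚ ≤_) (eq₀ (2ℚ ^ j) (c j)) (diff≥0 (≤-trans (-p≤∣p∣ (c j)) (hc j))))
                    (*≥0 (nat≥0 d) (diff≥0 (binomial≤term j))))
               (diff≥0 error))
          (trans (cong (λ z → nat d * (c j * term t j) + nat J * nat J * z) (term-scale 2ℚ t j))
            (eq₁ (nat d) (c j) (term t j) (nat J * nat J * (2ℚ ^ j * term t j)) (binomial d j) (2ℚ ^ j)))
          where
          eq₀ : ∀ p c → p - - c ≡ p + c
          eq₀ = solve-∀ ℚ-ring
          eq₁ : ∀ d c x J b p → d * (c * x) + J ≡ d * (b * c) + ((p + c) * (d * (x - b)) + (J - p * (d * (x - b))))
          eq₁ = solve-∀ ℚ-ring
          eq₂ : ∀ p J x → p * (J * J * x) ≡ J * J * (p * x)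
          eq₂ = solve-∀ ℚ-ring
          error : 2ℚ ^ j * (nat d * (term t j - binomial d j)) ≤ nat J * nat J * (2ℚ ^ j * term t j)
          error = ≤-trans (*-monoˡ (2ℚ ^ j) (^≥0 0≤2 j) (≤-trans (term-binomial J j (ℕP.<⇒≤ l))
              (*-monoʳ (term t j) (term≥0 t≥0 j) (*-monoʳ (nat J) (nat≥0 J) (nat-mono (ℕP.<⇒≤ l))))))
            (≤-reflexive (eq₂ (2ℚ ^ j) (nat J) (term t j)))

-- A line above the capped binomial means.

module SupportingLine where

  open import Data.Rational.Base
  open import Data.Rational.Properties
  open Rationals
  open ExponentialSums
  open SignChanges
  open RationalRoot
  open BinomialMeans

  cap : ℕ → ℕ → ℚ
  cap ℓ c = nat (ℓ ℕ.⊓ c)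

  Δcap-below : ∀ {ℓ c} → c ℕ.< ℓ → Δ (cap ℓ) c ≡ 1ℚ
  Δcap-below {ℓ} {c} l = trans (cong₂ (λ x y → nat x - nat y) (ℕP.m≥n⇒m⊓n≡n l) (ℕP.m≥n⇒m⊓n≡n (ℕP.<⇒≤ l))) (eq (nat c))
    where
    eq : ∀ c → 1ℚ + c - c ≡ 1ℚ
    eq = solve-∀ ℚ-ring

  Δcap-above : ∀ {ℓ c} → ℓ ℕ.≤ c → Δ (cap ℓ) c ≡ 0ℚ
  Δcap-above {ℓ} {c} l = trans
    (cong₂ (λ x y → nat x - nat y) (ℕP.m≤n⇒m⊓n≡m (ℕP.≤-trans l (ℕP.n≤1+n c))) (ℕP.m≤n⇒m⊓n≡m l)) (+-inverseʳ (nat ℓ))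

  Δcap≥0 : ∀ ℓ c → 0ℚ ≤ Δ (cap ℓ) c
  Δcap≥0 ℓ c = diff≥0 (nat-mono (ℕP.⊓-monoʳ-≤ ℓ (ℕP.n≤1+n c)))

  cap-concave : ∀ ℓ → Concave (cap ℓ)
  cap-concave ℓ c = go (ℕP.≤-total ℓ (suc c))
    where
    eq′ : ∀ x → 0ℚ ≡ 0ℚ - x + x
    eq′ = solve-∀ ℚ-ring
    go : ℓ ℕ.≤ suc c ⊎ suc c ℕ.≤ ℓ → Δ (cap ℓ) (suc c) - Δ (cap ℓ) c ≤ 0ℚ
    go (inj₁ l) = subst (λ z → z - Δ (cap ℓ) c ≤ 0ℚ) (sym (Δcap-above l))
      (≤-cert (Δ (cap ℓ) c) (Δcap≥0 ℓ c) (eq′ (Δ (cap ℓ) c)))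
    go (inj₂ l) = go′ (ℕP.m≤n⇒m<n∨m≡n l)
      where
      go′ : suc c ℕ.< ℓ ⊎ suc c ≡ ℓ → Δ (cap ℓ) (suc c) - Δ (cap ℓ) c ≤ 0ℚ
      go′ (inj₁ l′) = ≤-reflexive (trans (cong₂ _-_ (Δcap-below l′) (Δcap-below l)) (+-inverseʳ 1ℚ))
      go′ (inj₂ e) = go (inj₁ (ℕP.≤-reflexive (sym e)))

  module _ (k ℓ : ℕ) (2≤k : 2 ℕ.≤ k) (1≤ℓ : 1 ℕ.≤ ℓ) where
    open Excess k ℓ 2≤k 1≤ℓ

    -- One draw probability q₀ per d, with odds t / d.
    private
      module Scale (t : ℚ) (t>0 : 0ℚ < t) (d : ℕ) where
        μ : ℚ
        μ = t * inv d

        μ>0 : 0ℚ < μ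
        μ>0 = *>0 t>0 (inv>0 d)

        dμ≡t : nat (suc d) * μ ≡ t
        dμ≡t = trans (eq (nat (suc d)) t (inv d)) (trans (cong (t *_) (nat-inv d)) (*-identityʳ t))
          where
          eq : ∀ n t i → n * (t * i) ≡ t * (n * i)
          eq = solve-∀ ℚ-ring

        1+μ>0 : 0ℚ < 1ℚ + μ
        1+μ>0 = +>0 0<1 (<⇒≤ μ>0)

        q₀ : ℚ
        q₀ = proj₁ (quotient (1ℚ + μ) μ 1+μ>0 μ>0)

        q₀>0 : 0ℚ < q₀
        q₀>0 = proj₁ (proj₂ (quotient (1ℚ + μ) μ 1+μ>0 μ>0))

        odds : q₀ * (1ℚ + μ) ≡ μ
        odds = trans (*-comm q₀ (1ℚ + μ)) (proj₂ (proj₂ (quotient (1ℚ + μ) μ 1+μ>0 μ>0)))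

        q₀≤μ : q₀ ≤ μ
        q₀≤μ = ≤-cert (q₀ * μ) (*≥0 (<⇒≤ q₀>0) (<⇒≤ μ>0)) (trans (sym odds) (eq q₀ μ))
          where
          eq : ∀ q μ → q * (1ℚ + μ) ≡ q + q * μ
          eq = solve-∀ ℚ-ring

        prob : Probability q₀
        prob = <⇒≤ q₀>0 , *-cancelˡ-≤ (1ℚ + μ) 1+μ>0
          (≤-cert 1ℚ 0≤1 (trans (eq μ) (cong (_+ 1ℚ) (trans (sym odds) (*-comm q₀ (1ℚ + μ))))))
          where
          eq : ∀ μ → (1ℚ + μ) * 1ℚ ≡ μ + 1ℚ
          eq = solve-∀ ℚ-ring

        open Odds μ (<⇒≤ μ>0) public

    -- Negativity passes from the truncated series to binomial means uniformly in d: the weighted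
    -- sum exceeds the series by O(1 / d) at most, the omitted coefficients being nonpositive, and
    -- the normalisation (1 + t / d)^d is bounded by the exponential series.
    deficit : ∀ t → 0ℚ < t → ∀ L → m ℕ.≤ suc (suc L) → H t (suc (suc L)) < 0ℚ →
      ∃ λ ε → 0ℚ < ε × ∃ λ d₀ → ∀ d → d₀ ℕ.≤ d →
        ∃ λ q → Probability q × 0ℚ < q × nat (suc d) * q ≤ t × draws q (suc d) excess 0 ≤ - ε
    deficit t t>0 L m≤J H<0 = proj₁ ε , proj₁ (proj₂ ε) , N ℕ.+ T , λ d l → q₀ t t>0 d , prob t t>0 d , q₀>0 t t>0 d
        , subst (nat (suc d) * q₀ t t>0 d ≤_) (dμ≡t t t>0 d) (*-monoˡ (nat (suc d)) (nat≥0 (suc d)) (q₀≤μ t t>0 d))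
        , bound d (ℕP.≤-trans (ℕP.m≤m+n N T) l) (ℕP.≤-trans (ℕP.m≤n+m T N) l)
      where
      open Scale
      T : ℕ
      T = suc (suc L)
      h : ℚ
      h = H t T
      -- Half of the negative value is kept; the other half pays for the Poisson approximation.
      η : ℚ
      η = ½ * - h
      η>0 : 0ℚ < η
      η>0 = *>0 0<½ (neg-antimono-< H<0)
      C : ℚ
      C = proj₁ (expSum-bounded (<⇒≤ t>0))
      C>0 : 0ℚ < C
      C>0 = proj₁ (proj₂ (expSum-bounded (<⇒≤ t>0)))
      ε : ∃ λ ε → 0ℚ < ε × C * ε ≡ η
      ε = quotient C η C>0 η>0
      R : ℚ
      R = nat T * nat T * expSum (2ℚ * t) T
      N : ℕ
      N = proj₁ (archimedean-* R η η>0)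
      eq₁ : ∀ n h R w → n * - (½ * - h) ≡ n * w + ((n * h + R - n * w) + (n * (½ * - h) - R))
      eq₁ = solve-∀ ℚ-ring
      eq₂ : ∀ p E → p * - E ≡ - (p * E)
      eq₂ = solve-∀ ℚ-ring
      eq₃ : ∀ x y → - x ≡ y + (- y - x)
      eq₃ = solve-∀ ℚ-ring
      bound : ∀ d → N ℕ.≤ d → T ℕ.≤ d → draws (q₀ t t>0 d) (suc d) excess 0 ≤ - proj₁ ε
      bound d N≤d J≤d = ≤-cert (- E - proj₁ ε) (diff≥0 (*-cancelˡ-≤ C C>0 (subst (_≤ C * - E) (sym (proj₂ (proj₂ ε))) (go (≤-total 0ℚ (- E))))))
          (eq₃ (proj₁ ε) E)
        where
        E : ℚ
        E = draws (q₀ t t>0 d) (suc d) excess 0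
        P : ℚ
        P = (1ℚ + μ t t>0 d) ^ suc d
        w : ℚ
        w = weighted t t>0 d (suc d) excess
        w≤ : w ≤ - η
        w≤ = *-cancelˡ-≤ (nat (suc d)) (nat>0 d) (≤-cert
          (nat (suc d) * h + R - nat (suc d) * w + (nat (suc d) * η - R))
          (+≥0 (diff≥0 (weighted≤series t t>0 d (suc d) (dμ≡t t t>0 d) excess excess-moderate T
                   (λ j l → SignChange.after excess-signChange j (ℕP.≤-trans m≤J l)) (ℕP.m≤n⇒m≤1+n (ℕP.m≤n⇒m≤1+n J≤d))))
               (diff≥0 (≤-trans (proj₂ (archimedean-* R η η>0)) (*-monoʳ η (<⇒≤ η>0) (nat-mono (ℕP.m≤n⇒m≤1+n N≤d))))))
          (eq₁ (nat (suc d)) h R w))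
        η≤ : η ≤ P * - E
        η≤ = subst (η ≤_) (sym (trans (eq₂ P E) (cong -_ (sym (weighted-draws t t>0 d {q₀ t t>0 d} (odds t t>0 d) (suc d) excess)))))
          (≤-cert (- η - w) (diff≥0 w≤) (eq₃ w η))
        P>0 : 0ℚ < P
        P>0 = ^>0 (1+μ>0 t t>0 d) (suc d)
        -- Replacing P by its upper bound C is legitimate only for -E ≥ 0; the other sign
        -- contradicts η > 0.
        go : 0ℚ ≤ - E ⊎ - E ≤ 0ℚ → η ≤ C * - E
        go (inj₁ E≤0) = ≤-trans η≤ (*-monoʳ (- E) E≤0
          (≤-trans (power≤expSum t t>0 d (suc d) (dμ≡t t t>0 d) {q₀ t t>0 d} (odds t t>0 d)) (proj₂ (proj₂ (expSum-bounded (<⇒≤ t>0))) (suc (suc d)))))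
        go (inj₂ E≥0) = contradiction (<-≤-trans η>0 (≤-trans η≤ (≤-trans (*-monoˡ P (<⇒≤ P>0) E≥0) (≤-reflexive (*-zeroʳ P)))))
                                      (<-irrefl refl)

    -- The tangent at the q of `deficit` has intercept a ≥ 0, and few cells mean M q ≤ k. Hence q (M
    -- a + b k) ≤ k (a + b q), which is k times the capped mean at q, hence at most n q - k ε for n
    -- = d + 1 trials.
    supporting-line : ∀ t → 0ℚ < t → ∀ L → m ℕ.≤ suc (suc L) → H t (suc (suc L)) < 0ℚ →
      ∃ λ D → ∃ λ d₀ → ∀ d → d₀ ℕ.≤ d → ∀ M → nat M * t ≤ nat k * nat (suc d) →
      ∃ λ a → ∃ λ b → 0ℚ ≤ b × (∀ q → Probability q → draws q (suc d) (cap ℓ) 0 ≤ a + b * q) ×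
        nat M * a + b * nat k ≤ nat (suc d) * (1ℚ - inv D)
    supporting-line t t>0 L m≤J H<0 = proj₁ small , d₀ , λ d l M hM → line d M hM (proj₂ (proj₂ (proj₂ Def)) d l)
      where
      Def = deficit t t>0 L m≤J H<0
      ε : ℚ
      ε = proj₁ Def
      ε>0 : 0ℚ < ε
      ε>0 = proj₁ (proj₂ Def)
      d₀ : ℕ
      d₀ = proj₁ (proj₂ (proj₂ Def))
      kε>0 : 0ℚ < nat k * ε
      kε>0 = *>0 0<nat-k ε>0
      -- D is chosen so that t / (D + 1) ≤ k ε; since n q ≤ t, the loss k ε then covers n q / (D +
      -- 1).
      σ : ∃ λ σ → 0ℚ < σ × t * σ ≡ nat k * ε
      σ = quotient t (nat k * ε) t>0 kε>0
      small : ∃ λ D → inv D ≤ proj₁ σ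
      small = small-inv (proj₁ σ) (proj₁ (proj₂ σ))
      D : ℕ
      D = proj₁ small
      t/D≤ : t * inv D ≤ nat k * ε
      t/D≤ = subst (t * inv D ≤_) (proj₂ (proj₂ σ)) (*-monoˡ t (<⇒≤ t>0) (proj₂ small))
      line : ∀ d M → nat M * t ≤ nat k * nat (suc d) →
        (∃ λ q → Probability q × 0ℚ < q × nat (suc d) * q ≤ t × draws q (suc d) excess 0 ≤ - ε) →
        ∃ λ a → ∃ λ b → 0ℚ ≤ b × (∀ q → Probability q → draws q (suc d) (cap ℓ) 0 ≤ a + b * q) ×
          nat M * a + b * nat k ≤ nat (suc d) * (1ℚ - inv D)
      line d M hM (q , pq , q>0 , nq≤t , E≤) = a , b , *≥0 (nat≥0 (suc d)) s≥0 , above , *-cancelˡ-≤ q q>0 (begin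
          q * (nat M * a + b * nat k)
            ≡⟨ eq₁ q (nat M) a b (nat k) ⟩
          nat M * q * a + q * b * nat k
            ≤⟨ +-monoˡ-≤ (q * b * nat k) (*-monoʳ a a≥0 Mq≤k) ⟩
          nat k * a + q * b * nat k
            ≡⟨ eq₂ (nat k) f n q s ⟩
          nat k * f
            ≡⟨ trans (cong (nat k *_) f≡) (trans (eq₃ (nat k) E κ (n * q)) (cong (λ z → nat k * E + z * (n * q)) kκ≡1)) ⟩
          nat k * E + 1ℚ * (n * q)
            ≤⟨ ≤-cert (nat k * (- ε - E) + (nat k * ε - t * inv D) + (t - n * q) * inv D)
                 (+≥0 (+≥0 (*≥0 (nat≥0 k) (diff≥0 E≤)) (diff≥0 t/D≤)) (*≥0 (diff≥0 nq≤t) (<⇒≤ (inv>0 D))))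
                 (eq₄ (nat k) E n q (inv D) t ε) ⟩
          q * (n * (1ℚ - inv D)) ∎)
        where
        open ≤-Reasoning
        n s f a b E : ℚ
        n = nat (suc d)
        s = draws q d (Δ (cap ℓ)) 0
        f = draws q (suc d) (cap ℓ) 0
        E = draws q (suc d) excess 0
        a = f - n * q * s
        b = n * s
        s≥0 : 0ℚ ≤ s
        s≥0 = draws≥0 pq d (Δcap≥0 ℓ) 0
        eq₁ : ∀ q M a b k → q * (M * a + b * k) ≡ M * q * a + q * b * k
        eq₁ = solve-∀ ℚ-ring
        eq₂ : ∀ k f n q s → k * (f - n * q * s) + q * (n * s) * k ≡ k * f
        eq₂ = solve-∀ ℚ-ring
        eq₃ : ∀ k E κ x → k * (E + κ * x) ≡ k * E + k * κ * x
        eq₃ = solve-∀ ℚ-ring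
        eq₄ : ∀ k E n q i t ε → q * (n * (1ℚ - i)) ≡
              k * E + 1ℚ * (n * q) + (k * (- ε - E) + (k * ε - t * i) + (t - n * q) * i)
        eq₄ = solve-∀ ℚ-ring
        eq₅ : ∀ f n q s r → f + n * ((r - q) * s) ≡ f - n * q * s + n * s * r
        eq₅ = solve-∀ ℚ-ring
        eq₇ : ∀ κ x y → x - κ * y + κ * y ≡ x
        eq₇ = solve-∀ ℚ-ring
        above : ∀ r → Probability r → draws r (suc d) (cap ℓ) 0 ≤ a + b * r
        above r pr = ≤-trans (tangent pr pq d (cap-concave ℓ) 0) (≤-reflexive (eq₅ f n q s r))
        a≥0 : 0ℚ ≤ a
        a≥0 = subst₂ _≤_ (trans (draws-zero (suc d) (cap ℓ) 0) (cong nat (ℕP.⊓-zeroʳ ℓ)))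
          (eq₈ a b) (above 0ℚ (≤-refl , 0≤1))
          where
          eq₈ : ∀ a b → a + b * 0ℚ ≡ a
          eq₈ = solve-∀ ℚ-ring
        f≡ : f ≡ E + κ * (n * q)
        f≡ = trans (draws-cong q (suc d) (λ j → sym (eq₇ κ (cap ℓ j) (nat j))) 0)
          (trans (draws-linear q (suc d) κ excess nat 0)
            (cong (λ z → E + κ * z) (trans (draws-nat q (suc d) 0) (+-identityˡ (n * q)))))
        Mq≤k : nat M * q ≤ nat k
        Mq≤k = *-cancelˡ-≤ n (nat>0 d) (≤-trans (≤-reflexive (eq₉ n (nat M) q))
          (≤-trans (*-monoˡ (nat M) (nat≥0 M) nq≤t) (≤-trans hM (≤-reflexive (*-comm (nat k) n)))))
          where
          eq₉ : ∀ n M q → n * (M * q) ≡ M * (n * q)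
          eq₉ = solve-∀ ℚ-ring

-- Sums over d-sets and over d-tuples.

module SubsetSums where

  open import Data.Bool.Base using (Bool; true; false; if_then_else_; _∨_)
  open import Data.Bool.Properties using (∨-identityʳ)
  open import Data.Fin.Base using (Fin; zero; suc)
  open import Data.Fin.Subset using (Subset; _∪_; _∩_; ∁; ⁅_⁆; ⊥) renaming (∣_∣ to card)
  open import Data.Fin.Subset.Properties using (∪-identityʳ)
  open import Data.List.Base using (List; []; _∷_; _++_; map; filter; length)
  open import Data.List.Properties using (filter-++; map-++)
  open import Data.Nat.Base
  open import Data.Nat.ListAction using () renaming (sum to sumList)
  open import Data.Nat.ListAction.Properties using (sum-++)
  open import Data.Nat.Properties
  open import Data.Nat.Tactic.RingSolver using () renaming (solve-∀ to solveℕ)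
  open import Data.Vec.Base using ([]; _∷_; lookup; tabulate)
  open import Data.Vec.Properties using (lookup∘tabulate)
  open import Algebra.Properties.CommutativeMonoid.Sum +-0-commutativeMonoid
    using (sum; ∑-comm; sum-cong-≗)

  sum-mono : ∀ {n} {f g : Fin n → ℕ} → (∀ i → f i ≤ g i) → sum f ≤ sum g
  sum-mono {zero}  h = z≤n
  sum-mono {suc n} h = +-mono-≤ (h zero) (sum-mono (h ∘ suc))

  sum-const : ∀ n a → sum {n} (λ _ → a) ≡ n * a
  sum-const zero    a = refl
  sum-const (suc n) a = cong (a +_) (sum-const n a)

  sum-*ˡ : ∀ {n} a (f : Fin n → ℕ) → sum (λ i → a * f i) ≡ a * sum f
  sum-*ˡ {zero}  a f = sym (*-zeroʳ a)
  sum-*ˡ {suc n} a f = trans (cong (a * f zero +_) (sum-*ˡ a (f ∘ suc))) (sym (*-distribˡ-+ a (f zero) (sum (f ∘ suc))))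

  -- Pascal's recursion in place of filtering the list of all subsets, so that sums over d-sets can
  -- be handled by structural induction.
  overSize : ∀ n → ℕ → (Subset n → ℕ) → ℕ
  overSize zero    zero    g = g []
  overSize zero    (suc d) g = 0
  overSize (suc n) zero    g = overSize n zero (g ∘ (false ∷_))
  overSize (suc n) (suc d) g = overSize n (suc d) (g ∘ (false ∷_)) + overSize n d (g ∘ (true ∷_))

  sumList-subsetsOfSize : ∀ n d g → sumList (map g (subsetsOfSize n d)) ≡ overSize n d g
  sumList-subsetsOfSize n d = go n d
    where
    ofSize : ∀ {n} d → List (Subset n) → List (Subset n)
    ofSize d = filter (λ A → card A ≟ d)
    false-zero : ∀ {n} d (g : Subset (suc n) → ℕ) xs →
      sumList (map g (ofSize d (map (false ∷_) xs))) ≡ sumList (map (g ∘ (false ∷_)) (ofSize d xs))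
    false-zero d g []       = refl
    false-zero d g (A ∷ xs) with does (card A ≟ d)
    ... | false = false-zero d g xs
    ... | true  = cong (g (false ∷ A) +_) (false-zero d g xs)
    true-suc : ∀ {n} d (g : Subset (suc n) → ℕ) xs →
      sumList (map g (ofSize (suc d) (map (true ∷_) xs))) ≡ sumList (map (g ∘ (true ∷_)) (ofSize d xs))
    true-suc d g []       = refl
    true-suc d g (A ∷ xs) with does (card A ≟ d)
    ... | false = true-suc d g xs
    ... | true  = cong (g (true ∷ A) +_) (true-suc d g xs)
    true-zero : ∀ {n} (g : Subset (suc n) → ℕ) xs → sumList (map g (ofSize 0 (map (true ∷_) xs))) ≡ 0
    true-zero g []       = refl
    true-zero g (A ∷ xs) = true-zero g xs
    split : ∀ {n} d (g : Subset (suc n) → ℕ) →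
      sumList (map g (subsetsOfSize (suc n) d)) ≡
      sumList (map g (ofSize d (map (false ∷_) (subsets n)))) + sumList (map g (ofSize d (map (true ∷_) (subsets n))))
    split {n} d g = begin
      sumList (map g (ofSize d (map (false ∷_) (subsets n) ++ map (true ∷_) (subsets n))))
        ≡⟨ cong (sumList ∘ map g) (filter-++ (λ A → card A ≟ d) (map (false ∷_) (subsets n)) (map (true ∷_) (subsets n))) ⟩
      sumList (map g (ofSize d (map (false ∷_) (subsets n)) ++ ofSize d (map (true ∷_) (subsets n))))
        ≡⟨ cong sumList (map-++ g (ofSize d (map (false ∷_) (subsets n))) (ofSize d (map (true ∷_) (subsets n)))) ⟩
      sumList (map g (ofSize d (map (false ∷_) (subsets n))) ++ map g (ofSize d (map (true ∷_) (subsets n))))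
        ≡⟨ sum-++ (map g (ofSize d (map (false ∷_) (subsets n)))) (map g (ofSize d (map (true ∷_) (subsets n)))) ⟩
      sumList (map g (ofSize d (map (false ∷_) (subsets n)))) + sumList (map g (ofSize d (map (true ∷_) (subsets n)))) ∎
      where open ≡-Reasoning
    go : ∀ n d g → sumList (map g (subsetsOfSize n d)) ≡ overSize n d g
    go zero    zero    g = +-identityʳ (g [])
    go zero    (suc d) g = refl
    go (suc n) zero    g = trans (split 0 g) (trans
      (cong₂ _+_ (trans (false-zero 0 g (subsets n)) (go n 0 (g ∘ (false ∷_)))) (true-zero g (subsets n)))
      (+-identityʳ (overSize n 0 (g ∘ (false ∷_)))))
    go (suc n) (suc d) g = trans (split (suc d) g) (cong₂ _+_
      (trans (false-zero (suc d) g (subsets n)) (go n (suc d) (g ∘ (false ∷_))))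
      (trans (true-suc d g (subsets n)) (go n d (g ∘ (true ∷_)))))

  length≡sumList : ∀ {A : Set} (xs : List A) → length xs ≡ sumList (map (λ _ → 1) xs)
  length≡sumList []       = refl
  length≡sumList (x ∷ xs) = cong suc (length≡sumList xs)

  overSize-mono : ∀ n d {f g} → (∀ A → f A ≤ g A) → overSize n d f ≤ overSize n d g
  overSize-mono zero    zero    h = h []
  overSize-mono zero    (suc d) h = z≤n
  overSize-mono (suc n) zero    h = overSize-mono n zero (h ∘ (false ∷_))
  overSize-mono (suc n) (suc d) h = +-mono-≤ (overSize-mono n (suc d) (h ∘ (false ∷_))) (overSize-mono n d (h ∘ (true ∷_)))

  overSize-cong : ∀ n d {f g} → (∀ A → f A ≡ g A) → overSize n d f ≡ overSize n d g
  overSize-cong n d h = ≤-antisym (overSize-mono n d λ A → ≤-reflexive (h A)) (overSize-mono n d λ A → ≤-reflexive (sym (h A)))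

  private
    interchange : ∀ a b c d → a + b + (c + d) ≡ a + c + (b + d)
    interchange = solveℕ

  overSize-+ : ∀ n d f g → overSize n d (λ A → f A + g A) ≡ overSize n d f + overSize n d g
  overSize-+ zero    zero    f g = refl
  overSize-+ zero    (suc d) f g = refl
  overSize-+ (suc n) zero    f g = overSize-+ n zero (f ∘ (false ∷_)) (g ∘ (false ∷_))
  overSize-+ (suc n) (suc d) f g = trans
    (cong₂ _+_ (overSize-+ n (suc d) (f ∘ (false ∷_)) (g ∘ (false ∷_))) (overSize-+ n d (f ∘ (true ∷_)) (g ∘ (true ∷_))))
    (interchange (overSize n (suc d) (f ∘ (false ∷_))) (overSize n (suc d) (g ∘ (false ∷_)))
                 (overSize n d (f ∘ (true ∷_))) (overSize n d (g ∘ (true ∷_))))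

  overSize-0 : ∀ n d → overSize n d (λ _ → 0) ≡ 0
  overSize-0 zero    zero    = refl
  overSize-0 zero    (suc d) = refl
  overSize-0 (suc n) zero    = overSize-0 n zero
  overSize-0 (suc n) (suc d) = cong₂ _+_ (overSize-0 n (suc d)) (overSize-0 n d)

  overSize-sum : ∀ n d {M} (f : Fin M → Subset n → ℕ) → overSize n d (λ A → sum λ i → f i A) ≡ sum λ i → overSize n d (f i)
  overSize-sum n d {zero}  f = overSize-0 n d
  overSize-sum n d {suc M} f = trans (overSize-+ n d (f zero) (λ A → sum λ i → f (suc i) A))
    (cong (overSize n d (f zero) +_) (overSize-sum n d (f ∘ suc)))

  overSize-zero : ∀ n g → overSize n 0 g ≡ g ⊥
  overSize-zero zero    g = refl
  overSize-zero (suc n) g = overSize-zero n (g ∘ (false ∷_))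

  -- x may already belong to A; such terms account for repeated entries of tuples.
  addOne : ∀ {n} → (Subset n → ℕ) → Subset n → ℕ
  addOne g A = sum λ x → g (A ∪ ⁅ x ⁆)

  -- Each (d+1)-set arises from its d-subsets in d + 1 ways.
  overSize-suc : ∀ n d g → suc d * overSize n (suc d) g ≤ overSize n d (addOne g)
  overSize-suc zero    d g = subst (_≤ overSize zero d (addOne g)) (sym (*-zeroʳ d)) z≤n
  overSize-suc (suc n) zero g = begin
    1 * (overSize n 1 g₀ + overSize n 0 g₁)         ≡⟨ eq (overSize n 1 g₀) (overSize n 0 g₁) ⟩
    overSize n 0 g₁ + 1 * overSize n 1 g₀           ≤⟨ +-monoʳ-≤ (overSize n 0 g₁) (overSize-suc n 0 g₀) ⟩
    overSize n 0 g₁ + overSize n 0 (addOne g₀)      ≡⟨ sym (overSize-+ n 0 g₁ (addOne g₀)) ⟩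
    overSize n 0 (λ A → g₁ A + addOne g₀ A)
      ≡⟨ overSize-cong n 0 (λ A → cong (λ B → g₁ B + addOne g₀ A) (sym (∪-identityʳ A))) ⟩
    overSize n 0 (addOne g ∘ (false ∷_)) ∎
    where
    open ≤-Reasoning
    g₀ g₁ : Subset n → ℕ
    g₀ = g ∘ (false ∷_)
    g₁ = g ∘ (true ∷_)
    eq : ∀ a b → 1 * (a + b) ≡ b + 1 * a
    eq = solveℕ
  overSize-suc (suc n) (suc d) g = begin
    suc (suc d) * (overSize n (suc (suc d)) g₀ + overSize n (suc d) g₁)
      ≡⟨ eq d (overSize n (suc (suc d)) g₀) (overSize n (suc d) g₁) ⟩
    overSize n (suc d) g₁ + suc (suc d) * overSize n (suc (suc d)) g₀ + suc d * overSize n (suc d) g₁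
      ≤⟨ +-mono-≤ (+-monoʳ-≤ (overSize n (suc d) g₁) (overSize-suc n (suc d) g₀)) (overSize-suc n d g₁) ⟩
    overSize n (suc d) g₁ + overSize n (suc d) (addOne g₀) + overSize n d (addOne g₁)
      ≡⟨ cong (_+ overSize n d (addOne g₁)) (sym (overSize-+ n (suc d) g₁ (addOne g₀))) ⟩
    overSize n (suc d) (λ A → g₁ A + addOne g₀ A) + overSize n d (addOne g₁)
      ≤⟨ +-mono-≤ (≤-reflexive (overSize-cong n (suc d) (λ A → cong (λ B → g₁ B + addOne g₀ A) (sym (∪-identityʳ A)))))
                  (overSize-mono n d λ A → m≤n+m (addOne g₁ A) (g (true ∷ (A ∪ ⊥)))) ⟩
    overSize n (suc d) (addOne g ∘ (false ∷_)) + overSize n d (addOne g ∘ (true ∷_)) ∎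
    where
    open ≤-Reasoning
    g₀ g₁ : Subset n → ℕ
    g₀ = g ∘ (false ∷_)
    g₁ = g ∘ (true ∷_)
    eq : ∀ d a b → suc (suc d) * (a + b) ≡ b + suc (suc d) * a + suc d * b
    eq = solveℕ

  -- The sum of g over the sets of entries of all d-tuples, started from a given set.
  overTuples : ∀ {n} → ℕ → (Subset n → ℕ) → Subset n → ℕ
  overTuples zero    g = g
  overTuples (suc d) g = overTuples d (addOne g)

  overTuples-mono : ∀ {n} d {f g : Subset n → ℕ} → (∀ A → f A ≤ g A) → ∀ A → overTuples d f A ≤ overTuples d g A
  overTuples-mono zero    h = h
  overTuples-mono (suc d) h = overTuples-mono d λ A → sum-mono λ x → h (A ∪ ⁅ x ⁆)

  -- Each d-set is the set of entries of d! tuples, and the tuples with repeated entries only add to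
  -- the right side. This trades hypergeometric counts for binomial ones.
  overSize≤overTuples : ∀ n d g → d ! * overSize n d g ≤ overTuples d g ⊥
  overSize≤overTuples n zero    g = ≤-reflexive (trans (+-identityʳ (overSize n 0 g)) (overSize-zero n g))
  overSize≤overTuples n (suc d) g = begin
    suc d * d ! * overSize n (suc d) g    ≡⟨ eq (suc d) (d !) (overSize n (suc d) g) ⟩
    d ! * (suc d * overSize n (suc d) g)  ≤⟨ *-monoʳ-≤ (d !) (overSize-suc n d g) ⟩
    d ! * overSize n d (addOne g)         ≤⟨ overSize≤overTuples n d (addOne g) ⟩
    overTuples d (addOne g) ⊥             ∎
    where
    open ≤-Reasoning
    eq : ∀ s f x → s * f * x ≡ f * (s * x)
    eq = solveℕ

  overTuples-const : ∀ {n} d a (A : Subset n) → overTuples d (λ _ → a) A ≤ n ^ d * a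
  overTuples-const         zero    a A = ≤-reflexive (sym (+-identityʳ a))
  overTuples-const {n} (suc d) a A = begin
    overTuples d (λ _ → sum {n} (λ _ → a)) A   ≤⟨ overTuples-const d (sum {n} (λ _ → a)) A ⟩
    n ^ d * sum {n} (λ _ → a)                  ≡⟨ cong (n ^ d *_) (sum-const n a) ⟩
    n ^ d * (n * a)                            ≡⟨ eq (n ^ d) n a ⟩
    n * n ^ d * a                              ∎
    where
    open ≤-Reasoning
    eq : ∀ p n a → p * (n * a) ≡ n * p * a
    eq = solveℕ

  numberOfSize : ℕ → ℕ → ℕ
  numberOfSize n d = overSize n d λ _ → 1

  length-subsetsOfSize : ∀ n d → length (subsetsOfSize n d) ≡ numberOfSize n d
  length-subsetsOfSize n d = trans (length≡sumList (subsetsOfSize n d)) (sumList-subsetsOfSize n d λ _ → 1)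

  numberOfSize≤ : ∀ n d → d ! * numberOfSize n d ≤ n ^ d
  numberOfSize≤ n d = ≤-trans (overSize≤overTuples n d (λ _ → 1))
    (≤-trans (overTuples-const d 1 ⊥) (≤-reflexive (*-identityʳ (n ^ d))))

  numberOfSize-suc : ∀ n d → suc d * numberOfSize n (suc d) + d * numberOfSize n d ≡ n * numberOfSize n d
  numberOfSize-suc zero    zero    = refl
  numberOfSize-suc zero    (suc d) = cong₂ _+_ (*-zeroʳ d) (*-zeroʳ d)
  numberOfSize-suc (suc n) zero    = trans (eq₁ (numberOfSize n 1) (numberOfSize n 0))
    (cong (_+_ (numberOfSize n 0)) (numberOfSize-suc n 0))
    where
    eq₁ : ∀ a b → 1 * (a + b) + 0 * b ≡ b + (1 * a + 0 * b)
    eq₁ = solveℕ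
  numberOfSize-suc (suc n) (suc d) = trans (eq₁ d (numberOfSize n (suc (suc d))) (numberOfSize n (suc d)) (numberOfSize n d))
    (trans (cong₂ (λ x y → x + y + (numberOfSize n (suc d) + numberOfSize n d)) (numberOfSize-suc n (suc d)) (numberOfSize-suc n d))
      (eq₂ n (numberOfSize n (suc d)) (numberOfSize n d)))
    where
    eq₁ : ∀ d a b c → suc (suc d) * (a + b) + suc d * (b + c) ≡
          (suc (suc d) * a + suc d * b) + (suc d * b + d * c) + (b + c)
    eq₁ = solveℕ
    eq₂ : ∀ n b c → n * b + n * c + (b + c) ≡ suc n * (b + c)
    eq₂ = solveℕ

  -- The falling factorial has d factors, each at least n - d. Together with `numberOfSize≤` this
  -- shows that allowing repetitions costs a factor tending to 1 as n grows.
  numberOfSize≥ : ∀ n d → (n ∸ d) ^ d ≤ d ! * numberOfSize n d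
  numberOfSize≥ n zero    = ≤-reflexive (sym (trans (+-identityʳ (numberOfSize n 0)) (overSize-zero n λ _ → 1)))
  numberOfSize≥ n (suc d) = begin
    (n ∸ suc d) ^ suc d                        ≤⟨ ^-monoˡ-≤ (suc d) (∸-monoʳ-≤ n (n≤1+n d)) ⟩
    (n ∸ d) * (n ∸ d) ^ d                      ≤⟨ *-monoʳ-≤ (n ∸ d) (numberOfSize≥ n d) ⟩
    (n ∸ d) * (d ! * numberOfSize n d)         ≡⟨ eq₁ (n ∸ d) (d !) (numberOfSize n d) ⟩
    d ! * ((n ∸ d) * numberOfSize n d)         ≡⟨ cong (d ! *_) (trans (*-distribʳ-∸ (numberOfSize n d) n d)
                                                    (trans (cong (_∸ d * numberOfSize n d) (sym (numberOfSize-suc n d)))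
                                                      (m+n∸n≡m (suc d * numberOfSize n (suc d)) (d * numberOfSize n d)))) ⟩
    d ! * (suc d * numberOfSize n (suc d))     ≡⟨ eq₂ (d !) (suc d) (numberOfSize n (suc d)) ⟩
    suc d * d ! * numberOfSize n (suc d)       ∎
    where
    open ≤-Reasoning
    eq₁ : ∀ a f x → a * (f * x) ≡ f * (a * x)
    eq₁ = solveℕ
    eq₂ : ∀ f s x → f * (s * x) ≡ s * f * x
    eq₂ = solveℕ

  indicator : Bool → ℕ
  indicator b = if b then 1 else 0

  card-∪⁅⁆ : ∀ {n} (A X : Subset n) x → card ((A ∪ ⁅ x ⁆) ∩ X) ≤ card (A ∩ X) + indicator (lookup X x)
  card-∪⁅⁆ (a ∷ A) (b ∷ X) zero = ≤-trans (≤-reflexive (cong (λ B → card (((a ∨ true) ∷ B) ∩ (b ∷ X))) (∪-identityʳ A))) (go a b)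
    where
    go : ∀ a b → card (((a ∨ true) ∷ A) ∩ (b ∷ X)) ≤ card ((a ∷ A) ∩ (b ∷ X)) + indicator b
    go false false = ≤-reflexive (sym (+-identityʳ (card (A ∩ X))))
    go false true  = ≤-reflexive (+-comm 1 (card (A ∩ X)))
    go true  false = ≤-reflexive (sym (+-identityʳ (card (A ∩ X))))
    go true  true  = m≤m+n (suc (card (A ∩ X))) 1
  card-∪⁅⁆ (false ∷ A) (b     ∷ X) (suc x) = card-∪⁅⁆ A X x
  card-∪⁅⁆ (true  ∷ A) (false ∷ X) (suc x) = card-∪⁅⁆ A X x
  card-∪⁅⁆ (true  ∷ A) (true  ∷ X) (suc x) = s≤s (card-∪⁅⁆ A X x)

  card≡sum : ∀ {n} (X : Subset n) → card X ≡ sum λ x → indicator (lookup X x)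
  card≡sum []          = refl
  card≡sum (false ∷ X) = card≡sum X
  card≡sum (true  ∷ X) = cong suc (card≡sum X)

  -- `draw` with success probability K / (K + K′), scaled by K + K′ to stay in ℕ.
  draw-ℕ : ℕ → ℕ → (ℕ → ℕ) → ℕ → ℕ
  draw-ℕ K K′ h c = K * h (suc c) + K′ * h c

  draws-ℕ : ℕ → ℕ → ℕ → (ℕ → ℕ) → ℕ → ℕ
  draws-ℕ K K′ zero    h = h
  draws-ℕ K K′ (suc d) h = draws-ℕ K K′ d (draw-ℕ K K′ h)

  Monotone : (ℕ → ℕ) → Set
  Monotone h = ∀ {a b} → a ≤ b → h a ≤ h b

  -- Only the elements of X can raise the count, each by at most one; an element drawn again does
  -- not, which the monotonicity of h turns into an inequality.
  addOne-∩ : ∀ {n} (X : Subset n) h → Monotone h → ∀ A →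
             addOne (λ A → h (card (A ∩ X))) A ≤ draw-ℕ (card X) (card (∁ X)) h (card (A ∩ X))
  addOne-∩ X h mono A = ≤-trans (sum-mono λ x → mono (card-∪⁅⁆ A X x)) (≤-reflexive (go X (card (A ∩ X))))
    where
    eq : ∀ a b c d → b + (c * a + d * b) ≡ c * a + suc d * b
    eq = solveℕ
    go : ∀ {n} (X : Subset n) c → sum (λ x → h (c + indicator (lookup X x))) ≡ draw-ℕ (card X) (card (∁ X)) h c
    go []          c = refl
    go (false ∷ X) c = trans (cong₂ _+_ (cong h (+-identityʳ c)) (go X c)) (eq (h (suc c)) (h c) (card X) (card (∁ X)))
    go (true  ∷ X) c = trans (cong₂ _+_ (cong h (+-comm c 1)) (go X c))
      (sym (+-assoc (h (suc c)) (card X * h (suc c)) (card (∁ X) * h c)))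

  overTuples-∩ : ∀ {n} d (X : Subset n) h → Monotone h → ∀ A →
    overTuples d (λ A → h (card (A ∩ X))) A ≤ draws-ℕ (card X) (card (∁ X)) d h (card (A ∩ X))
  overTuples-∩ zero    X h mono A = ≤-refl
  overTuples-∩ (suc d) X h mono A = ≤-trans (overTuples-mono d (addOne-∩ X h mono) A)
    (overTuples-∩ d X (draw-ℕ (card X) (card (∁ X)) h)
      (λ l → +-mono-≤ (*-monoʳ-≤ (card X) (mono (s≤s l))) (*-monoʳ-≤ (card (∁ X)) (mono l))) A)

  column : ∀ {n M} → (Fin n → Subset M) → Fin M → Subset n
  column S i = tabulate λ x → lookup (S x) i

  sum-column : ∀ {n M} (S : Fin n → Subset M) → sum (λ i → card (column S i)) ≡ sum λ x → card (S x)
  sum-column S = trans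
    (sum-cong-≗ λ i → trans (card≡sum (column S i))
      (sum-cong-≗ λ x → cong indicator (lookup∘tabulate (λ x → lookup (S x) i) x)))
    (trans (∑-comm (λ i x → indicator (lookup (S x) i))) (sum-cong-≗ λ x → sym (card≡sum (S x))))

  -- The elements of A outside X are removed one at a time, each without changing f. Applied to a
  -- cell of the encoding, this is the insertion of the non-writers last.
  ∩-local : ∀ {n} {C : Set} (X : Subset n) (f : Subset n → C) →
    (∀ A x → lookup X x ≡ false → f (A ∪ ⁅ x ⁆) ≡ f A) → ∀ A → f A ≡ f (A ∩ X)
  ∩-local []          f h []      = refl
  ∩-local (b ∷ X) f h (a ∷ A) = trans (∩-local X (f ∘ (a ∷_)) tail A) (head a b refl)
    where
    tail : ∀ B x → lookup X x ≡ false → f (a ∷ (B ∪ ⁅ x ⁆)) ≡ f (a ∷ B)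
    tail B x e = trans (cong (λ z → f (z ∷ (B ∪ ⁅ x ⁆))) (sym (∨-identityʳ a))) (h (a ∷ B) (suc x) e)
    head : ∀ a b′ → b′ ≡ b → f (a ∷ (A ∩ X)) ≡ f ((a ∷ A) ∩ (b′ ∷ X))
    head false b     e = refl
    head true  true  e = refl
    head true  false e = trans (cong (λ B → f (true ∷ B)) (sym (∪-identityʳ (A ∩ X)))) (h (false ∷ (A ∩ X)) zero (sym e))

-- Counting sketch states of bounded total weight.

module StateCodes where

  open import Data.Fin.Base using (Fin; zero; suc)
  open import Data.List.Base using (List; []; _∷_; _++_; [_]; map; filter; length; concatMap; cartesianProductWith; upTo)
  open import Data.List.Membership.Propositional using (_∈_; lose)
  open import Data.List.Membership.Propositional.Properties
    using (∈-∃++; ∈-concatMap⁺; ∈-cartesianProductWith⁺; ∈-upTo⁺; ∈-upTo⁻; ∈-++⁻; ∈-++⁺ˡ; ∈-++⁺ʳ)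
  open import Data.List.Properties using (length-++; length-map; length-upTo; length-++-sucʳ)
  open import Data.List.Relation.Unary.All as ListAll using ()
  open import Data.List.Relation.Unary.AllPairs using ([]; _∷_)
  open import Data.List.Relation.Unary.Any using (here; there)
  open import Data.List.Relation.Unary.Unique.Propositional using (Unique)
  open import Data.Nat.Base
  open import Data.Nat.ListAction using () renaming (sum to sumList)
  open import Data.Nat.Properties
  open import Data.Nat.Tactic.RingSolver using () renaming (solve-∀ to solveℕ)
  open import Data.Vec.Base using (Vec; []; _∷_; lookup)
  open import Data.Vec.Relation.Unary.All using (All; []; _∷_)
  open import Data.Vec.Relation.Unary.All.Properties using (lookup⁺)
  open import Algebra.Properties.CommutativeMonoid.Sum +-0-commutativeMonoid using (sum)

  module _ {A B : Set} where

    length-injection : ∀ (f : A → B) xs ys → Unique xs → (∀ {x} → x ∈ xs → f x ∈ ys) →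
      (∀ {x y} → x ∈ xs → y ∈ xs → f x ≡ f y → x ≡ y) → length xs ≤ length ys
    length-injection f []       ys u image inj = z≤n
    length-injection f (x ∷ xs) ys (x∉xs ∷ u) image inj with ∈-∃++ (image (here refl))
    ... | as , bs , refl = ≤-trans (s≤s (length-injection f xs (as ++ bs) u image′ λ p q → inj (there p) (there q)))
          (≤-reflexive (sym (length-++-sucʳ as (f x) bs)))
      where
      image′ : ∀ {y} → y ∈ xs → f y ∈ as ++ bs
      image′ {y} p with ∈-++⁻ as (image (there p))
      ... | inj₁ q         = ∈-++⁺ˡ q
      ... | inj₂ (here e)  = contradiction (inj (here refl) (there p) (sym e)) (ListAll.lookup x∉xs p)
      ... | inj₂ (there q) = ∈-++⁺ʳ as q

    length-concatMap-≤ : ∀ (f : A → List B) b xs → (∀ {x} → x ∈ xs → length (f x) ≤ b) →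
                         length (concatMap f xs) ≤ length xs * b
    length-concatMap-≤ f b []       h = z≤n
    length-concatMap-≤ f b (x ∷ xs) h = ≤-trans (≤-reflexive (length-++ (f x)))
      (+-mono-≤ (h (here refl)) (length-concatMap-≤ f b xs (h ∘ there)))

  length-cartesianProductWith : ∀ {A B C : Set} (f : A → B → C) xs ys →
                                length (cartesianProductWith f xs ys) ≡ length xs * length ys
  length-cartesianProductWith f []       ys = refl
  length-cartesianProductWith f (x ∷ xs) ys = trans (length-++ (map (f x) ys))
    (cong₂ _+_ (length-map (f x) ys) (length-cartesianProductWith f xs ys))

  module _ {A : Set} {Q : Pred A 0ℓ} (Q? : Decidable Q) where

    length-markov : ∀ (f : A → ℕ) c → (∀ {x} → Q x → c ≤ f x) → ∀ xs → c * length (filter Q? xs) ≤ sumList (map f xs)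
    length-markov f c h []       = ≤-reflexive (*-zeroʳ c)
    length-markov f c h (x ∷ xs) with Q? x
    ... | yes q = ≤-trans (≤-reflexive (*-suc c (length (filter Q? xs)))) (+-mono-≤ (h q) (length-markov f c h xs))
    ... | no ¬q = ≤-trans (length-markov f c h xs) (m≤n+m (sumList (map f xs)) (f x))

    length-filter-split : ∀ {P R : Pred A 0ℓ} (P? : Decidable P) (R? : Decidable R) → (∀ {x} → ¬ Q x → R x) → ∀ xs →
      length (filter P? xs) ≤ length (filter Q? xs) + length (filter (λ x → P? x ×-dec R? x) xs)
    length-filter-split P? R? h []       = z≤n
    length-filter-split P? R? h (x ∷ xs) with P? x | Q? x | R? x
    ... | no _  | no _  | _     = length-filter-split P? R? h xs
    ... | no _  | yes _ | _     = m≤n⇒m≤1+n (length-filter-split P? R? h xs)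
    ... | yes _ | yes _ | no _  = s≤s (length-filter-split P? R? h xs)
    ... | yes _ | yes _ | yes _ = s≤s (≤-trans (length-filter-split P? R? h xs)
          (+-monoʳ-≤ (length (filter Q? xs)) (n≤1+n _)))
    ... | yes _ | no ¬q | no ¬r = contradiction (h ¬q) ¬r
    ... | yes _ | no _  | yes _ = ≤-trans (s≤s (length-filter-split P? R? h xs))
          (≤-reflexive (sym (+-suc (length (filter Q? xs)) _)))

  Choices : ∀ {M} → Vec ℕ M → Set
  Choices {M} size = (i : Fin M) → ℕ → List (Fin (lookup size i))

  -- The states whose i-th cell lies in L i (w i) for some weights w i ≤ ℓ of total at most b.
  codes : ∀ {M} (ℓ : ℕ) (size : Vec ℕ M) → Choices size → ℕ → List (All Fin size)
  codes ℓ []       L b = [ [] ]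
  codes ℓ (s ∷ ss) L b = concatMap
    (λ w → cartesianProductWith _∷_ (L zero w) (codes ℓ ss (L ∘ suc) (b ∸ w))) (upTo (suc (ℓ ⊓ b)))

  ∈-codes : ∀ {M ℓ} {size : Vec ℕ M} (L : Choices size) {b} (w : Fin M → ℕ) (σ : All Fin size) →
    (∀ i → w i ≤ ℓ) → (∀ i → lookup⁺ σ i ∈ L i (w i)) → sum w ≤ b → σ ∈ codes ℓ size L b
  ∈-codes {ℓ = ℓ} {[]} L w [] w≤ℓ mem w≤b = here refl
  ∈-codes {ℓ = ℓ} {s ∷ ss} L {b} w (x ∷ σ) w≤ℓ mem w≤b = ∈-concatMap⁺
    (λ w → cartesianProductWith _∷_ (L zero w) (codes ℓ ss (L ∘ suc) (b ∸ w)))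
    (lose (∈-upTo⁺ (s≤s (⊓-glb (w≤ℓ zero) (≤-trans (m≤m+n (w zero) (sum (w ∘ suc))) w≤b))))
      (∈-cartesianProductWith⁺ _∷_ (mem zero) (∈-codes (L ∘ suc) (w ∘ suc) σ (w≤ℓ ∘ suc) (mem ∘ suc)
        (≤-trans (≤-reflexive (sym (m+n∸m≡n (w zero) (sum (w ∘ suc))))) (∸-monoˡ-≤ (w zero) w≤b)))))

  -- Each cell has at most ℓ + 1 weights to choose from and contributes a factor Y; the powers V^w
  -- of the cells multiply to at most V^b.
  length-codes : ∀ {M ℓ} {size : Vec ℕ M} (L : Choices size) Y V → .{{NonZero V}} →
    (∀ i w → w ≤ ℓ → length (L i w) ≤ Y * V ^ w) → ∀ b → length (codes ℓ size L b) ≤ suc ℓ ^ M * Y ^ M * V ^ b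
  length-codes {ℓ = ℓ} {[]}     L Y V h b = ≤-trans (m^n>0 V b) (≤-reflexive (sym (+-identityʳ (V ^ b))))
  length-codes {suc M} {ℓ} {s ∷ ss} L Y V h b = ≤-trans
    (length-concatMap-≤ branch (Y * (suc ℓ ^ M * Y ^ M * V ^ b)) (upTo (suc (ℓ ⊓ b))) λ {w} w∈ → bound w (s≤s⁻¹ (∈-upTo⁻ w∈)))
    (≤-trans (*-monoˡ-≤ (Y * (suc ℓ ^ M * Y ^ M * V ^ b)) (≤-trans (≤-reflexive (length-upTo (suc (ℓ ⊓ b)))) (s≤s (m⊓n≤m ℓ b))))
      (≤-reflexive (eq (suc ℓ) Y (suc ℓ ^ M) (Y ^ M) (V ^ b))))
    where
    branch : ℕ → List (All Fin (s ∷ ss))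
    branch w = cartesianProductWith _∷_ (L zero w) (codes ℓ ss (L ∘ suc) (b ∸ w))
    eq : ∀ l Y A B C → l * (Y * (A * B * C)) ≡ l * A * (Y * B) * C
    eq = solveℕ
    eq′ : ∀ Y v A B c → Y * v * (A * B * c) ≡ Y * (A * B * (v * c))
    eq′ = solveℕ
    bound : ∀ w → w ≤ ℓ ⊓ b → length (branch w) ≤ Y * (suc ℓ ^ M * Y ^ M * V ^ b)
    bound w l = begin
      length (branch w)
        ≡⟨ length-cartesianProductWith _∷_ (L zero w) (codes ℓ ss (L ∘ suc) (b ∸ w)) ⟩
      length (L zero w) * length (codes ℓ ss (L ∘ suc) (b ∸ w))
        ≤⟨ *-mono-≤ (h zero w (≤-trans l (m⊓n≤m ℓ b))) (length-codes {size = ss} (L ∘ suc) Y V (h ∘ suc) (b ∸ w)) ⟩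
      Y * V ^ w * (suc ℓ ^ M * Y ^ M * V ^ (b ∸ w))
        ≡⟨ eq′ Y (V ^ w) (suc ℓ ^ M) (Y ^ M) (V ^ (b ∸ w)) ⟩
      Y * (suc ℓ ^ M * Y ^ M * (V ^ w * V ^ (b ∸ w)))
        ≡⟨ cong (λ z → Y * (suc ℓ ^ M * Y ^ M * z)) (trans (sym (^-distribˡ-+-* V w (b ∸ w)))
             (cong (V ^_) (m+[n∸m]≡n (≤-trans l (m⊓n≤n ℓ b))))) ⟩
      Y * (suc ℓ ^ M * Y ^ M * V ^ b) ∎
      where open ≤-Reasoning

-- The success count once the randomness is fixed.

module FixedRandomness where

  open import Data.Bool.Base using (true; false)
  open import Data.Fin.Base using (Fin; zero; suc)
  open import Data.Fin.Subset using (Subset; _∪_; _∩_; ∁; ⁅_⁆; ⊥) renaming (∣_∣ to card)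
  open import Data.Fin.Subset.Properties using (∩-zeroˡ; ∣⊥∣≡0; ∣∁p∣≡n∸∣p∣; ∣p∣≤n)
  open import Data.List.Base using (List; []; _∷_; map; filter; length; allFin)
  open import Data.List.Membership.Propositional using (_∈_)
  open import Data.List.Membership.Propositional.Properties using (∈-map⁺; ∈-filter⁺; ∈-filter⁻; ∈-allFin; ∈-++⁺ˡ; ∈-++⁺ʳ)
  open import Data.List.Properties using (length-map; length-tabulate)
  open import Data.List.Relation.Unary.AllPairs using ([]; _∷_)
  open import Data.List.Relation.Unary.All using ([])
  open import Data.List.Relation.Unary.Any using (here)
  open import Data.List.Relation.Unary.Unique.Propositional using (Unique)
  open import Data.List.Relation.Unary.Unique.Propositional.Properties using (filter⁺; map⁺; ++⁺)
  open import Data.List.Membership.Propositional.Properties using (∈-map⁻)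
  open import Data.Nat.Base
  open import Data.Nat.Properties
  open import Data.Nat.Tactic.RingSolver using () renaming (solve-∀ to solveℕ)
  open import Data.Vec.Base using (Vec; []; _∷_; lookup)
  open import Data.Vec.Properties using (lookup∘tabulate; ∷-injectiveʳ)
  open import Data.Vec.Relation.Unary.All using (All)
  open import Data.Vec.Relation.Unary.All.Properties using (lookup⁺)
  open import Relation.Nullary using (Dec)
  open import Algebra.Properties.CommutativeMonoid.Sum +-0-commutativeMonoid using (sum)
  open Rationals using (nat; nat≥0; nat-+; nat-*; nat-mono; nat-cancel-≤; inv; inv>0; nat-inv; ℚ-ring; *≥0; *-monoˡ; *-monoʳ)
  open BinomialMeans using (draw; draws; draws-cong; Probability)
  open SupportingLine using (cap)
  open SubsetSums
  open StateCodes


  subsets-unique : ∀ n → Unique (subsets n)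
  subsets-unique zero    = [] ∷ []
  subsets-unique (suc n) = ++⁺ (map⁺ ∷-injectiveʳ (subsets-unique n)) (map⁺ ∷-injectiveʳ (subsets-unique n)) disjoint
    where
    disjoint : ∀ {A} → A ∈ map (false ∷_) (subsets n) × A ∈ map (true ∷_) (subsets n) → _
    disjoint (p , q) with ∈-map⁻ (false ∷_) p | ∈-map⁻ (true ∷_) q
    ... | _ , _ , refl | _ , _ , ()

  ∈-subsets : ∀ {n} (A : Subset n) → A ∈ subsets n
  ∈-subsets []          = here refl
  ∈-subsets (false ∷ A) = ∈-++⁺ˡ (∈-map⁺ (false ∷_) (∈-subsets A))
  ∈-subsets (true  ∷ A) = ∈-++⁺ʳ (map (false ∷_) (subsets _)) (∈-map⁺ (true ∷_) (∈-subsets A))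

  ∈-subsetsOfSize : ∀ {n} (A : Subset n) → A ∈ subsetsOfSize n (card A)
  ∈-subsetsOfSize A = ∈-filter⁺ (λ B → card B ≟ card A) (∈-subsets A) refl

  length-subsetsOfSize≤ : ∀ n w → length (subsetsOfSize n w) ≤ n ^ w
  length-subsetsOfSize≤ n w = ≤-trans (≤-reflexive (length-subsetsOfSize n w))
    (≤-trans (≤-trans (≤-reflexive (sym (+-identityʳ (numberOfSize n w)))) (*-monoˡ-≤ (numberOfSize n w) (1≤n! w)))
      (numberOfSize≤ n w))

  ^-distribʳ-* : ∀ d a b → (a * b) ^ d ≡ a ^ d * b ^ d
  ^-distribʳ-* zero    a b = refl
  ^-distribʳ-* (suc d) a b = trans (cong (a * b *_) (^-distribʳ-* d a b)) (eq a b (a ^ d) (b ^ d))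
    where
    eq : ∀ a b c e → a * b * (c * e) ≡ a * c * (b * e)
    eq = solveℕ

  square-cancel-≤ : ∀ {a b} → a * a ≤ b * b → a ≤ b
  square-cancel-≤ {a} {b} h = ≮⇒≥ λ b<a → <-irrefl refl (<-≤-trans (*-mono-< b<a b<a) h)

  -- Bernoulli's inequality (1 - d / n)^e ≥ 1 - e d / n, cleared of denominators.
  bernoulli : ∀ n d e → n * n ^ e ≤ n * (n ∸ d) ^ e + e * d * n ^ e
  bernoulli n d zero    = m≤m+n (n * 1) 0
  bernoulli n d (suc e) = begin
    n * (n * n ^ e)                                        ≤⟨ *-monoʳ-≤ n (bernoulli n d e) ⟩
    n * (n * (n ∸ d) ^ e + e * d * n ^ e)                  ≡⟨ eq₁ n ((n ∸ d) ^ e) e d (n ^ e) ⟩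
    n * (n * (n ∸ d) ^ e) + e * d * (n * n ^ e)            ≤⟨ +-monoˡ-≤ (e * d * (n * n ^ e)) (*-monoʳ-≤ n split) ⟩
    n * ((n ∸ d) ^ suc e + d * n ^ e) + e * d * (n * n ^ e) ≡⟨ eq₂ n ((n ∸ d) ^ suc e) e d (n ^ e) ⟩
    n * (n ∸ d) ^ suc e + suc e * d * (n * n ^ e)          ∎
    where
    open ≤-Reasoning
    eq₁ : ∀ n x e d p → n * (n * x + e * d * p) ≡ n * (n * x) + e * d * (n * p)
    eq₁ = solveℕ
    eq₂ : ∀ n y e d p → n * (y + d * p) + e * d * (n * p) ≡ n * y + suc e * d * (n * p)
    eq₂ = solveℕ
    split : n * (n ∸ d) ^ e ≤ (n ∸ d) ^ suc e + d * n ^ e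
    split = ≤-trans (*-monoˡ-≤ ((n ∸ d) ^ e) (≤-trans (m≤n+m∸n n d) (≤-reflexive (+-comm d (n ∸ d)))))
      (≤-trans (≤-reflexive (*-distribʳ-+ ((n ∸ d) ^ e) (n ∸ d) d))
        (+-monoʳ-≤ ((n ∸ d) ^ suc e) (*-monoʳ-≤ d (^-monoˡ-≤ e (m∸n≤m n d)))))

  -- In units of N / F, the high sets take at most 1 - 1 / (D + 1), the low ones at most 1 / (4 (D +
  -- 1)), and the total T is at least 1 - 1 / (4 (D + 1)). The balance leaves a failure share of 1 /
  -- (2 (D + 1)).
  proportion : ∀ {D F N T h l s} → 1 ≤ F → s ≤ h + l → suc D * (F * h) ≤ D * N → 4 * suc D * F * l ≤ N →
    4 * suc D * N ≤ 4 * suc D * (F * T) + N → F * T ≤ N → 2 * suc D * s + T ≤ 2 * suc D * T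
  proportion {D} {F} {N} {T} {h} {l} {s} F≥1 s≤ high low size≥ size≤ =
    *-cancelˡ-≤ (2 * F) {{m*n≢0 2 F {{_}} {{>-nonZero F≥1}}}} (+-cancelʳ-≤ N _ _ (begin
      2 * F * (2 * suc D * s + T) + N                   ≡⟨ eq₁ F D s T N ⟩
      4 * suc D * F * s + 2 * (F * T) + N               ≤⟨ +-monoˡ-≤ N (+-mono-≤ (*-monoʳ-≤ (4 * suc D * F) s≤) (*-monoʳ-≤ 2 size≤)) ⟩
      4 * suc D * F * (h + l) + 2 * N + N               ≡⟨ eq₂ D F h l N ⟩
      4 * (suc D * (F * h)) + 4 * suc D * F * l + 3 * N ≤⟨ +-monoˡ-≤ (3 * N) (+-mono-≤ (*-monoʳ-≤ 4 high) low) ⟩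
      4 * (D * N) + N + 3 * N                           ≡⟨ eq₃ D N ⟩
      4 * suc D * N                                     ≤⟨ size≥ ⟩
      4 * suc D * (F * T) + N                           ≡⟨ eq₄ D F T N ⟩
      2 * F * (2 * suc D * T) + N                       ∎))
    where
    open ≤-Reasoning
    eq₁ : ∀ F D s T N → 2 * F * (2 * suc D * s + T) + N ≡ 4 * suc D * F * s + 2 * (F * T) + N
    eq₁ = solveℕ
    eq₂ : ∀ D F h l N → 4 * suc D * F * (h + l) + 2 * N + N ≡ 4 * (suc D * (F * h)) + 4 * suc D * F * l + 3 * N
    eq₂ = solveℕ
    eq₃ : ∀ D N → 4 * (D * N) + N + 3 * N ≡ 4 * suc D * N
    eq₃ = solveℕ
    eq₄ : ∀ D F T N → 4 * suc D * (F * T) + N ≡ 2 * F * (2 * suc D * T) + N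
    eq₄ = solveℕ

  draws-scale : ∀ q d a v c → draws q d (λ c → a ℚ.* v c) c ≡ a ℚ.* draws q d v c
  draws-scale q zero    a v c = refl
  draws-scale q (suc d) a v c = trans (draws-cong q d (λ c → eq q a (v (suc c)) (v c)) c) (draws-scale q d a (draw q v) c)
    where
    eq : ∀ q a x y → q ℚ.* (a ℚ.* x) ℚ.+ (ℚ.1ℚ ℚ.- q) ℚ.* (a ℚ.* y) ≡ a ℚ.* (q ℚ.* x ℚ.+ (ℚ.1ℚ ℚ.- q) ℚ.* y)
    eq = solve-∀ ℚ-ring

  module _ (n′ K K′ : ℕ) (K+K′≡n : K + K′ ≡ suc n′) where
    private
      q : ℚ.ℚ
      q = nat K ℚ.* inv n′

    fraction : nat (suc n′) ℚ.* q ≡ nat K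
    fraction = trans (eq (nat (suc n′)) (nat K) (inv n′)) (trans (cong (nat K ℚ.*_) (nat-inv n′)) (ℚP.*-identityʳ (nat K)))
      where
      eq : ∀ n k i → n ℚ.* (k ℚ.* i) ≡ k ℚ.* (n ℚ.* i)
      eq = solve-∀ ℚ-ring

    fraction-probability : Probability q
    fraction-probability = *≥0 (nat≥0 K) (ℚP.<⇒≤ (inv>0 n′)) ,
      subst (q ℚ.≤_) (nat-inv n′) (*-monoʳ (inv n′) (ℚP.<⇒≤ (inv>0 n′)) (nat-mono (≤-trans (m≤m+n K K′) (≤-reflexive K+K′≡n))))

    nat-draws-ℕ : ∀ d h c → nat (draws-ℕ K K′ d h c) ≡ nat (suc n′ ^ d) ℚ.* draws q d (nat ∘ h) c
    nat-draws-ℕ zero    h c = sym (trans (cong (ℚ._* nat (h c)) (ℚP.+-identityʳ ℚ.1ℚ)) (ℚP.*-identityˡ (nat (h c))))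
    nat-draws-ℕ (suc d) h c = begin
      nat (draws-ℕ K K′ d (draw-ℕ K K′ h) c)
        ≡⟨ nat-draws-ℕ d (draw-ℕ K K′ h) c ⟩
      nat (suc n′ ^ d) ℚ.* draws q d (nat ∘ draw-ℕ K K′ h) c
        ≡⟨ cong (nat (suc n′ ^ d) ℚ.*_) (trans (draws-cong q d step c) (draws-scale q d (nat (suc n′)) (draw q (nat ∘ h)) c)) ⟩
      nat (suc n′ ^ d) ℚ.* (nat (suc n′) ℚ.* draws q d (draw q (nat ∘ h)) c)
        ≡⟨ eq₁ (nat (suc n′ ^ d)) (nat (suc n′)) (draws q d (draw q (nat ∘ h)) c) ⟩
      nat (suc n′) ℚ.* nat (suc n′ ^ d) ℚ.* draws q d (draw q (nat ∘ h)) c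
        ≡⟨ cong (ℚ._* draws q d (draw q (nat ∘ h)) c) (sym (nat-* (suc n′) (suc n′ ^ d))) ⟩
      nat (suc n′ ^ suc d) ℚ.* draws q d (draw q (nat ∘ h)) c ∎
      where
      open ≡-Reasoning
      eq₁ : ∀ p n x → p ℚ.* (n ℚ.* x) ≡ n ℚ.* p ℚ.* x
      eq₁ = solve-∀ ℚ-ring
      eq₂ : ∀ k k′ x y → k ℚ.* x ℚ.+ k′ ℚ.* y ≡ k ℚ.* x ℚ.+ (k ℚ.+ k′ ℚ.- k) ℚ.* y
      eq₂ = solve-∀ ℚ-ring
      eq₃ : ∀ n q x y → n ℚ.* q ℚ.* x ℚ.+ (n ℚ.- n ℚ.* q) ℚ.* y ≡ n ℚ.* (q ℚ.* x ℚ.+ (ℚ.1ℚ ℚ.- q) ℚ.* y)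
      eq₃ = solve-∀ ℚ-ring
      step : ∀ c → nat (draw-ℕ K K′ h c) ≡ nat (suc n′) ℚ.* draw q (nat ∘ h) c
      step c = begin
        nat (K * h (suc c) + K′ * h c)
          ≡⟨ trans (nat-+ (K * h (suc c)) (K′ * h c)) (cong₂ ℚ._+_ (nat-* K (h (suc c))) (nat-* K′ (h c))) ⟩
        nat K ℚ.* nat (h (suc c)) ℚ.+ nat K′ ℚ.* nat (h c)
          ≡⟨ eq₂ (nat K) (nat K′) (nat (h (suc c))) (nat (h c)) ⟩
        nat K ℚ.* nat (h (suc c)) ℚ.+ (nat K ℚ.+ nat K′ ℚ.- nat K) ℚ.* nat (h c)
          ≡⟨ cong₂ (λ x y → x ℚ.* nat (h (suc c)) ℚ.+ (y ℚ.- x) ℚ.* nat (h c)) (sym fraction)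
               (trans (sym (nat-+ K K′)) (cong nat K+K′≡n)) ⟩
        nat (suc n′) ℚ.* q ℚ.* nat (h (suc c)) ℚ.+ (nat (suc n′) ℚ.- nat (suc n′) ℚ.* q) ℚ.* nat (h c)
          ≡⟨ eq₃ (nat (suc n′)) q (nat (h (suc c))) (nat (h c)) ⟩
        nat (suc n′) ℚ.* draw q (nat ∘ h) c ∎

  -- The first summand makes the loss (d + 1)² / n in Bernoulli's inequality at most 1 / (4 (D +
  -- 1)). The second dominates the squared bound on the low sets; its factors 2 and 4^d come from V
  -- ≤ 2 (V - 1).
  threshold : (ℓ M D d C : ℕ) → ℕ
  threshold ℓ M D d C = 4 * suc D * (suc d * suc d) + 2 * (C * (c * c) * (2 ^ d * 2 ^ d))
    where
    c : ℕ
    c = 4 * suc D * suc d ! * suc ℓ ^ M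

  module _ {M k ℓ : ℕ} (n′ : ℕ) (size : Vec ℕ M) (Enc : Subset (suc n′) → All Fin size) (S : Fin (suc n′) → Subset M)
    (S≤k : ∀ x → card (S x) ≤ k)
    (local : ∀ A x i → lookup (S x) i ≡ false → lookup⁺ (Enc (A ∪ ⁅ x ⁆)) i ≡ lookup⁺ (Enc A) i) where

    private
      n : ℕ
      n = suc n′

      X : Fin M → Subset n
      X = column S

    -- min {ℓ , Nᵢ} for Nᵢ the number of elements of A that may write to cell i
    load : Fin M → Subset n → ℕ
    load i A = ℓ ⊓ card (A ∩ X i)

    totalLoad : Subset n → ℕ
    totalLoad A = sum λ i → load i A

    Enc-local : ∀ A i → lookup⁺ (Enc A) i ≡ lookup⁺ (Enc (A ∩ X i)) i
    Enc-local A i = ∩-local (X i) (λ B → lookup⁺ (Enc B) i)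
      (λ B x e → local B x i (trans (sym (lookup∘tabulate (λ x → lookup (S x) i) x)) e)) A

    sum-card-X : sum (λ i → card (X i)) ≤ n * k
    sum-card-X = ≤-trans (≤-reflexive (sum-column S)) (≤-trans (sum-mono S≤k) (≤-reflexive (sum-const n k)))

    overSize-totalLoad : ∀ d → d ! * overSize n d totalLoad ≤ sum λ i → draws-ℕ (card (X i)) (card (∁ (X i))) d (ℓ ⊓_) 0
    overSize-totalLoad d = begin
      d ! * overSize n d totalLoad                        ≡⟨ cong (d ! *_) (overSize-sum n d load) ⟩
      d ! * sum (λ i → overSize n d (load i))             ≡⟨ sym (sum-*ˡ (d !) (λ i → overSize n d (load i))) ⟩
      sum (λ i → d ! * overSize n d (load i))             ≤⟨ sum-mono (λ i → overSize≤overTuples n d (load i)) ⟩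
      sum (λ i → overTuples d (load i) ⊥)                 ≤⟨ sum-mono (λ i → overTuples-∩ d (X i) (ℓ ⊓_) (⊓-monoʳ-≤ ℓ) ⊥) ⟩
      sum (λ i → draws-ℕ (card (X i)) (card (∁ (X i))) d (ℓ ⊓_) (card (⊥ ∩ X i)))
        ≤⟨ sum-mono (λ i → ≤-reflexive (cong (draws-ℕ (card (X i)) (card (∁ (X i))) d (ℓ ⊓_))
             (trans (cong card (∩-zeroˡ (X i))) (∣⊥∣≡0 n)))) ⟩
      sum (λ i → draws-ℕ (card (X i)) (card (∁ (X i))) d (ℓ ⊓_) 0) ∎
      where open ≤-Reasoning

    -- The cells have unequal numbers of writers, of which only the sum, at most n k, is controlled;
    -- a linear bound on each mean depends on nothing else after summation.
    overSize-totalLoad-line : ∀ d {a b} → ℚ.0ℚ ℚ.≤ b → (∀ q → Probability q → draws q d (cap ℓ) 0 ℚ.≤ a ℚ.+ b ℚ.* q) →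
      nat (d ! * overSize n d totalLoad) ℚ.≤ nat (n ^ d) ℚ.* (nat M ℚ.* a ℚ.+ b ℚ.* nat k)
    overSize-totalLoad-line d {a} {b} b≥0 line = begin
      nat (d ! * overSize n d totalLoad)
        ≤⟨ nat-mono (overSize-totalLoad d) ⟩
      nat (sum λ i → draws-ℕ (card (X i)) (card (∁ (X i))) d (ℓ ⊓_) 0)
        ≤⟨ go (card ∘ X) _ cell ⟩
      nat (n ^ d) ℚ.* (nat M ℚ.* a ℚ.+ b ℚ.* (nat (sum (card ∘ X)) ℚ.* inv n′))
        ≤⟨ *-monoˡ (nat (n ^ d)) (nat≥0 (n ^ d)) (ℚP.+-monoʳ-≤ (nat M ℚ.* a) (*-monoˡ b b≥0 average)) ⟩
      nat (n ^ d) ℚ.* (nat M ℚ.* a ℚ.+ b ℚ.* nat k) ∎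
      where
      open ℚP.≤-Reasoning
      complement : ∀ i → card (X i) + card (∁ (X i)) ≡ n
      complement i = trans (cong (card (X i) +_) (∣∁p∣≡n∸∣p∣ (X i))) (m+[n∸m]≡n (∣p∣≤n (X i)))
      cell : ∀ i → nat (draws-ℕ (card (X i)) (card (∁ (X i))) d (ℓ ⊓_) 0) ℚ.≤ nat (n ^ d) ℚ.* (a ℚ.+ b ℚ.* (nat (card (X i)) ℚ.* inv n′))
      cell i = ℚP.≤-trans (ℚP.≤-reflexive (nat-draws-ℕ n′ (card (X i)) (card (∁ (X i))) (complement i) d (ℓ ⊓_) 0))
        (*-monoˡ (nat (n ^ d)) (nat≥0 (n ^ d)) (line (nat (card (X i)) ℚ.* inv n′)
          (fraction-probability n′ (card (X i)) (card (∁ (X i))) (complement i))))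
      eq₀ : ∀ P a b i → ℚ.0ℚ ≡ P ℚ.* (ℚ.0ℚ ℚ.* a ℚ.+ b ℚ.* (ℚ.0ℚ ℚ.* i))
      eq₀ = solve-∀ ℚ-ring
      eq₁ : ∀ P a b i K M s → P ℚ.* (a ℚ.+ b ℚ.* (K ℚ.* i)) ℚ.+ P ℚ.* (M ℚ.* a ℚ.+ b ℚ.* (s ℚ.* i)) ≡
                              P ℚ.* ((ℚ.1ℚ ℚ.+ M) ℚ.* a ℚ.+ b ℚ.* ((K ℚ.+ s) ℚ.* i))
      eq₁ = solve-∀ ℚ-ring
      go : ∀ {M} (K f : Fin M → ℕ) → (∀ i → nat (f i) ℚ.≤ nat (n ^ d) ℚ.* (a ℚ.+ b ℚ.* (nat (K i) ℚ.* inv n′))) →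
           nat (sum f) ℚ.≤ nat (n ^ d) ℚ.* (nat M ℚ.* a ℚ.+ b ℚ.* (nat (sum K) ℚ.* inv n′))
      go {zero}  K f h = ℚP.≤-reflexive (eq₀ (nat (n ^ d)) a b (inv n′))
      go {suc M} K f h = ℚP.≤-trans (ℚP.≤-reflexive (nat-+ (f zero) (sum (f ∘ suc))))
        (ℚP.≤-trans (ℚP.+-mono-≤ (h zero) (go (K ∘ suc) (f ∘ suc) (h ∘ suc)))
          (ℚP.≤-reflexive (trans (eq₁ (nat (n ^ d)) a b (inv n′) (nat (K zero)) (nat M) (nat (sum (K ∘ suc))))
            (cong (λ z → nat (n ^ d) ℚ.* (nat (suc M) ℚ.* a ℚ.+ b ℚ.* (z ℚ.* inv n′))) (sym (nat-+ (K zero) (sum (K ∘ suc))))))))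
      average : nat (sum (card ∘ X)) ℚ.* inv n′ ℚ.≤ nat k
      average = ℚP.≤-trans (*-monoʳ (inv n′) (ℚP.<⇒≤ (inv>0 n′)) (nat-mono sum-card-X))
        (ℚP.≤-reflexive (trans (cong (ℚ._* inv n′) (nat-* n k)) (trans (eq₂ (nat n) (nat k) (inv n′))
          (trans (cong (nat k ℚ.*_) (nat-inv n′)) (ℚP.*-identityʳ (nat k))))))
        where
        eq₂ : ∀ n k i → n ℚ.* k ℚ.* i ≡ k ℚ.* (n ℚ.* i)
        eq₂ = solve-∀ ℚ-ring

    module _ {OK : Pred (Subset n) 0ℓ} (ok? : Decidable OK) (OK-injective : ∀ {A B} → OK A → OK B → Enc A ≡ Enc B → A ≡ B) where

      high low : ℕ → ℕ
      high d = length (filter (λ A → d ≤? totalLoad A) (subsetsOfSize n d))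
      low d  = length (filter (λ A → ok? A ×-dec (totalLoad A <? d)) (subsetsOfSize n d))

      successes≤ : ∀ d → length (filter ok? (subsetsOfSize n d)) ≤ high d + low d
      successes≤ d = length-filter-split (λ A → d ≤? totalLoad A) ok? (λ A → totalLoad A <? d) ≰⇒> (subsetsOfSize n d)

      high≤ : ∀ d → d * high d ≤ overSize n d totalLoad
      high≤ d = ≤-trans (length-markov (λ A → d ≤? totalLoad A) totalLoad d (λ h → h) (subsetsOfSize n d))
        (≤-reflexive (sumList-subsetsOfSize n d totalLoad))

      -- Successful sets are determined by their encodings, and a total load of at most d places the
      -- encoding among the `codes` of weight d: one power of V less than the size d + 1 of the
      -- sets.
      low≤ : ∀ d Y → 1 ≤ Y → (∀ i → lookup size i ≤ Y * suc n ^ ℓ) → low (suc d) ≤ suc ℓ ^ M * Y ^ M * suc n ^ d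
      low≤ d Y Y≥1 size≤ = ≤-trans
        (length-injection Enc (filter good? (subsetsOfSize n (suc d))) (codes ℓ size L d)
          (filter⁺ good? (filter⁺ (λ A → card A ≟ suc d) (subsets-unique n)))
          (λ {A} p → ∈-codes L (λ i → load i A) (Enc A) (λ i → m⊓n≤m ℓ (card (A ∩ X i))) (member A)
            (s≤s⁻¹ (proj₂ (proj₂ (∈-filter⁻ good? {xs = subsetsOfSize n (suc d)} p)))))
          (λ p q → OK-injective (proj₁ (proj₂ (∈-filter⁻ good? {xs = subsetsOfSize n (suc d)} p)))
                                (proj₁ (proj₂ (∈-filter⁻ good? {xs = subsetsOfSize n (suc d)} q)))))
        (length-codes {size = size} L Y (suc n) L≤ d)
        where
        good? : Decidable (λ A → OK A × totalLoad A < suc d)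
        good? A = ok? A ×-dec (totalLoad A <? suc d)
        choose : ∀ i w → Dec (w < ℓ) → List (Fin (lookup size i))
        choose i w (yes _) = map (λ B → lookup⁺ (Enc B) i) (subsetsOfSize n w)
        choose i w (no _)  = allFin (lookup size i)
        L : Choices size
        L i w = choose i w (w <? ℓ)
        member : ∀ A i → lookup⁺ (Enc A) i ∈ L i (load i A)
        member A i = go (load i A <? ℓ)
          where
          go : (dec : Dec (load i A < ℓ)) → lookup⁺ (Enc A) i ∈ choose i (load i A) dec
          go (no _)  = ∈-allFin (lookup⁺ (Enc A) i)
          go (yes l) = subst (_∈ choose i (load i A) (yes l)) (sym (Enc-local A i))
            (∈-map⁺ (λ B → lookup⁺ (Enc B) i) (subst (λ w → A ∩ X i ∈ subsetsOfSize n w) (sym load≡) (∈-subsetsOfSize (A ∩ X i))))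
            where
            load≡ : load i A ≡ card (A ∩ X i)
            load≡ = m≥n⇒m⊓n≡n (≮⇒≥ λ ℓ<c → <-irrefl (m≤n⇒m⊓n≡m (<⇒≤ ℓ<c)) l)
        L≤ : ∀ i w → w ≤ ℓ → length (L i w) ≤ Y * suc n ^ w
        L≤ i w w≤ℓ = go (w <? ℓ)
          where
          go : (dec : Dec (w < ℓ)) → length (choose i w dec) ≤ Y * suc n ^ w
          go (yes _) = ≤-trans (≤-reflexive (length-map (λ B → lookup⁺ (Enc B) i) (subsetsOfSize n w)))
            (≤-trans (length-subsetsOfSize≤ n w) (≤-trans (^-monoˡ-≤ w (n≤1+n n))
              (≤-trans (≤-reflexive (sym (+-identityʳ (suc n ^ w)))) (*-monoˡ-≤ (suc n ^ w) Y≥1))))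
          go (no ¬l) = ≤-trans (≤-reflexive (length-tabulate {n = lookup size i} (λ j → j)))
            (subst (λ w → lookup size i ≤ Y * suc n ^ w) (≤-antisym (≮⇒≥ ¬l) w≤ℓ) (size≤ i))

      -- Markov's inequality: by the supporting line the mean load is at most the fraction 1 - 1 /
      -- (D + 1) of the size d + 1, so reaching that size has at most a D / (D + 1) share.
      high-fraction : ∀ D d {a b} → ℚ.0ℚ ℚ.≤ b → (∀ q → Probability q → draws q (suc d) (cap ℓ) 0 ℚ.≤ a ℚ.+ b ℚ.* q) →
        nat M ℚ.* a ℚ.+ b ℚ.* nat k ℚ.≤ nat (suc d) ℚ.* (ℚ.1ℚ ℚ.- inv D) →
        suc D * (suc d ! * high (suc d)) ≤ D * n ^ suc d
      high-fraction D d {a} {b} b≥0 line loss = *-cancelˡ-≤ (suc d) (begin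
        suc d * (suc D * (suc d ! * high (suc d)))   ≡⟨ eq₁ (suc d) (suc D) (suc d !) (high (suc d)) ⟩
        suc D * (suc d ! * (suc d * high (suc d)))   ≤⟨ *-monoʳ-≤ (suc D) (*-monoʳ-≤ (suc d !) (high≤ (suc d))) ⟩
        suc D * (suc d ! * overSize n (suc d) totalLoad) ≤⟨ nat-cancel-≤ cast ⟩
        suc d * (D * n ^ suc d)                      ∎)
        where
        open ≤-Reasoning
        eq₁ : ∀ a b c e → a * (b * (c * e)) ≡ b * (c * (a * e))
        eq₁ = solveℕ
        eq₂ : ∀ Q N s i → Q ℚ.* (N ℚ.* (s ℚ.* (ℚ.1ℚ ℚ.- i))) ≡ s ℚ.* ((Q ℚ.- Q ℚ.* i) ℚ.* N)
        eq₂ = solve-∀ ℚ-ring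
        eq₃ : ∀ D → ℚ.1ℚ ℚ.+ D ℚ.- ℚ.1ℚ ≡ D
        eq₃ = solve-∀ ℚ-ring
        cast : nat (suc D * (suc d ! * overSize n (suc d) totalLoad)) ℚ.≤ nat (suc d * (D * n ^ suc d))
        cast = ℚP.≤-trans (ℚP.≤-reflexive (nat-* (suc D) (suc d ! * overSize n (suc d) totalLoad)))
          (ℚP.≤-trans (*-monoˡ (nat (suc D)) (nat≥0 (suc D)) (ℚP.≤-trans (overSize-totalLoad-line (suc d) b≥0 line)
              (*-monoˡ (nat (n ^ suc d)) (nat≥0 (n ^ suc d)) loss)))
            (ℚP.≤-reflexive (trans (eq₂ (nat (suc D)) (nat (n ^ suc d)) (nat (suc d)) (inv D))
              (trans (cong (λ z → nat (suc d) ℚ.* (z ℚ.* nat (n ^ suc d)))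
                  (trans (cong (λ z → nat (suc D) ℚ.- z) (nat-inv D)) (eq₃ (nat D))))
                (trans (cong (nat (suc d) ℚ.*_) (sym (nat-* D (n ^ suc d)))) (sym (nat-* (suc d) (D * n ^ suc d))))))))

      -- The slack is controlled only through Y^(2M) ≤ C V, so both sides are squared; V^(2d + 1)
      -- then stands against n^(2d + 2), and one factor n beats all constants.
      low-fraction : ∀ D d C Y → 1 ≤ Y → (∀ i → lookup size i ≤ Y * suc n ^ ℓ) → Y ^ M * Y ^ M ≤ C * suc n →
        threshold ℓ M D d C ≤ n → 4 * suc D * suc d ! * low (suc d) ≤ n ^ suc d
      low-fraction D d C Y Y≥1 size≤ Y²≤ t≤n = square-cancel-≤ (begin
        (4 * suc D * suc d ! * low (suc d)) * (4 * suc D * suc d ! * low (suc d))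
          ≤⟨ *-mono-≤ low-bound low-bound ⟩
        (c * Y ^ M * suc n ^ d) * (c * Y ^ M * suc n ^ d)
          ≡⟨ eq₁ c (Y ^ M) (suc n ^ d) ⟩
        c * c * (Y ^ M * Y ^ M) * (suc n ^ d * suc n ^ d)
          ≤⟨ *-mono-≤ (*-monoʳ-≤ (c * c) (≤-trans Y²≤ (*-monoʳ-≤ C V≤))) (*-mono-≤ V^d≤ V^d≤) ⟩
        c * c * (C * (2 * n)) * ((2 ^ d * n ^ d) * (2 ^ d * n ^ d))
          ≡⟨ eq₂ c C n (2 ^ d) (n ^ d) ⟩
        2 * (C * (c * c) * (2 ^ d * 2 ^ d)) * (n * (n ^ d * n ^ d))
          ≤⟨ *-monoˡ-≤ (n * (n ^ d * n ^ d)) (≤-trans (m≤n+m _ (4 * suc D * (suc d * suc d))) t≤n) ⟩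
        n * (n * (n ^ d * n ^ d))
          ≡⟨ eq₃ n (n ^ d) ⟩
        n ^ suc d * n ^ suc d ∎)
        where
        open ≤-Reasoning
        c : ℕ
        c = 4 * suc D * suc d ! * suc ℓ ^ M
        eq₀ : ∀ a l y v → a * (l * y * v) ≡ a * l * y * v
        eq₀ = solveℕ
        eq₁ : ∀ c y v → (c * y * v) * (c * y * v) ≡ c * c * (y * y) * (v * v)
        eq₁ = solveℕ
        eq₂ : ∀ c C n p q → c * c * (C * (2 * n)) * ((p * q) * (p * q)) ≡ 2 * (C * (c * c) * (p * p)) * (n * (q * q))
        eq₂ = solveℕ
        eq₃ : ∀ n q → n * (n * (q * q)) ≡ n * q * (n * q)
        eq₃ = solveℕ
        low-bound : 4 * suc D * suc d ! * low (suc d) ≤ c * Y ^ M * suc n ^ d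
        low-bound = ≤-trans (*-monoʳ-≤ (4 * suc D * suc d !) (low≤ d Y Y≥1 size≤))
          (≤-reflexive (eq₀ (4 * suc D * suc d !) (suc ℓ ^ M) (Y ^ M) (suc n ^ d)))
        V≤ : suc n ≤ 2 * n
        V≤ = ≤-trans (+-monoˡ-≤ n (s≤s z≤n)) (≤-reflexive (cong (n +_) (sym (+-identityʳ n))))
        V^d≤ : suc n ^ d ≤ 2 ^ d * n ^ d
        V^d≤ = ≤-trans (^-monoˡ-≤ d V≤) (≤-reflexive (^-distribʳ-* d 2 n))

      success-bound : ∀ D d C Y → 1 ≤ Y → (∀ i → lookup size i ≤ Y * suc n ^ ℓ) → Y ^ M * Y ^ M ≤ C * suc n →
        threshold ℓ M D d C ≤ n → ∀ {a b} → ℚ.0ℚ ℚ.≤ b →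
        (∀ q → Probability q → draws q (suc d) (cap ℓ) 0 ℚ.≤ a ℚ.+ b ℚ.* q) →
        nat M ℚ.* a ℚ.+ b ℚ.* nat k ℚ.≤ nat (suc d) ℚ.* (ℚ.1ℚ ℚ.- inv D) →
        2 * suc D * length (filter ok? (subsetsOfSize n (suc d))) + length (subsetsOfSize n (suc d)) ≤
        2 * suc D * length (subsetsOfSize n (suc d))
      success-bound D d C Y Y≥1 size≤ Y²≤ t≤n b≥0 line loss = proportion {D} {suc d !} {N} {T} {high (suc d)} {low (suc d)} (1≤n! (suc d)) (successes≤ (suc d))
        (high-fraction D d b≥0 line loss) (low-fraction D d C Y Y≥1 size≤ Y²≤ t≤n) size≥
        (≤-trans (≤-reflexive (cong (suc d ! *_) (length-subsetsOfSize n (suc d)))) (numberOfSize≤ n (suc d)))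
        where
        open ≤-Reasoning
        N T : ℕ
        N = n ^ suc d
        T = length (subsetsOfSize n (suc d))
        eq₁ : ∀ Q n N → n * (Q * N) ≡ Q * (n * N)
        eq₁ = solveℕ
        eq₂ : ∀ Q n x s N → Q * (n * x + s * s * N) ≡ n * (Q * x) + Q * (s * s) * N
        eq₂ = solveℕ
        -- With s = d + 1 the set size, s! T ≥ (n - s)^s ≥ (1 - s² / n) n^s, and n ≥ 4 (D + 1) s² by
        -- the first summand of `threshold`.
        size≥ : 4 * suc D * N ≤ 4 * suc D * (suc d ! * T) + N
        size≥ = *-cancelˡ-≤ n (begin
          n * (4 * suc D * N)
            ≡⟨ eq₁ (4 * suc D) n N ⟩
          4 * suc D * (n * N)
            ≤⟨ *-monoʳ-≤ (4 * suc D) (bernoulli n (suc d) (suc d)) ⟩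
          4 * suc D * (n * (n ∸ suc d) ^ suc d + suc d * suc d * N)
            ≡⟨ eq₂ (4 * suc D) n ((n ∸ suc d) ^ suc d) (suc d) N ⟩
          n * (4 * suc D * (n ∸ suc d) ^ suc d) + 4 * suc D * (suc d * suc d) * N
            ≤⟨ +-mono-≤ (*-monoʳ-≤ n (*-monoʳ-≤ (4 * suc D) (≤-trans (numberOfSize≥ n (suc d))
                   (≤-reflexive (cong (suc d ! *_) (sym (length-subsetsOfSize n (suc d))))))))
                 (*-monoˡ-≤ N (≤-trans (m≤m+n (4 * suc D * (suc d * suc d)) _) t≤n)) ⟩
          n * (4 * suc D * (suc d ! * T)) + n * N
            ≡⟨ sym (*-distribˡ-+ n (4 * suc D * (suc d ! * T)) N) ⟩
          n * (4 * suc D * (suc d ! * T) + N) ∎)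

-- Real sums and exponentials through their rational approximations.

module RealSequences where

  open import Data.Rational.Base hiding (_÷_)
  open import Data.Rational.Properties
  open Rationals
  open ExponentialSums
  open RationalRoot using (series-converges)

  Ev : (ℕ → Set) → Set
  Ev P = ∃ λ N → ∀ n → N ℕ.≤ n → P n

  ev-map : ∀ {P Q : ℕ → Set} → (∀ n → P n → Q n) → Ev P → Ev Q
  ev-map f (N , h) = N , λ n l → f n (h n l)

  ev-zip : ∀ {P Q R : ℕ → Set} → (∀ n → P n → Q n → R n) → Ev P → Ev Q → Ev R
  ev-zip f (N , h) (N′ , h′) = N ℕ.⊔ N′ , λ n l →
    f n (h n (ℕP.m⊔n≤o⇒m≤o N N′ l)) (h′ n (ℕP.m⊔n≤o⇒n≤o N N′ l))

  ev-zip₃ : ∀ {P Q R S : ℕ → Set} → (∀ n → P n → Q n → R n → S n) → Ev P → Ev Q → Ev R → Ev S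
  ev-zip₃ f p q r = ev-zip (λ n pq r → f n (proj₁ pq) (proj₂ pq) r) (ev-zip (λ _ p q → p , q) p q) r

  ev-all : ∀ {P : ℕ → Set} → (∀ n → P n) → Ev P
  ev-all h = 0 , λ n _ → h n

  halve : ∀ {ε} → 0ℚ < ε → 0ℚ < ½ * ε
  halve = *>0 0<½

  halves : ∀ ε → ½ * ε + ½ * ε ≡ ε
  halves = solve-∀ ℚ-ring

  ∣∣≤⇒≤ : ∀ x y {ε} → ∣ x - y ∣ ≤ ε → x ≤ y + ε
  ∣∣≤⇒≤ x y {ε} h = ≤-cert (ε - (x - y)) (diff≥0 (≤-trans (p≤∣p∣ (x - y)) h)) (eq x y ε)
    where
    eq : ∀ x y e → y + e ≡ x + (e - (x - y))
    eq = solve-∀ ℚ-ring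

  ∣∣≤⇒≥ : ∀ x y {ε} → ∣ x - y ∣ ≤ ε → y ≤ x + ε
  ∣∣≤⇒≥ x y {ε} h = ∣∣≤⇒≤ y x (subst (_≤ ε) (∣p-q∣≡∣q-p∣ x y) h)

  ≤⇒∣∣≤ : ∀ x y {ε} → x ≤ y + ε → y ≤ x + ε → ∣ x - y ∣ ≤ ε
  ≤⇒∣∣≤ x y {ε} h₁ h₂ = ∣∣≤-intro
    (≤-cert (y + ε - x) (diff≥0 h₁) (eq₁ x y ε)) (≤-cert (x + ε - y) (diff≥0 h₂) (eq₂ x y ε))
    where
    eq₁ : ∀ x y e → e ≡ x - y + (y + e - x)
    eq₁ = solve-∀ ℚ-ring
    eq₂ : ∀ x y e → e ≡ - (x - y) + (x + e - y)
    eq₂ = solve-∀ ℚ-ring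

  ∣*∣≤ : ∀ {x y a b} → ∣ x ∣ ≤ a → ∣ y ∣ ≤ b → ∣ x * y ∣ ≤ a * b
  ∣*∣≤ {x} {y} {a} {b} hx hy = subst (_≤ a * b) (sym (∣p*q∣≡∣p∣*∣q∣ x y))
    (*-mono (0≤∣p∣ x) (≤-trans (0≤∣p∣ y) hy) hx hy)

  ∣+∣≤ : ∀ {x y a b} → ∣ x ∣ ≤ a → ∣ y ∣ ≤ b → ∣ x + y ∣ ≤ a + b
  ∣+∣≤ {x} {y} hx hy = ≤-trans (∣p+q∣≤∣p∣+∣q∣ x y) (+-mono-≤ hx hy)

  bounded : ∀ x → ∃ λ B → 0ℚ < B × Ev λ n → ∣ seq x n ∣ ≤ B
  bounded x = 1ℚ + ∣ seq x N ∣ , +>0 0<1 (0≤∣p∣ (seq x N)) , N , λ n l →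
    subst (λ z → ∣ z ∣ ≤ 1ℚ + ∣ seq x N ∣) (eq (seq x n) (seq x N))
      (∣+∣≤ (<⇒≤ (proj₂ (cauchy x 1ℚ 0<1) n N l ℕP.≤-refl)) ≤-refl)
    where
    N = proj₁ (cauchy x 1ℚ 0<1)
    eq : ∀ a b → a - b + b ≡ a
    eq = solve-∀ ℚ-ring

  ≈⇒close : ∀ {x y} → x ℝ.≈ y → ∀ ε → 0ℚ < ε → Ev λ n → ∣ seq x n - seq y n ∣ ≤ ε
  ≈⇒close {x} {y} (h₁ , h₂) ε ε>0 = ev-zip (λ n → ≤⇒∣∣≤ (seq x n) (seq y n)) (h₁ ε ε>0) (h₂ ε ε>0)

  close⇒≈ : ∀ {x y} → (∀ ε → 0ℚ < ε → Ev λ n → ∣ seq x n - seq y n ∣ ≤ ε) → x ℝ.≈ y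
  close⇒≈ {x} {y} h = (λ ε ε>0 → ev-map (λ n → ∣∣≤⇒≤ (seq x n) (seq y n)) (h ε ε>0)) ,
    (λ ε ε>0 → ev-map (λ n → ∣∣≤⇒≥ (seq x n) (seq y n)) (h ε ε>0))

  ≈-refl : ∀ {x} → x ℝ.≈ x
  ≈-refl {x} = close⇒≈ {x} {x} λ ε ε>0 → ev-all λ n → subst (_≤ ε) (sym (cong ∣_∣ (+-inverseʳ (seq x n)))) (<⇒≤ ε>0)

  -- `HasSum` restated by non-strict rational inequalities between approximations; the index from
  -- which they hold may depend on the number J of terms.
  SumsTo : (ℕ → ℝ) → ℝ → Set
  SumsTo f s = ∀ ε → 0ℚ < ε → ∃ λ J₀ → ∀ J → J₀ ℕ.≤ J → Ev λ n → ∣ ∑ J (λ j → seq (f j) n) - seq s n ∣ ≤ ε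

  seq-sum : ∀ J f n → seq (ℝ.sum J f) n ≡ ∑ J λ j → seq (f j) n
  seq-sum zero    f n = refl
  seq-sum (suc J) f n = cong (_+ seq (f J) n) (seq-sum J f n)

  hasSum⇒sumsTo : ∀ {f s} → HasSum f s → SumsTo f s
  hasSum⇒sumsTo {f} {s} h ε ε>0 = let (J₀ , g) = h ε ε>0 in J₀ , λ J l →
    let ((δ , δ>0 , below) , (δ′ , δ′>0 , above)) = g J l in
    ev-zip (λ n b a → subst (λ z → ∣ z - seq s n ∣ ≤ ε) (seq-sum J f n) (≤⇒∣∣≤ (seq (ℝ.sum J f) n) (seq s n)
      (≤-trans (≤-cert {p = seq (ℝ.sum J f) n} δ′ (<⇒≤ δ′>0) refl) a)
      (≤-cert (seq (ℝ.sum J f) n - (seq s n + - ε + δ) + δ) (+≥0 (diff≥0 b) (<⇒≤ δ>0)) (eq (seq (ℝ.sum J f) n) (seq s n) ε δ))))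
      below above
    where
    eq : ∀ x s e d → x + e ≡ s + (x - (s + - e + d) + d)
    eq = solve-∀ ℚ-ring

  sumsTo⇒hasSum : ∀ {f s} → SumsTo f s → HasSum f s
  sumsTo⇒hasSum {f} {s} h ε ε>0 = let (J₀ , g) = h (½ * ε) (halve ε>0) in J₀ , λ J l →
    let close = ev-map (λ n → subst (λ z → ∣ z - seq s n ∣ ≤ ½ * ε) (sym (seq-sum J f n))) (g J l) in
    (½ * ε , halve ε>0 , ev-map (λ n c → ≤-cert (seq (ℝ.sum J f) n + ½ * ε - seq s n) (diff≥0 (∣∣≤⇒≥ (seq (ℝ.sum J f) n) (seq s n) c))
       (eq₁ (seq (ℝ.sum J f) n) (seq s n) ε)) close) ,
    (½ * ε , halve ε>0 , ev-map (λ n c → ≤-cert (seq s n + ½ * ε - seq (ℝ.sum J f) n) (diff≥0 (∣∣≤⇒≤ (seq (ℝ.sum J f) n) (seq s n) c))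
       (eq₂ (seq (ℝ.sum J f) n) (seq s n) ε)) close)
    where
    eq₁ : ∀ x s e → x ≡ s + - e + ½ * e + (x + ½ * e - s)
    eq₁ = solve-∀ ℚ-ring
    eq₂ : ∀ x s e → s + e ≡ x + ½ * e + (s + ½ * e - x)
    eq₂ = solve-∀ ℚ-ring

  -- Exponentials

  nat-÷ : ∀ a m .{{_ : ℕ.NonZero m}} n → nat m * seq (a ÷ m) n ≡ nat a
  nat-÷ a (suc m) n = nat-/ a m

  seq-^ : ∀ x j n → seq (x ℝ.^ j) n ≡ seq x n ^ j
  seq-^ x zero    n = refl
  seq-^ x (suc j) n = cong (seq x n *_) (seq-^ x j n)

  nat!-term : ∀ t j → nat (j !) * term t j ≡ t ^ j
  nat!-term t zero    = refl
  nat!-term t (suc j) = trans (cong (_* term t (suc j)) (nat-* (suc j) (j !)))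
    (trans (eq (nat (suc j)) (nat (j !)) (term t (suc j)))
      (trans (cong (nat (j !) *_) (term-suc t j)) (trans (eq′ (nat (j !)) t (term t j)) (cong (t *_) (nat!-term t j)))))
    where
    eq : ∀ s f x → s * f * x ≡ f * (s * x)
    eq = solve-∀ ℚ-ring
    eq′ : ∀ f t x → f * (t * x) ≡ t * (f * x)
    eq′ = solve-∀ ℚ-ring

  seq-term : ∀ x j n → seq ((1 ÷ (j !)) ℝ.* (x ℝ.^ j)) n ≡ term (seq x n) j
  seq-term x j n = trans (cong (i *_) (trans (seq-^ x j n) (sym (nat!-term (seq x n) j))))
    (trans (sym (*-assoc i (nat (j !)) (term (seq x n) j)))
      (trans (cong (_* term (seq x n) j) (trans (*-comm i (nat (j !))) (nat-÷ 1 (j !) {{j ℕP.!≢0}} n)))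
        (trans (cong (_* term (seq x n) j) (+-identityʳ 1ℚ)) (*-identityˡ (term (seq x n) j)))))
    where
    i = seq (1 ÷ (j !)) n

  isExp⇒ : ∀ {x y} → IsExp x y → ∀ ε → 0ℚ < ε → ∃ λ J₀ → ∀ J → J₀ ℕ.≤ J → Ev λ n → ∣ expSum (seq x n) J - seq y n ∣ ≤ ε
  isExp⇒ {x} {y} h ε ε>0 = let (J₀ , g) = hasSum⇒sumsTo {_} {y} h ε ε>0 in J₀ , λ J l →
    ev-map (λ n → subst (λ z → ∣ z - seq y n ∣ ≤ ε) (∑-cong J λ j _ → seq-term x j n)) (g J l)

  expSum≡series : ∀ t J → expSum t J ≡ series (λ _ → 1ℚ) t J
  expSum≡series t J = ∑-cong J λ j _ → sym (*-identityˡ (term t j))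

  one-moderate : Moderate (λ _ → 1ℚ)
  one-moderate zero    = ≤-refl
  one-moderate (suc j) = ≤-trans (one-moderate j) (≤-cert (2ℚ ^ j) (^≥0 0≤2 j) (eq (2ℚ ^ j)))
    where
    eq : ∀ p → 2ℚ * p ≡ p + p
    eq = solve-∀ ℚ-ring

  expSum-converges : ∀ {B} → 0ℚ ≤ B → ∀ ε → 0ℚ < ε → ∃ λ N →
    ∀ t → ∣ t ∣ ≤ B → ∀ J K → N ℕ.≤ J → N ℕ.≤ K → ∣ expSum t K - expSum t J ∣ ≤ ε
  expSum-converges B≥0 ε ε>0 = let (N , h) = series-converges (λ _ → 1ℚ) one-moderate B≥0 ε ε>0 in
    N , λ t b J K l l′ → subst₂ (λ x y → ∣ x - y ∣ ≤ ε) (sym (expSum≡series t K)) (sym (expSum≡series t J)) (h t b J K l l′)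

  expSum-lipschitz : ∀ {B} → 0ℚ ≤ B → ∃ λ C → 0ℚ < C ×
    (∀ x y → ∣ x ∣ ≤ B → ∣ y ∣ ≤ B → ∀ J → ∣ expSum x J - expSum y J ∣ ≤ ∣ x - y ∣ * C)
  expSum-lipschitz {B} B≥0 = 2ℚ * C , *>0 (+>0 0<1 0≤1) C>0 , λ x y hx hy J →
    subst₂ (λ u v → ∣ u - v ∣ ≤ ∣ x - y ∣ * (2ℚ * C)) (sym (expSum≡series x J)) (sym (expSum≡series y J))
      (≤-trans (series-lipschitz (λ _ → 1ℚ) one-moderate hx hy J)
        (*-monoˡ ∣ x - y ∣ (0≤∣p∣ (x - y)) (*-monoˡ 2ℚ 0≤2 (bound J))))
    where
    Cs = expSum-bounded {2ℚ * B} (*≥0 0≤2 B≥0)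
    C : ℚ
    C = proj₁ Cs
    C>0 : 0ℚ < C
    C>0 = proj₁ (proj₂ Cs)
    bound : ∀ J → expSum (2ℚ * B) J ≤ C
    bound = proj₂ (proj₂ Cs)

  ∣expSum∣≤ : ∀ {t B} → ∣ t ∣ ≤ B → ∀ J → ∣ expSum t J ∣ ≤ expSum B J
  ∣expSum∣≤ {t} {B} h J = ≤-trans (∣∑∣≤ J (term t)) (∑-mono J λ j _ →
    subst (_≤ term B j) (sym (∣term∣ t j)) (term-mono (0≤∣p∣ t) h j))

  -- A diagonal sequence: uniform tail bounds on a bounded interval handle the number of terms, and
  -- the Lipschitz bound handles the argument.
  exp-cauchy : ∀ x → IsCauchy (λ n → expSum (seq x n) n)
  exp-cauchy x ε ε>0 = N₀ ℕ.⊔ (N₁ ℕ.⊔ N₂) , λ m n l l′ → ≤-<-trans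
      (≤-trans (∣p-r∣≤ (expSum (seq x m) m) (expSum (seq x m) n) (expSum (seq x n) n))
        (+-mono-≤ (tail (seq x m) (b≤ m (first l)) n m (second l′) (second l))
          (≤-trans (lip (seq x m) (seq x n) (b≤ m (first l)) (b≤ n (first l′)) n)
            (subst (∣ seq x m - seq x n ∣ * C ≤_) (trans (*-comm (proj₁ δ) C) (proj₂ (proj₂ δ)))
              (*-monoʳ C (<⇒≤ C>0) (<⇒≤ (proj₂ (cauchy x (proj₁ δ) (proj₁ (proj₂ δ))) m n (third l) (third l′))))))))
      (<-cert (½ * ε) (halve ε>0) (eq ε))
    where
    eq : ∀ e → e ≡ ½ * (½ * e) + ½ * (½ * e) + ½ * e
    eq = solve-∀ ℚ-ring
    bd = bounded x
    B : ℚ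
    B = proj₁ bd
    B≥0 : 0ℚ ≤ B
    B≥0 = <⇒≤ (proj₁ (proj₂ bd))
    N₀ : ℕ
    N₀ = proj₁ (proj₂ (proj₂ bd))
    b≤ : ∀ n → N₀ ℕ.≤ n → ∣ seq x n ∣ ≤ B
    b≤ = proj₂ (proj₂ (proj₂ bd))
    ¼ε>0 : 0ℚ < ½ * (½ * ε)
    ¼ε>0 = halve (halve ε>0)
    conv-tail = expSum-converges B≥0 (½ * (½ * ε)) ¼ε>0
    N₁ : ℕ
    N₁ = proj₁ conv-tail
    tail : ∀ t → ∣ t ∣ ≤ B → ∀ J K → N₁ ℕ.≤ J → N₁ ℕ.≤ K → ∣ expSum t K - expSum t J ∣ ≤ ½ * (½ * ε)
    tail = proj₂ conv-tail
    C : ℚ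
    C = proj₁ (expSum-lipschitz B≥0)
    C>0 : 0ℚ < C
    C>0 = proj₁ (proj₂ (expSum-lipschitz B≥0))
    lip : ∀ x y → ∣ x ∣ ≤ B → ∣ y ∣ ≤ B → ∀ J → ∣ expSum x J - expSum y J ∣ ≤ ∣ x - y ∣ * C
    lip = proj₂ (proj₂ (expSum-lipschitz B≥0))
    δ : ∃ λ δ → 0ℚ < δ × C * δ ≡ ½ * (½ * ε)
    δ = quotient C (½ * (½ * ε)) C>0 ¼ε>0
    N₂ : ℕ
    N₂ = proj₁ (cauchy x (proj₁ δ) (proj₁ (proj₂ δ)))
    first : ∀ {n} → N₀ ℕ.⊔ (N₁ ℕ.⊔ N₂) ℕ.≤ n → N₀ ℕ.≤ n
    first = ℕP.m⊔n≤o⇒m≤o N₀ (N₁ ℕ.⊔ N₂)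
    second : ∀ {n} → N₀ ℕ.⊔ (N₁ ℕ.⊔ N₂) ℕ.≤ n → N₁ ℕ.≤ n
    second l = ℕP.m⊔n≤o⇒m≤o N₁ N₂ (ℕP.m⊔n≤o⇒n≤o N₀ (N₁ ℕ.⊔ N₂) l)
    third : ∀ {n} → N₀ ℕ.⊔ (N₁ ℕ.⊔ N₂) ℕ.≤ n → N₂ ℕ.≤ n
    third l = ℕP.m⊔n≤o⇒n≤o N₁ N₂ (ℕP.m⊔n≤o⇒n≤o N₀ (N₁ ℕ.⊔ N₂) l)

  exp : ℝ → ℝ
  exp x = mkℝ (λ n → expSum (seq x n) n) (exp-cauchy x)

  exp-isExp : ∀ x → IsExp x (exp x)
  exp-isExp x = sumsTo⇒hasSum {_} {exp x} λ ε ε>0 →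
    let (B , B>0 , N₀ , b≤) = bounded x
        (N₁ , tail) = expSum-converges (<⇒≤ B>0) ε ε>0
    in N₁ , λ J l → N₀ ℕ.⊔ N₁ , λ n l′ → subst (λ z → ∣ z - expSum (seq x n) n ∣ ≤ ε)
      (∑-cong J λ j _ → sym (seq-term x j n))
      (tail (seq x n) (b≤ n (ℕP.m⊔n≤o⇒m≤o N₀ N₁ l′)) n J (ℕP.m⊔n≤o⇒n≤o N₀ N₁ l′) l)

  expSum-0 : ∀ J → expSum 0ℚ (suc J) ≡ 1ℚ
  expSum-0 zero    = refl
  expSum-0 (suc J) = trans (cong₂ _+_ (expSum-0 J) (eq (term 0ℚ J) (inv J))) (+-identityʳ 1ℚ)
    where
    eq : ∀ x i → x * (0ℚ * i) ≡ 0ℚ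
    eq = solve-∀ ℚ-ring

  -- The functional equation at x and -x; the truncation at 0 equals 1 only if it has at least one
  -- term, hence the successor in the index.
  exp-inverse : ∀ {x e} → IsExp (ℝ.- x) e → ∀ ε → 0ℚ < ε →
    ∃ λ J₀ → ∀ J → J₀ ℕ.≤ J → Ev λ n → ∣ seq e n * expSum (seq x n) J - 1ℚ ∣ ≤ ε
  exp-inverse {x} {e} h ε ε>0 =
    let (B , B>0 , Nb , b≤) = bounded x
        (C , C>0 , C≥) = expSum-bounded {B} (<⇒≤ B>0)
        (δ , δ>0 , Cδ) = quotient C (½ * ε) C>0 (halve ε>0)
        (J₁ , near) = isExp⇒ {ℝ.- x} {e} h δ δ>0
        (J₂ , _ , tail) = term→0 {B + B} (+≥0 (<⇒≤ B>0) (<⇒≤ B>0)) (½ * ε) (halve ε>0)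
    in suc (J₁ ℕ.+ J₂) , λ { (suc J) (ℕ.s≤s l) → ev-zip (λ n b c → main B C δ Cδ (seq x n) (seq e n) J b
          (≤-trans (∣expSum∣≤ b (suc J)) (C≥ (suc J))) c
          (tail (suc J) (suc J ℕ.+ suc J) (ℕP.≤-trans (ℕP.m≤n+m J₂ J₁) (ℕP.m≤n⇒m≤1+n l)) (ℕP.m≤m+n (suc J) (suc J))))
        (Nb , b≤) (near (suc J) (ℕP.≤-trans (ℕP.m≤m+n J₁ J₂) (ℕP.m≤n⇒m≤1+n l))) }
    where
    main : ∀ B C δ → C * δ ≡ ½ * ε → ∀ x e J → ∣ x ∣ ≤ B → ∣ expSum x (suc J) ∣ ≤ C → ∣ expSum (- x) (suc J) - e ∣ ≤ δ →
      expSum (B + B) (suc J ℕ.+ suc J) - expSum (B + B) (suc J) ≤ ½ * ε → ∣ e * expSum x (suc J) - 1ℚ ∣ ≤ ε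
    main B C δ Cδ x e J x≤B P≤C near tail = subst₂ _≤_ (cong ∣_∣ eq₁) (trans (cong (_+ ½ * ε) Cδ) (halves ε))
      (∣+∣≤ {x = - (P * (Q₋ - e))} {y = P * Q₋ - 1ℚ}
        (subst (_≤ C * δ) (sym (∣-p∣≡∣p∣ (P * (Q₋ - e)))) (∣*∣≤ P≤C near))
        (subst (λ z → ∣ P * Q₋ - z ∣ ≤ ½ * ε) (trans (cong (λ z → expSum z (suc J)) (+-inverseʳ x)) (expSum-0 J))
          (≤-trans (expSum-homomorphic {x} { - x} {B + B} (+-mono-≤ x≤B (subst (_≤ B) (sym (∣-p∣≡∣p∣ x)) x≤B)) (suc J)) tail)))
      where
      P Q₋ : ℚ
      P = expSum x (suc J)
      Q₋ = expSum (- x) (suc J)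
      eq : ∀ p q e → - (p * (q - e)) + (p * q - 1ℚ) ≡ e * p - 1ℚ
      eq = solve-∀ ℚ-ring
      eq₁ : - (P * (Q₋ - e)) + (P * Q₋ - 1ℚ) ≡ e * P - 1ℚ
      eq₁ = eq P Q₋ e

  -- `recip` inverts a shifted sequence, so the product is exactly 1 only against the shifted index.
  recip-seq : ∀ x (x>0 : ℝ.0ℝ ℝ.< x) n → seq x (proj₁ (proj₂ (proj₂ x>0)) ℕ.+ n) * seq (recip x x>0) n ≡ 1ℚ
  recip-seq x x>0 n = 1/⁺-inverse (Reciprocal.shifted x x>0 n) (Reciprocal.shifted>0 x x>0 n)

-- Existence, bounds and uniqueness of the real root.

module RealRoot where

  open import Data.Rational.Base hiding (_÷_)
  open import Data.Rational.Properties
  open Rationals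
  open ExponentialSums
  open SignChanges
  open RationalRoot
  open RealSequences

  seq-fromℕ : ∀ a n → seq (fromℕ a) n ≡ nat a
  seq-fromℕ a n = nat≡ a

  module RealExcess (k ℓ : ℕ) (2≤k : 2 ℕ.≤ k) (1≤ℓ : 1 ℕ.≤ ℓ) where
    open Excess k ℓ 2≤k 1≤ℓ

    κ≤1 : κ ≤ 1ℚ
    κ≤1 = ≤-trans κ≤½ (≤-cert ½ (<⇒≤ 0<½) refl)

    κ>0 : 0ℚ < κ
    κ>0 = inv>0 (ℕ.pred k)

    abstract
      ρ-cauchy : ℝ.IsCauchy (λ n → κ * root n)
      ρ-cauchy ε ε>0 = let (N , h) = root-cauchy ε ε>0 in N , λ m n l l′ → ≤-<-trans
        (subst₂ _≤_ (trans (sym (trans (∣p*q∣≡∣p∣*∣q∣ κ (root m - root n)) (cong (_* ∣ root m - root n ∣) (0≤p⇒∣p∣≡p κ≥0))))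
                           (cong ∣_∣ (eq κ (root m) (root n))))
                    (*-identityˡ ∣ root m - root n ∣)
          (*-monoʳ ∣ root m - root n ∣ (0≤∣p∣ (root m - root n)) κ≤1))
        (h m n l l′)
        where
        eq : ∀ k a b → k * (a - b) ≡ k * a - k * b
        eq = solve-∀ ℚ-ring

    -- `root` approximates the Poisson mean kρ, hence the factor 1 / k.
    ρ : ℝ
    ρ = mkℝ (λ n → κ * root n) ρ-cauchy

    kκ-cancel : ∀ x → nat k * (κ * x) ≡ x
    kκ-cancel x = trans (sym (*-assoc (nat k) κ x)) (trans (cong (_* x) kκ≡1) (*-identityˡ x))

    mean : ℝ → ℝ
    mean r = fromℕ k ℝ.* r

    seq-mean : ∀ r n → κ * seq (mean r) n ≡ seq r n
    seq-mean r n = trans (cong (λ z → κ * (z * seq r n)) (seq-fromℕ k n))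
      (trans (eq κ (nat k) (seq r n)) (trans (cong (_* seq r n) kκ≡1) (*-identityˡ (seq r n))))
      where
      eq : ∀ a b c → a * (b * c) ≡ b * a * c
      eq = solve-∀ ℚ-ring

    mean-ρ : ∀ n → seq (mean ρ) n ≡ root n
    mean-ρ n = trans (cong (_* (κ * root n)) (seq-fromℕ k n)) (kκ-cancel (root n))

    ρ>0 : ℝ.0ℝ ℝ.< ρ
    ρ>0 = κ * ½ , *>0 κ>0 0<½ , 0 , λ n _ →
      subst (_≤ κ * root n) (sym (+-identityˡ (κ * ½))) (*-monoˡ κ κ≥0 (root≥½ n))

    -- The series is at most -½ at kℓ and eventually above -¼ at `root`, so by the Lipschitz bound
    -- the two points stay a fixed distance apart.
    root-gap : ∃ λ g → 0ℚ < g × Ev λ n → root n + g ≤ β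
    root-gap = proj₁ g , proj₁ (proj₂ g) , N , λ n l → *-cancelˡ-≤ L L>0 (bound n l)
      where
      Cs = expSum-bounded {2ℚ * β} (*≥0 0≤2 (nat≥0 m))
      L : ℚ
      L = 2ℚ * proj₁ Cs
      L>0 : 0ℚ < L
      L>0 = *>0 (+>0 0<1 0≤1) (proj₁ (proj₂ Cs))
      ¼>0 : 0ℚ < ½ * ½
      ¼>0 = *>0 0<½ 0<½
      g : ∃ λ g → 0ℚ < g × L * g ≡ ½ * ½
      g = quotient L (½ * ½) L>0 ¼>0
      N₁ N₂ N : ℕ
      N₁ = proj₁ (root-residual (½ * ½) ¼>0)
      N₂ = proj₁ (term→0 (nat≥0 m) 1ℚ 0<1)
      N = N₁ ℕ.+ N₂
      eq₁ : ∀ L r g → L * (r + g) ≡ L * g + L * r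
      eq₁ = solve-∀ ℚ-ring
      eq₂ : ∀ L b r → (b - r) * L + L * r ≡ L * b
      eq₂ = solve-∀ ℚ-ring
      eq₃ : ∀ h b → h - b ≡ ½ * ½ + (½ * ½ - - h + (- ½ - b))
      eq₃ = solve-∀ ℚ-ring
      bound : ∀ n → N ℕ.≤ n → L * (root n + proj₁ g) ≤ L * β
      bound n l = subst₂ _≤_ (sym (eq₁ L (root n) (proj₁ g))) (eq₂ L β (root n)) (+-monoˡ-≤ (L * root n) (begin
        L * proj₁ g
          ≡⟨ proj₂ (proj₂ g) ⟩
        ½ * ½
          ≤⟨ ≤-cert (½ * ½ - - H (root n) T + (- ½ - H β T)) (+≥0
               (diff≥0 (≤-trans (-p≤∣p∣ (H (root n) T)) (proj₂ (root-residual (½ * ½) ¼>0) n T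
                 (ℕP.≤-trans (ℕP.m≤m+n N₁ N₂) l) (ℕP.m≤n⇒m≤1+n (ℕP.m≤m+n N₁ N₂)))))
               (diff≥0 (H-at-m N (proj₁ (proj₂ (term→0 (nat≥0 m) 1ℚ 0<1)) N (ℕP.m≤n+m N₂ N₁)))))
               (eq₃ (H (root n) T) (H β T)) ⟩
        H (root n) T - H β T
          ≤⟨ ≤-trans (p≤∣p∣ (H (root n) T - H β T)) (≤-reflexive (∣p-q∣≡∣q-p∣ (H (root n) T) (H β T))) ⟩
        ∣ H β T - H (root n) T ∣
          ≤⟨ series-lipschitz excess excess-moderate (≤-reflexive (0≤p⇒∣p∣≡p (nat≥0 m))) (∣root∣≤β n) T ⟩
        ∣ β - root n ∣ * (2ℚ * expSum (2ℚ * β) T)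
          ≤⟨ *-mono (0≤∣p∣ (β - root n)) (<⇒≤ L>0) (≤-reflexive (0≤p⇒∣p∣≡p (diff≥0 (root≤β n))))
               (*-monoˡ 2ℚ 0≤2 (proj₂ (proj₂ Cs) T)) ⟩
        (β - root n) * L ∎))
        where
        open ≤-Reasoning
        T : ℕ
        T = suc N

    ρ-gap : ∃ λ g → 0ℚ < g × Ev λ n → κ * root n + g ≤ nat ℓ
    ρ-gap = let (g , g>0 , N , h) = root-gap in κ * g , *>0 κ>0 g>0 , N , λ n l →
      subst₂ _≤_ (*-distribˡ-+ κ (root n) g) κm≡ℓ (*-monoˡ κ κ≥0 (h n l))

    ρ<ℓ : ρ ℝ.< fromℕ ℓ
    ρ<ℓ = let (g , g>0 , N , h) = ρ-gap in g , g>0 , N , λ n l → subst (κ * root n + g ≤_) (sym (seq-fromℕ ℓ n)) (h n l)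

    -- ρ + g ≤ ℓ gives ℓ / ρ ≥ 1 + g / ρ ≥ 1 + g / ℓ, and g / ℓ is the fixed rational margin that
    -- strict inequality of reals demands.
    1<ℓ/ρ : ℝ.1ℝ ℝ.< fromℕ ℓ ℝ.* recip ρ ρ>0
    1<ℓ/ρ = let (g , g>0 , N , h) = ρ-gap in inv (ℕ.pred ℓ) * g , *>0 (inv>0 (ℕ.pred ℓ)) g>0 , N , λ n l →
        subst (1ℚ + inv (ℕ.pred ℓ) * g ≤_) (cong (_* R n) (sym (seq-fromℕ ℓ n)))
          (bound g g>0 (P n) (R n) (recip-seq ρ ρ>0 n) (*>0 κ>0 (0<root n)) (h n l))
      where
      R P : ℕ → ℚ
      R = seq (recip ρ ρ>0)
      P n = κ * root n
      ℓi≡1 : nat ℓ * inv (ℕ.pred ℓ) ≡ 1ℚ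
      ℓi≡1 = subst (λ n → nat n * inv (ℕ.pred ℓ) ≡ 1ℚ) (ℕP.suc-pred ℓ {{ℕ.>-nonZero 1≤ℓ}}) (nat-inv (ℕ.pred ℓ))
      bound : ∀ g → 0ℚ < g → ∀ p r → p * r ≡ 1ℚ → 0ℚ < p → p + g ≤ nat ℓ → 1ℚ + inv (ℕ.pred ℓ) * g ≤ nat ℓ * r
      bound g g>0 p r pr≡1 p>0 p+g≤ℓ = *-cancelˡ-≤ p p>0 (begin
        p * (1ℚ + i * g)   ≡⟨ eq₁ p i g ⟩
        p + p * i * g      ≤⟨ +-monoʳ-≤ p (*-monoʳ {p * i} {nat ℓ * i} g (<⇒≤ g>0) (*-monoʳ {p} {nat ℓ} i (<⇒≤ (inv>0 (ℕ.pred ℓ)))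
                                (≤-trans (≤-cert {p} {p + g} g (<⇒≤ g>0) refl) p+g≤ℓ))) ⟩
        p + nat ℓ * i * g  ≡⟨ trans (cong (λ z → p + z * g) ℓi≡1) (cong (p +_) (*-identityˡ g)) ⟩
        p + g              ≤⟨ p+g≤ℓ ⟩
        nat ℓ              ≡⟨ sym (trans (eq₂ p (nat ℓ) r) (trans (cong (nat ℓ *_) pr≡1) (*-identityʳ (nat ℓ)))) ⟩
        p * (nat ℓ * r)    ∎)
        where
        open ≤-Reasoning
        i : ℚ
        i = inv (ℕ.pred ℓ)
        eq₁ : ∀ p i g → p * (1ℚ + i * g) ≡ p + p * i * g
        eq₁ = solve-∀ ℚ-ring
        eq₂ : ∀ p l r → p * (l * r) ≡ l * (p * r)
        eq₂ = solve-∀ ℚ-ring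

    -- e_n · Σ_{j<J} min {ℓ , j} tʲ/j! − t/k for the n-th approximations e_n of e^{-t} and t.
    private
      defect : ℚ → ℚ → ℚ → ℕ → ℚ
      defect e t r J = e * truncated t (suc J) - r

      defect≡ : ∀ e t r J → κ * t ≡ r → defect e t r J ≡ e * H t (suc J) + r * (e * expSum t J - 1ℚ)
      defect≡ e t r J refl = trans (cong (λ z → e * z - κ * t) (truncated-H t J)) (eq e (H t (suc J)) (κ * t) (expSum t J))
        where
        eq : ∀ e h r p → e * (h + r * p) - r ≡ e * h + r * (e * p - 1ℚ)
        eq = solve-∀ ℚ-ring

    seq-truncated : ∀ e x J n → ∑ J (λ j → seq (fromℕ (ℓ ℕ.⊓ j) ℝ.* (e ℝ.* ((1 ÷ (j !)) ℝ.* x ℝ.^ j))) n) ≡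
                    seq e n * truncated (seq x n) J
    seq-truncated e x J n = trans (∑-cong J λ j _ → trans
        (cong₂ (λ a b → a * (seq e n * b)) (seq-fromℕ (ℓ ℕ.⊓ j) n) (seq-term x j n))
        (eq (nat (ℓ ℕ.⊓ j)) (seq e n) (term (seq x n) j)))
      (∑-*ˡ J (seq e n) (λ j → nat (ℓ ℕ.⊓ j) * term (seq x n) j))
      where
      eq : ∀ a e t → a * (e * t) ≡ e * (a * t)
      eq = solve-∀ ℚ-ring

    -- By `defect≡` the error is e times the series at `root` plus ρ times the error of e^(-t) e^t =
    -- 1; both are small.
    ρ-isRoot : IsRoot k ℓ ρ
    ρ-isRoot = (λ j → e ℝ.* ((1 ÷ (j !)) ℝ.* mean ρ ℝ.^ j)) ,
      (e , exp-isExp (ℝ.- mean ρ) , λ j → ≈-refl {e ℝ.* ((1 ÷ (j !)) ℝ.* mean ρ ℝ.^ j)}) ,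
      sumsTo⇒hasSum {_} {ρ} sums
      where
      e : ℝ
      e = exp (ℝ.- mean ρ)
      sums : SumsTo (λ j → fromℕ (ℓ ℕ.⊓ j) ℝ.* (e ℝ.* ((1 ÷ (j !)) ℝ.* mean ρ ℝ.^ j))) ρ
      sums ε ε>0 =
        let (B , B>0 , b≤) = bounded e
            (η , η>0 , Bη) = quotient B (½ * ε) B>0 (halve ε>0)
            (θ , θ>0 , ℓθ) = quotient (nat ℓ) (½ * ε) (<-≤-trans 0<1 1≤nat-ℓ) (halve ε>0)
            (J₁ , inverse) = exp-inverse {mean ρ} {e} (exp-isExp (ℝ.- mean ρ)) θ θ>0
            (N₂ , residual) = root-residual η η>0
        in suc (J₁ ℕ.+ N₂) , λ { (suc J) (ℕ.s≤s l) → ev-zip₃ (λ n b c h → subst (_≤ ε)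
              (cong ∣_∣ (trans (sym (defect≡ (seq e n) (root n) (κ * root n) J refl))
                (cong (_- κ * root n) (sym (trans (seq-truncated e (mean ρ) (suc J) n)
                  (cong (λ z → seq e n * truncated z (suc J)) (mean-ρ n)))))))
              (subst (∣ seq e n * H (root n) (suc J) + κ * root n * (seq e n * expSum (root n) J - 1ℚ) ∣ ≤_)
                (trans (cong₂ _+_ Bη ℓθ) (halves ε))
                (∣+∣≤ (∣*∣≤ {seq e n} {H (root n) (suc J)} b h)
                      (∣*∣≤ {κ * root n} {seq e n * expSum (root n) J - 1ℚ}
                        (≤-trans (≤-reflexive (0≤p⇒∣p∣≡p (<⇒≤ (*>0 κ>0 (0<root n)))))
                          (subst (κ * root n ≤_) κm≡ℓ (*-monoˡ κ κ≥0 (root≤β n))))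
                        (subst (λ z → ∣ seq e n * expSum z J - 1ℚ ∣ ≤ θ) (mean-ρ n) c)))))
            b≤ (inverse J (ℕP.≤-trans (ℕP.m≤m+n J₁ N₂) l))
            (N₂ , λ n l′ → residual n (suc J) l′ (ℕP.m≤n⇒m≤1+n (ℕP.≤-trans (ℕP.m≤n+m N₂ J₁) l))) }

    sum-close : ∀ (f g : ℕ → ℝ) (a : ℕ → ℕ) → (∀ j → f j ℝ.≈ g j) → ∀ J ε → 0ℚ < ε →
      Ev λ n → ∣ ∑ J (λ j → seq (fromℕ (a j) ℝ.* f j) n) - ∑ J (λ j → seq (fromℕ (a j) ℝ.* g j) n) ∣ ≤ ε
    sum-close f g a h zero    ε ε>0 = ev-all λ n → <⇒≤ ε>0
    sum-close f g a h (suc J) ε ε>0 =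
      let (η , η>0 , aη) = quotient (nat (suc (a J))) (½ * ε) (nat>0 (a J)) (halve ε>0)
      in ev-zip (λ n p q → subst₂ _≤_ (cong ∣_∣ (eq (∑ J (λ j → seq (fromℕ (a j) ℝ.* f j) n)) (∑ J (λ j → seq (fromℕ (a j) ℝ.* g j) n))
                                          (seq (fromℕ (a J)) n) (seq (f J) n) (seq (g J) n)))
                                      (trans (cong (½ * ε +_) aη) (halves ε))
            (∣+∣≤ p (∣*∣≤ {seq (fromℕ (a J)) n} {seq (f J) n - seq (g J) n}
              (≤-trans (≤-reflexive (trans (cong ∣_∣ (seq-fromℕ (a J) n)) (0≤p⇒∣p∣≡p (nat≥0 (a J))))) (nat-mono (ℕP.n≤1+n (a J)))) q)))
          (sum-close f g a h J (½ * ε) (halve ε>0)) (≈⇒close {f J} {g J} (h J) η η>0)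
      where
      eq : ∀ x y a u v → (x - y) + a * (u - v) ≡ (x + a * u) - (y + a * v)
      eq = solve-∀ ℚ-ring

    root-defect : ∀ {r} → (root : IsRoot k ℓ r) → let e = proj₁ (proj₁ (proj₂ root)) in
      ∀ ε → 0ℚ < ε → ∃ λ J₀ → ∀ J → J₀ ℕ.≤ J → Ev λ n → ∣ seq e n * truncated (seq (mean r) n) J - seq r n ∣ ≤ ε
    root-defect {r} (π , (e , isExp , π≈) , hasSum) ε ε>0 =
      let (J₀ , near) = hasSum⇒sumsTo {_} {r} hasSum (½ * ε) (halve ε>0) in
      J₀ , λ J l → ev-zip (λ n p q → subst (λ z → ∣ z - seq r n ∣ ≤ ε) (seq-truncated e (mean r) J n)
          (≤-trans (∣p-r∣≤ (∑ J (λ j → seq (fromℕ (ℓ ℕ.⊓ j) ℝ.* (e ℝ.* ((1 ÷ (j !)) ℝ.* mean r ℝ.^ j))) n))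
                           (∑ J (λ j → seq (fromℕ (ℓ ℕ.⊓ j) ℝ.* π j) n)) (seq r n))
            (≤-trans (+-mono-≤ (subst (_≤ ½ * ε) (∣p-q∣≡∣q-p∣
                (∑ J (λ j → seq (fromℕ (ℓ ℕ.⊓ j) ℝ.* π j) n))
                (∑ J (λ j → seq (fromℕ (ℓ ℕ.⊓ j) ℝ.* (e ℝ.* ((1 ÷ (j !)) ℝ.* mean r ℝ.^ j))) n))) p) q)
              (≤-reflexive (halves ε)))))
        (sum-close π (λ j → e ℝ.* ((1 ÷ (j !)) ℝ.* mean r ℝ.^ j)) (ℓ ℕ.⊓_) π≈ J (½ * ε) (halve ε>0)) (near J l)

    private
      ∣H∣≤ : ∀ {t B} → ∣ t ∣ ≤ B → ∀ J → ∣ H t J ∣ ≤ expSum (2ℚ * B) J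
      ∣H∣≤ {t} h J = ≤-trans (∣∑∣≤ J (λ j → excess j * term t j))
        (∑-mono J λ j _ → coefficient-bound excess excess-moderate h j)

      -- `defect≡` bounds e h for the series value h. Multiplying by P, the exponential sum at t,
      -- recovers h = P (e h) - (e P - 1) h without a lower bound on e.
      H-small : ∀ {e t r J C C₂ R δ} → κ * t ≡ r → ∣ expSum t J ∣ ≤ C → ∣ H t (suc J) ∣ ≤ C₂ → ∣ r ∣ ≤ R →
        ∣ e * truncated t (suc J) - r ∣ ≤ δ → ∣ e * expSum t J - 1ℚ ∣ ≤ δ → ∣ H t (suc J) ∣ ≤ (C * (1ℚ + R) + C₂) * δ
      H-small {e} {t} {r} {J} {C} {C₂} {R} {δ} κt hC hC₂ hR hd he = subst₂ _≤_ (cong ∣_∣ eq′) (eq₂ C R C₂ δ)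
        (∣+∣≤ (∣*∣≤ hC (∣+∣≤ hd (subst (_≤ R * δ) (sym (∣-p∣≡∣p∣ (r * (e * P - 1ℚ)))) (∣*∣≤ {r} {e * P - 1ℚ} hR he))))
              (subst (_≤ δ * C₂) (sym (∣-p∣≡∣p∣ ((e * P - 1ℚ) * h))) (∣*∣≤ {e * P - 1ℚ} {h} he hC₂)))
        where
        P h : ℚ
        P = expSum t J
        h = H t (suc J)
        eq₁ : ∀ e h r P → P * (e * h + r * (e * P - 1ℚ) + - (r * (e * P - 1ℚ))) + - ((e * P - 1ℚ) * h) ≡ h
        eq₁ = solve-∀ ℚ-ring
        eq₂ : ∀ C R D d → C * (d + R * d) + d * D ≡ (C * (1ℚ + R) + D) * d
        eq₂ = solve-∀ ℚ-ring
        eq′ : P * (e * truncated t (suc J) - r + - (r * (e * P - 1ℚ))) + - ((e * P - 1ℚ) * h) ≡ h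
        eq′ = trans (cong (λ z → P * (z + - (r * (e * P - 1ℚ))) + - ((e * P - 1ℚ) * h)) (defect≡ e t r J κt)) (eq₁ e h r P)

    H-vanishes : ∀ r → IsRoot k ℓ r → ∀ η → 0ℚ < η → ∃ λ J₀ → ∀ J → J₀ ℕ.≤ J → Ev λ n → ∣ H (seq (mean r) n) (suc J) ∣ ≤ η
    H-vanishes r isRoot η η>0 =
      let e = proj₁ (proj₁ (proj₂ isRoot))
          (B , B>0 , b≤) = bounded (mean r)
          (R , R>0 , r≤) = bounded r
          (C , C>0 , C≥) = expSum-bounded {B} (<⇒≤ B>0)
          (C₂ , C₂>0 , C₂≥) = expSum-bounded {2ℚ * B} (*≥0 0≤2 (<⇒≤ B>0))
          (δ , δ>0 , Kδ) = quotient (C * (1ℚ + R) + C₂) η (+>0 (*>0 C>0 (+>0 0<1 (<⇒≤ R>0))) (<⇒≤ C₂>0)) η>0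
          (J₁ , defect≤) = root-defect {r} isRoot δ δ>0
          (J₂ , inverse) = exp-inverse {mean r} {e} (proj₁ (proj₂ (proj₁ (proj₂ isRoot)))) δ δ>0
      in J₁ ℕ.+ J₂ , λ J l → ev-zip₃
        (λ n br d i → subst (∣ H (seq (mean r) n) (suc J) ∣ ≤_) Kδ (H-small {e = seq e n} {J = J} (seq-mean r n)
          (≤-trans (∣expSum∣≤ (proj₁ br) J) (C≥ J)) (≤-trans (∣H∣≤ (proj₁ br) (suc J)) (C₂≥ (suc J))) (proj₂ br) d i))
        (ev-zip (λ n b r → b , r) b≤ r≤) (defect≤ (suc J) (ℕP.m≤n⇒m≤1+n (ℕP.≤-trans (ℕP.m≤m+n J₁ J₂) l)))
        (inverse J (ℕP.≤-trans (ℕP.m≤n+m J₂ J₁) l))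

    private
      separated : ∀ {α B a b η ε J} → 0ℚ < α → α ≤ a → α ≤ b → a ≤ B → b ≤ B → 0ℚ ≤ η →
        2ℚ * 2ℚ * B ^ m * η ≡ α ^ m * ε → ∣ H a (suc (suc J)) ∣ ≤ η → ∣ H b (suc (suc J)) ∣ ≤ η → ∣ a - b ∣ ≤ ε
      separated {α} {B} {a} {b} {η} {ε} {J} α>0 αa αb aB bB η≥0 scale Ha Hb = go (≤-total a b)
        where
        flip : ∀ {x} → ∣ x ∣ ≤ η → - η ≤ x
        flip {x} h = ≤-cert (η - - x) (diff≥0 (≤-trans (-p≤∣p∣ x) h)) (eq x η)
          where
          eq : ∀ x e → x ≡ - e + (e - - x)
          eq = solve-∀ ℚ-ring
        close : ∀ {a b} → α ≤ a → a ≤ b → b ≤ B → ∣ H a (suc (suc J)) ∣ ≤ η → ∣ H b (suc (suc J)) ∣ ≤ η → ∣ b - a ∣ ≤ ε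
        close {a} {b} αa a≤b bB Ha Hb = subst (_≤ ε) (sym (0≤p⇒∣p∣≡p (diff≥0 a≤b))) (*-cancelˡ-≤ (α ^ m) (^>0 α>0 m)
          (≤-trans (separation excess-signChange α>0 αa a≤b bB η≥0 J (≤-trans (p≤∣p∣ (H a (suc (suc J)))) Ha) (flip Hb))
            (≤-reflexive scale)))
        go : a ≤ b ⊎ b ≤ a → ∣ a - b ∣ ≤ ε
        go (inj₁ l) = subst (_≤ ε) (∣p-q∣≡∣q-p∣ b a) (close αa l bB Ha Hb)
        go (inj₂ l) = close αb l aB Hb Ha

    -- For any root r, both k r and `root` n nearly annihilate the series, and both lie in a fixed
    -- interval whose left end α is positive, so `separation` makes them close.
    ρ-unique : ∀ r → ℝ.0ℝ ℝ.< r → IsRoot k ℓ r → r ℝ.≈ ρ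
    ρ-unique r (α′ , α′>0 , r≥) isRoot = close⇒≈ {r} {ρ} λ ε ε>0 →
      let (B′ , B′>0 , b≤) = bounded (mean r)
          B>0 = +>0 B′>0 (nat≥0 m)
          (η , η>0 , scale) = quotient (2ℚ * 2ℚ * (B′ + β) ^ m) (α ^ m * ε)
            (*>0 (*>0 (+>0 0<1 0≤1) (+>0 0<1 0≤1)) (^>0 B>0 m)) (*>0 (^>0 α>0 m) ε>0)
          (J₁ , vanish) = H-vanishes r isRoot η η>0
          (N₂ , residual) = root-residual η η>0
          J = J₁ ℕ.+ N₂
      in ev-zip₃ (λ n (b , r≥) h h′ → contract n (separated {J = J} α>0
            (≤-trans (p⊓q≤p α′ ½) (≤-trans (subst (_≤ seq r n) (+-identityˡ α′) r≥) (r≤mean n (≤-trans (<⇒≤ α′>0) (subst (_≤ seq r n) (+-identityˡ α′) r≥)))))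
            (≤-trans (p⊓q≤q α′ ½) (root≥½ n))
            (≤-trans (≤-trans (p≤∣p∣ (seq (mean r) n)) b) (≤-cert {p = B′} β (nat≥0 m) refl))
            (≤-trans (root≤β n) (≤-cert B′ (<⇒≤ B′>0) (+-comm B′ β)))
            (<⇒≤ η>0) scale h h′))
          (ev-zip (λ n b r → b , r) b≤ r≥)
          (vanish (suc J) (ℕP.m≤n⇒m≤1+n (ℕP.m≤m+n J₁ N₂)))
          (N₂ , λ n l → residual n (suc (suc J)) l (ℕP.m≤n⇒m≤1+n (ℕP.m≤n⇒m≤1+n (ℕP.m≤n+m N₂ J₁))))
      where
      α : ℚ
      α = α′ ⊓ ½
      α>0 : 0ℚ < α
      α>0 = go (⊓-sel α′ ½)
        where
        go : α ≡ α′ ⊎ α ≡ ½ → 0ℚ < α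
        go (inj₁ e) = subst (0ℚ <_) (sym e) α′>0
        go (inj₂ e) = subst (0ℚ <_) (sym e) 0<½
      r≤mean : ∀ n → 0ℚ ≤ seq r n → seq r n ≤ seq (mean r) n
      r≤mean n r≥0 = subst₂ _≤_ (*-identityˡ (seq r n)) (cong (_* seq r n) (sym (seq-fromℕ k n)))
        (*-monoʳ (seq r n) r≥0 (nat-mono {1} (ℕP.≤-trans (ℕP.n≤1+n 1) 2≤k)))
      contract : ∀ n {ε} → ∣ seq (mean r) n - root n ∣ ≤ ε → ∣ seq r n - κ * root n ∣ ≤ ε
      contract n {ε} h = ≤-trans (≤-reflexive (trans (cong (λ z → ∣ z - κ * root n ∣) (sym (seq-mean r n)))
          (trans (cong ∣_∣ (eq κ (seq (mean r) n) (root n))) (∣p*q∣≡∣p∣*∣q∣ κ (seq (mean r) n - root n)))))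
        (≤-trans (*-mono (0≤∣p∣ κ) (≤-trans (0≤∣p∣ _) h) (≤-trans (≤-reflexive (0≤p⇒∣p∣≡p κ≥0)) κ≤1) h)
          (≤-reflexive (*-identityˡ ε)))
        where
        eq : ∀ k a b → k * a - k * b ≡ k * (a - b)
        eq = solve-∀ ℚ-ring

-- Integer bounds for the real power V^(ℓ + r).

module RealPowers where

  open import Data.Rational.Base hiding (_÷_)
  open import Data.Rational.Properties
  open Rationals
  open ExponentialSums
  open RealSequences
  open RealRoot using (seq-fromℕ)
  open FixedRandomness using (^-distribʳ-*)

  -- The power law for truncations: in this direction the number of terms is multiplied by the
  -- exponent, in `expSum-≤-^` it stays the same.
  expSum-^-≤ : ∀ {x} → 0ℚ ≤ x → ∀ J N → expSum x J ^ suc N ≤ expSum (nat (suc N) * x) (suc N ℕ.* J)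
  expSum-^-≤ {x} x≥0 J zero = ≤-reflexive (trans (*-identityʳ (expSum x J))
    (cong₂ expSum (eq x) (sym (ℕP.+-identityʳ J))))
    where
    eq : ∀ x → x ≡ (1ℚ + 0ℚ) * x
    eq = solve-∀ ℚ-ring
  expSum-^-≤ {x} x≥0 J (suc N) = ≤-trans (*-monoˡ (expSum x J) (expSum≥0 x≥0 J) (expSum-^-≤ x≥0 J N))
    (≤-trans (expSum-*-≤ x≥0 (*≥0 (nat≥0 (suc N)) x≥0) J (suc N ℕ.* J))
      (≤-reflexive (cong (λ z → expSum z (suc (suc N) ℕ.* J)) (eq x (nat (suc N))))))
    where
    eq : ∀ x n → x + n * x ≡ (1ℚ + n) * x
    eq = solve-∀ ℚ-ring

  expSum-≤-^ : ∀ {x} → 0ℚ ≤ x → ∀ J N → expSum (nat N * x) J ≤ expSum x J ^ N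
  expSum-≤-^ {x} x≥0 zero    zero = 0≤1
  expSum-≤-^ {x} x≥0 (suc J) zero = ≤-reflexive (trans (cong (λ z → expSum z (suc J)) (*-zeroˡ x)) (expSum-0 J))
  expSum-≤-^ {x} x≥0 J (suc N) = ≤-trans (≤-reflexive (cong (λ z → expSum z J) (eq x (nat N))))
    (≤-trans (expSum-+-≤ x≥0 (*≥0 (nat≥0 N) x≥0) J) (*-monoˡ (expSum x J) (expSum≥0 x≥0 J) (expSum-≤-^ x≥0 J N)))
    where
    eq : ∀ x n → (1ℚ + n) * x ≡ x + n * x
    eq = solve-∀ ℚ-ring

  -- exp L · exp (- L) ≈ 1, and exp (- L) ≥ 1 if L ≤ 0.
  exponent≥0 : ∀ {L B} J → ∣ L ∣ ≤ B → expSum (B + B) (suc J ℕ.+ suc J) - expSum (B + B) (suc J) ≤ ½ →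
               2ℚ ≤ expSum L (suc J) → 0ℚ ≤ L
  exponent≥0 {L} {B} J h tail big = go (≤-total 0ℚ L)
    where
    P Q₋ : ℚ
    P = expSum L (suc J)
    Q₋ = expSum (- L) (suc J)
    product : P * Q₋ - 1ℚ ≤ ½
    product = ≤-trans (p≤∣p∣ (P * Q₋ - 1ℚ)) (≤-trans
      (subst (λ z → ∣ P * Q₋ - z ∣ ≤ expSum (B + B) (suc J ℕ.+ suc J) - expSum (B + B) (suc J))
        (trans (cong (λ z → expSum z (suc J)) (+-inverseʳ L)) (expSum-0 J))
        (expSum-homomorphic {L} { - L} {B + B} (+-mono-≤ h (subst (_≤ B) (sym (∣-p∣≡∣p∣ L)) h)) (suc J))) tail)
    go : 0ℚ ≤ L ⊎ L ≤ 0ℚ → 0ℚ ≤ L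
    go (inj₁ l) = l
    go (inj₂ l) = contradiction (<-≤-trans (<-cert {½} {2ℚ * 1ℚ - 1ℚ} ½ 0<½ refl) (≤-trans
        (≤-cert {2ℚ * 1ℚ - 1ℚ} {P * Q₋ - 1ℚ} (P * Q₋ - 2ℚ * 1ℚ) (diff≥0 (*-mono 0≤2 (≤-trans 0≤1 1≤Q) big 1≤Q)) (eq₂ (P * Q₋)))
        product)) (<-irrefl refl)
      where
      1≤Q : 1ℚ ≤ Q₋
      1≤Q = 1≤expSum (neg≥0 l) J
      eq₂ : ∀ x → x - 1ℚ ≡ 2ℚ * 1ℚ - 1ℚ + (x - 2ℚ * 1ℚ)
      eq₂ = solve-∀ ℚ-ring

  -- Approximation losses of `power-bound`: a factor 3 under the exponent N and a factor 2 under the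
  -- exponent N ℓ + 1.
  powerFactor : ℕ → ℕ → ℕ
  powerFactor ℓ N = 3 ℕ.^ N ℕ.* 2 ℕ.^ suc (N ℕ.* ℓ)

  -- Raising to the power N + 1 clears the real exponent: (N + 1) (ℓ + r) ≤ (N + 1) ℓ + 1 when ∣r∣ ≤
  -- 1 / (N + 1). Truncations at one sufficiently late index replace all the reals.
  power-bound : ∀ {ℓ p s r z} N → 1 ℕ.≤ ℓ → 3 ℕ.≤ p → IsPower p (fromℕ ℓ ℝ.+ r) z → fromℕ s ℝ.≤ z →
    (Ev λ n → ∣ seq r n ∣ ≤ inv N) → s ℕ.^ suc N ℕ.≤ powerFactor ℓ (suc N) ℕ.* p ℕ.^ suc (suc N ℕ.* ℓ)
  power-bound {ℓ} {p} {s} {r} {z} N 1≤ℓ 3≤p (L , expL , expyL) s≤z r-small =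
    let (B , B>0 , L≤) = bounded L
        (J₁ , nearL) = isExp⇒ {L} {fromℕ p} expL 1ℚ 0<1
        (J₂ , nearx) = isExp⇒ {(fromℕ ℓ ℝ.+ r) ℝ.* L} {z} expyL 1ℚ 0<1
        (J₃ , _ , tail) = term→0 {B + B} (+≥0 (<⇒≤ B>0) (<⇒≤ B>0)) ½ 0<½
        J′ = J₁ ℕ.+ (J₂ ℕ.+ J₃)
        J = suc J′
        J₁≤J = ℕP.m≤n⇒m≤1+n (ℕP.m≤m+n J₁ (J₂ ℕ.+ J₃))
        J₂≤J = ℕP.m≤n⇒m≤1+n (ℕP.≤-trans (ℕP.m≤m+n J₂ J₃) (ℕP.m≤n+m (J₂ ℕ.+ J₃) J₁))
        J₃≤J = ℕP.m≤n⇒m≤1+n (ℕP.≤-trans (ℕP.m≤n+m J₃ J₂) (ℕP.m≤n+m (J₂ ℕ.+ J₃) J₁))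
        (n , h) = ev-zip₃ (λ n a b c → a , b , c)
          (ev-zip₃ (λ n a b c → a , b , c) L≤ (nearL J J₁≤J) (nearL (suc N ℕ.* J) (ℕP.≤-trans J₁≤J (ℕP.m≤m+n J (N ℕ.* J)))))
          (ev-zip (λ n a b → a , b) (nearx J J₂≤J) r-small)
          (s≤z 1ℚ 0<1)
        ((l≤ , a , b) , (c , ρ) , d) = h n ℕP.≤-refl
    in main B J′ (seq L n) (seq r n) (seq z n) l≤ (tail J (J ℕ.+ J) J₃≤J (ℕP.m≤m+n J J))
         (subst (λ y → ∣ expSum (seq L n) J - y ∣ ≤ 1ℚ) (seq-fromℕ p n) a)
         (subst (λ y → ∣ expSum (seq L n) (suc N ℕ.* J) - y ∣ ≤ 1ℚ) (seq-fromℕ p n) b)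
         (subst (λ y → ∣ expSum ((y + seq r n) * seq L n) J - seq z n ∣ ≤ 1ℚ) (seq-fromℕ ℓ n) c) ρ
         (subst (_≤ seq z n + 1ℚ) (seq-fromℕ s n) d)
    where
    N′ : ℕ
    N′ = suc (suc N ℕ.* ℓ)
    main : ∀ B J′ L r z → let J = suc J′ in ∣ L ∣ ≤ B → expSum (B + B) (J ℕ.+ J) - expSum (B + B) J ≤ ½ →
      ∣ expSum L J - nat p ∣ ≤ 1ℚ → ∣ expSum L (suc N ℕ.* J) - nat p ∣ ≤ 1ℚ →
      ∣ expSum ((nat ℓ + r) * L) J - z ∣ ≤ 1ℚ → ∣ r ∣ ≤ inv N → nat s ≤ z + 1ℚ →
      s ℕ.^ suc N ℕ.≤ powerFactor ℓ (suc N) ℕ.* p ℕ.^ N′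
    main B J′ L r z L≤ tail nearL nearL′ nearx r≤ s≤ = nat-cancel-≤ (begin
      nat (s ℕ.^ suc N)
        ≡⟨ nat-^ s (suc N) ⟩
      nat s ^ suc N
        ≤⟨ ^-mono (nat≥0 s) s≤3P (suc N) ⟩
      (nat 3 * P) ^ suc N
        ≡⟨ ^-distrib (nat 3) P (suc N) ⟩
      nat 3 ^ suc N * P ^ suc N
        ≤⟨ *-monoˡ (nat 3 ^ suc N) (^≥0 (nat≥0 3) (suc N)) (begin
            P ^ suc N                                          ≤⟨ expSum-^-≤ x≥0 J N ⟩
            expSum (nat (suc N) * x) (suc N ℕ.* J)             ≤⟨ expSum-mono (*≥0 (nat≥0 (suc N)) x≥0) Nx≤ (suc N ℕ.* J) ⟩
            expSum (nat N′ * L) (suc N ℕ.* J)                  ≤⟨ expSum-≤-^ L≥0 (suc N ℕ.* J) N′ ⟩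
            expSum L (suc N ℕ.* J) ^ N′                        ≤⟨ ^-mono (expSum≥0 L≥0 (suc N ℕ.* J)) P′≤ N′ ⟩
            nat (2 ℕ.* p) ^ N′                                 ∎) ⟩
      nat 3 ^ suc N * nat (2 ℕ.* p) ^ N′
        ≡⟨ trans (cong₂ _*_ (sym (nat-^ 3 (suc N))) (sym (nat-^ (2 ℕ.* p) N′))) (sym (nat-* (3 ℕ.^ suc N) ((2 ℕ.* p) ℕ.^ N′))) ⟩
      nat (3 ℕ.^ suc N ℕ.* (2 ℕ.* p) ℕ.^ N′)
        ≡⟨ cong nat (trans (cong (3 ℕ.^ suc N ℕ.*_) (^-distribʳ-* N′ 2 p)) (sym (ℕP.*-assoc (3 ℕ.^ suc N) (2 ℕ.^ N′) (p ℕ.^ N′)))) ⟩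
      nat (powerFactor ℓ (suc N) ℕ.* p ℕ.^ N′) ∎)
      where
      open ≤-Reasoning
      J : ℕ
      J = suc J′
      x P : ℚ
      x = (nat ℓ + r) * L
      P = expSum x J
      ^-distrib : ∀ a b n → (a * b) ^ n ≡ a ^ n * b ^ n
      ^-distrib a b zero    = refl
      ^-distrib a b (suc n) = trans (cong (a * b *_) (^-distrib a b n)) (eq a b (a ^ n) (b ^ n))
        where
        eq : ∀ a b c d → a * b * (c * d) ≡ a * c * (b * d)
        eq = solve-∀ ℚ-ring
      -- p ≥ 3 still leaves the truncation of e^L at least 2 after an error of 1, as `exponent≥0`
      -- asks.
      L≥0 : 0ℚ ≤ L
      L≥0 = exponent≥0 J′ L≤ tail (≤-cert (nat p - nat 3 + (expSum L J + 1ℚ - nat p))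
        (+≥0 (diff≥0 (nat-mono 3≤p)) (diff≥0 (∣∣≤⇒≥ (expSum L J) (nat p) nearL))) (eq (expSum L J) (nat p)))
        where
        eq : ∀ e p → e ≡ 2ℚ + (p - (1ℚ + (1ℚ + (1ℚ + 0ℚ))) + (e + 1ℚ - p))
        eq = solve-∀ ℚ-ring
      Nr≤1 : ∀ y → y ≤ ∣ r ∣ → nat (suc N) * y ≤ 1ℚ
      Nr≤1 y h = subst (nat (suc N) * y ≤_) (nat-inv N) (*-monoˡ (nat (suc N)) (nat≥0 (suc N)) (≤-trans h r≤))
      ℓ+r≥0 : 0ℚ ≤ nat ℓ + r
      ℓ+r≥0 = ≤-cert (nat ℓ - 1ℚ + (1ℚ - ∣ r ∣) + (∣ r ∣ - - r))
        (+≥0 (+≥0 (diff≥0 (nat-mono {1} 1≤ℓ)) (diff≥0 (≤-trans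
          (≤-cert {∣ r ∣} (nat N * ∣ r ∣) (*≥0 (nat≥0 N) (0≤∣p∣ r)) (eq (nat N) ∣ r ∣)) (Nr≤1 ∣ r ∣ ≤-refl)))) (diff≥0 (-p≤∣p∣ r)))
        (eq′ (nat ℓ) r ∣ r ∣)
        where
        eq : ∀ n a → (1ℚ + n) * a ≡ a + n * a
        eq = solve-∀ ℚ-ring
        eq′ : ∀ l r a → l + r ≡ 0ℚ + (l - 1ℚ + (1ℚ - a) + (a - - r))
        eq′ = solve-∀ ℚ-ring
      x≥0 : 0ℚ ≤ x
      x≥0 = *≥0 ℓ+r≥0 L≥0
      Nx≤ : nat (suc N) * x ≤ nat N′ * L
      Nx≤ = ≤-cert ((1ℚ - nat (suc N) * r) * L) (*≥0 (diff≥0 (Nr≤1 r (p≤∣p∣ r))) L≥0)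
        (trans (cong (λ y → (1ℚ + y) * L) (nat-* (suc N) ℓ)) (eq (nat (suc N)) (nat ℓ) r L))
        where
        eq : ∀ n l r L → (1ℚ + n * l) * L ≡ n * ((l + r) * L) + (1ℚ - n * r) * L
        eq = solve-∀ ℚ-ring
      s≤3P : nat s ≤ nat 3 * P
      s≤3P = ≤-cert (z + 1ℚ - nat s + (P + 1ℚ - z) + 2ℚ * (P - 1ℚ))
        (+≥0 (+≥0 (diff≥0 s≤) (diff≥0 (∣∣≤⇒≥ P z nearx))) (*≥0 0≤2 (diff≥0 (1≤expSum x≥0 J′)))) (eq (nat s) z P)
        where
        eq : ∀ s z p → (1ℚ + (1ℚ + (1ℚ + 0ℚ))) * p ≡ s + (z + 1ℚ - s + (p + 1ℚ - z) + 2ℚ * (p - 1ℚ))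
        eq = solve-∀ ℚ-ring
      P′≤ : expSum L (suc N ℕ.* J) ≤ nat (2 ℕ.* p)
      P′≤ = ≤-trans (∣∣≤⇒≤ (expSum L (suc N ℕ.* J)) (nat p) nearL′)
        (subst (nat p + 1ℚ ≤_) (sym (trans (nat-* 2 p) (eq (nat p))))
          (+-monoʳ-≤ (nat p) (nat-mono {1} (ℕP.≤-trans (ℕ.s≤s ℕ.z≤n) 3≤p))))
        where
        eq : ∀ p → (1ℚ + (1ℚ + 0ℚ)) * p ≡ p + p
        eq = solve-∀ ℚ-ring

  integer-root : ∀ N Z → ∃ λ Y → Y ℕ.^ suc N ℕ.≤ Z × Z ℕ.< suc Y ℕ.^ suc N
  integer-root N zero    = 0 , ℕ.z≤n , ℕP.m^n>0 1 (suc N)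
  integer-root N (suc Z) with integer-root N Z
  ... | Y , lo , hi with suc Z ℕP.<? suc Y ℕ.^ suc N
  ...   | yes l = Y , ℕP.m≤n⇒m≤1+n lo , l
  ...   | no ¬l = suc Y , ℕP.≮⇒≥ ¬l , ℕP.≤-<-trans hi (ℕP.^-monoˡ-< (suc N) ℕP.≤-refl)

  -- Rounds V^{ℓ + o(1)} to Y V^ℓ with Y^{2M} = O(V).
  integer-slack : ∀ {ℓ p M K} → 1 ℕ.≤ p → 1 ℕ.≤ K → ∃ λ Y → 1 ℕ.≤ Y ×
    (∀ s → s ℕ.^ suc (M ℕ.+ M) ℕ.≤ K ℕ.* p ℕ.^ suc (suc (M ℕ.+ M) ℕ.* ℓ) → s ℕ.≤ Y ℕ.* p ℕ.^ ℓ) ×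
    Y ℕ.^ M ℕ.* Y ℕ.^ M ℕ.≤ 2 ℕ.^ suc (M ℕ.+ M) ℕ.* K ℕ.* p
  integer-slack {ℓ} {p} {M} {K} 1≤p 1≤K = suc Y , ℕ.s≤s ℕ.z≤n ,
      (λ s h → ℕP.≮⇒≥ λ l → ℕP.<-irrefl refl (ℕP.<-≤-trans (too-big s l) h)) , small
    where
    open ℕP.≤-Reasoning
    N : ℕ
    N = M ℕ.+ M
    R = integer-root N (K ℕ.* p)
    Y : ℕ
    Y = proj₁ R
    instance
      p≢0 : ℕ.NonZero p
      p≢0 = ℕ.>-nonZero 1≤p
    -- With Y ≥ 1, rounding up to Y + 1 at most doubles the slack, which accounts for the power of
    -- 2.
    Y≥1 : ∀ Y → K ℕ.* p ℕ.< suc Y ℕ.^ suc N → 1 ℕ.≤ Y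
    Y≥1 zero    l = contradiction (ℕP.<-≤-trans l (ℕP.≤-reflexive (ℕP.^-zeroˡ (suc N)))) (ℕP.≤⇒≯ (ℕP.*-mono-≤ 1≤K 1≤p))
    Y≥1 (suc Y) l = ℕ.s≤s ℕ.z≤n
    too-big : ∀ s → suc Y ℕ.* p ℕ.^ ℓ ℕ.< s → K ℕ.* p ℕ.^ suc (suc N ℕ.* ℓ) ℕ.< s ℕ.^ suc N
    too-big s l = begin-strict
      K ℕ.* (p ℕ.* p ℕ.^ (suc N ℕ.* ℓ))          ≡⟨ sym (ℕP.*-assoc K p (p ℕ.^ (suc N ℕ.* ℓ))) ⟩
      K ℕ.* p ℕ.* p ℕ.^ (suc N ℕ.* ℓ)            <⟨ ℕP.*-monoˡ-< (p ℕ.^ (suc N ℕ.* ℓ)) {{ℕP.m^n≢0 p (suc N ℕ.* ℓ)}} (proj₂ (proj₂ R)) ⟩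
      suc Y ℕ.^ suc N ℕ.* p ℕ.^ (suc N ℕ.* ℓ)    ≡⟨ cong (suc Y ℕ.^ suc N ℕ.*_) (trans (cong (p ℕ.^_) (ℕP.*-comm (suc N) ℓ)) (sym (ℕP.^-*-assoc p ℓ (suc N)))) ⟩
      suc Y ℕ.^ suc N ℕ.* (p ℕ.^ ℓ) ℕ.^ suc N    ≡⟨ sym (^-distribʳ-* (suc N) (suc Y) (p ℕ.^ ℓ)) ⟩
      (suc Y ℕ.* p ℕ.^ ℓ) ℕ.^ suc N              ≤⟨ ℕP.^-monoˡ-≤ (suc N) (ℕP.<⇒≤ l) ⟩
      s ℕ.^ suc N                                ∎
    small : suc Y ℕ.^ M ℕ.* suc Y ℕ.^ M ℕ.≤ 2 ℕ.^ suc N ℕ.* K ℕ.* p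
    small = begin
      suc Y ℕ.^ M ℕ.* suc Y ℕ.^ M      ≡⟨ sym (ℕP.^-distribˡ-+-* (suc Y) M M) ⟩
      suc Y ℕ.^ N                      ≤⟨ ℕP.^-monoʳ-≤ (suc Y) (ℕP.n≤1+n N) ⟩
      suc Y ℕ.^ suc N                  ≤⟨ ℕP.^-monoˡ-≤ (suc N) (ℕP.≤-trans (ℕP.+-monoˡ-≤ Y (Y≥1 Y (proj₂ (proj₂ R))))
                                            (ℕP.≤-reflexive (cong (Y ℕ.+_) (sym (ℕP.+-identityʳ Y))))) ⟩
      (2 ℕ.* Y) ℕ.^ suc N              ≡⟨ ^-distribʳ-* (suc N) 2 Y ⟩
      2 ℕ.^ suc N ℕ.* Y ℕ.^ suc N      ≤⟨ ℕP.*-monoʳ-≤ (2 ℕ.^ suc N) (proj₁ (proj₂ R)) ⟩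
      2 ℕ.^ suc N ℕ.* (K ℕ.* p)        ≡⟨ sym (ℕP.*-assoc (2 ℕ.^ suc N) K p) ⟩
      2 ℕ.^ suc N ℕ.* K ℕ.* p          ∎

-- Averaging over the randomness.

module RandomSketches where

  open import Data.Bool.Base using (true; false)
  open import Data.Fin.Base using (Fin; zero; suc)
  open import Data.Fin.Subset using (Subset; _∪_; ⁅_⁆; ⊥) renaming (_∈_ to _∈ˢ_)
  open import Data.Fin.Subset.Properties using (∪-identityʳ; _∈?_)
  open import Data.List.Properties using (length-filter)
  open import Data.Rational.Base hiding (_÷_)
  open import Data.Rational.Properties
  open import Data.Product.Properties using (,-injectiveˡ)
  open import Data.Unit.Base using (tt)
  open import Data.Vec.Base using (lookup; here; there; _∷_)
  open import Data.Vec.Properties using ([]=⇒lookup)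
  open import Relation.Unary using (⋃; U; ∅)
  open Rationals
  open RealSequences
  open BinomialMeans using (draws; Probability)
  open SupportingLine using (cap)
  open FixedRandomness using (success-bound; threshold)

  module _ (P : ProbabilitySpace) where
    open ProbabilitySpace P

    module _ (f : Ω → ℕ) (T : ℕ) (f≤T : ∀ ω → f ω ℕ.≤ T) (event : ∀ j → Event (λ ω → f ω ≡ j)) where

      private
        p : ℕ → ℕ → ℚ
        p j n = seq (ℙr _ (event j)) n

      empty-event : ∀ j → (∀ ω → f ω ≢ j) → ∀ ε → 0ℚ < ε → Ev λ n → ∣ p j n ∣ ≤ ε
      empty-event j h ε ε>0 = ev-zip (λ n a b → subst₂ _≤_ (cong ∣_∣ (eq (p j n) (seq (ℙr ∅ ∅-event) n))) (halves ε)
          (∣+∣≤ {p j n - seq (ℙr ∅ ∅-event) n} {seq (ℙr ∅ ∅-event) n - 0ℚ} a b))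
        (≈⇒close {ℙr _ (event j)} {ℙr ∅ ∅-event} (ℙr-cong (event j) ∅-event ((λ {ω} e → contradiction e (h ω)) , λ ())) (½ * ε) (halve ε>0))
        (≈⇒close {ℙr ∅ ∅-event} {ℝ.0ℝ} ℙr-∅ (½ * ε) (halve ε>0))
        where
        eq : ∀ a b → a - b + (b - 0ℚ) ≡ a
        eq = solve-∀ ℚ-ring

      -- Countable additivity is applied to all the level sets of f. Those beyond T are empty, so
      -- the finite sum itself serves as the sum of the series in the summability premise.
      total-probability : ∀ ε → 0ℚ < ε → Ev λ n → ∑ (suc T) (λ j → p j n) ≤ 1ℚ + ε
      total-probability ε ε>0 = ev-zip₃ (λ n a b c → ≤-trans (≤-reflexive (sym (seq-sum (suc T) (λ j → ℙr _ (event j)) n)))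
          (chain (seq (ℝ.sum (suc T) λ j → ℙr _ (event j)) n) (seq (ℙr (⋃ ℕ A) (proj₁ union)) n) (seq (ℙr U U-event) n) a b c))
        (≈⇒close {ℙr (⋃ ℕ A) (proj₁ union)} {s} (proj₂ union) (½ * (½ * ε)) (halve (halve ε>0)))
        (≈⇒close {ℙr (⋃ ℕ A) (proj₁ union)} {ℙr U U-event} (ℙr-cong (proj₁ union) U-event ((λ _ → tt) , λ {ω} _ → f ω , refl))
          (½ * (½ * ε)) (halve (halve ε>0)))
        (≈⇒close {ℙr U U-event} {ℝ.1ℝ} ℙr-U (½ * ε) (halve ε>0))
        where
        A : ℕ → Pred Ω 0ℓ
        A j ω = f ω ≡ j
        s : ℝ
        s = ℝ.sum (suc T) λ j → ℙr (A j) (event j)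
        chain : ∀ x y z → ∣ y - x ∣ ≤ ½ * (½ * ε) → ∣ y - z ∣ ≤ ½ * (½ * ε) → ∣ z - 1ℚ ∣ ≤ ½ * ε → x ≤ 1ℚ + ε
        chain x y z a b c = ≤-cert ((y + ½ * (½ * ε) - x) + (z + ½ * (½ * ε) - y) + (1ℚ + ½ * ε - z))
          (+≥0 (+≥0 (diff≥0 (∣∣≤⇒≥ y x a)) (diff≥0 (∣∣≤⇒≤ y z b))) (diff≥0 (∣∣≤⇒≤ z 1ℚ c))) (eq x y z ε)
          where
          eq : ∀ x y z e → 1ℚ + e ≡ x + ((y + ½ * (½ * e) - x) + (z + ½ * (½ * e) - y) + (1ℚ + ½ * e - z))
          eq = solve-∀ ℚ-ring
        beyond : ∀ i ε → 0ℚ < ε → Ev λ n → ∣ ∑ (i ℕ.+ suc T) (λ j → p j n) - ∑ (suc T) (λ j → p j n) ∣ ≤ ε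
        beyond zero    ε ε>0 = ev-all λ n → subst (_≤ ε) (sym (cong ∣_∣ (+-inverseʳ (∑ (suc T) (λ j → p j n))))) (<⇒≤ ε>0)
        beyond (suc i) ε ε>0 = ev-zip (λ n a b → subst₂ _≤_
            (cong ∣_∣ (eq (∑ (i ℕ.+ suc T) (λ j → p j n)) (∑ (suc T) (λ j → p j n)) (p (i ℕ.+ suc T) n))) (halves ε) (∣+∣≤ a b))
          (beyond i (½ * ε) (halve ε>0))
          (empty-event (i ℕ.+ suc T) (λ ω e → ℕP.<-irrefl refl (ℕP.<-≤-trans (ℕP.m≤n+m (suc T) i) (ℕP.≤-trans (ℕP.≤-reflexive (sym e)) (f≤T ω))))
            (½ * ε) (halve ε>0))
          where
          eq : ∀ a b c → a - b + c ≡ a + c - b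
          eq = solve-∀ ℚ-ring
        union : Σ (Event (⋃ ℕ A)) λ e → ℙr (⋃ ℕ A) e ℝ.≈ s
        union = ⋃-event A event (λ i≢j ω a b → i≢j (trans (sym a) b)) s (sumsTo⇒hasSum {_} {s} λ ε ε>0 →
          suc T , λ J l → ev-map (λ n h → subst (λ z → ∣ ∑ J (λ j → p j n) - z ∣ ≤ ε) (sym (seq-sum (suc T) (λ j → ℙr (A j) (event j)) n))
              (subst (λ i → ∣ ∑ i (λ j → p j n) - ∑ (suc T) (λ j → p j n) ∣ ≤ ε) (ℕP.m∸n+n≡m l) h))
            (beyond (J ℕ.∸ suc T) ε ε>0))

      module _ (D : ℕ) (bound : ∀ ω → 2 ℕ.* suc D ℕ.* f ω ℕ.+ T ℕ.≤ 2 ℕ.* suc D ℕ.* T) where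

        private
          θ : ℚ
          θ = 1ℚ - ½ * inv D

          c : ℕ → ℕ → ℚ
          c j n = seq (j ÷ T) n

          Good : ℕ → Set
          Good j = 2 ℕ.* suc D ℕ.* j ℕ.+ T ℕ.≤ 2 ℕ.* suc D ℕ.* T

          inv≤1 : inv D ≤ 1ℚ
          inv≤1 = subst (inv D ≤_) (nat-inv D) (subst (_≤ nat (suc D) * inv D) (*-identityˡ (inv D))
            (*-monoʳ (inv D) (<⇒≤ (inv>0 D)) (1≤nat D)))

          θ≥0 : 0ℚ ≤ θ
          θ≥0 = ≤-cert (½ * (1ℚ - inv D) + ½) (+≥0 (*≥0 (<⇒≤ 0<½) (diff≥0 inv≤1)) (<⇒≤ 0<½)) (eq (inv D))
            where
            eq : ∀ i → 1ℚ - ½ * i ≡ 0ℚ + (½ * (1ℚ - i) + ½)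
            eq = solve-∀ ℚ-ring

          θ≤1 : θ ≤ 1ℚ
          θ≤1 = ≤-cert (½ * inv D) (*≥0 (<⇒≤ 0<½) (<⇒≤ (inv>0 D))) (eq (½ * inv D))
            where
            eq : ∀ x → 1ℚ ≡ 1ℚ - x + x
            eq = solve-∀ ℚ-ring

          c≥0 : ∀ T j n → 0ℚ ≤ seq (j ÷ T) n
          c≥0 zero    j n = ≤-refl
          c≥0 (suc T) j n = *-cancelˡ-≤ (nat (suc T)) (nat>0 T)
            (subst₂ _≤_ (sym (*-zeroʳ (nat (suc T)))) (sym (nat-÷ j (suc T) n)) (nat≥0 j))

          c≤1 : ∀ T j n → j ℕ.≤ T → seq (j ÷ T) n ≤ 1ℚ
          c≤1 zero    j n l = 0≤1
          c≤1 (suc T) j n l = *-cancelˡ-≤ (nat (suc T)) (nat>0 T)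
            (subst₂ _≤_ (sym (nat-÷ j (suc T) n)) (sym (*-identityʳ (nat (suc T)))) (nat-mono l))

          c≤θ : ∀ T j n → 2 ℕ.* suc D ℕ.* j ℕ.+ T ℕ.≤ 2 ℕ.* suc D ℕ.* T → seq (j ÷ T) n ≤ θ
          c≤θ zero    j n h = θ≥0
          c≤θ (suc T) j n h = *-cancelˡ-≤ (nat (2 ℕ.* suc D)) (nat-mono-< {0} {2 ℕ.* suc D} (ℕ.s≤s ℕ.z≤n))
            (*-cancelˡ-≤ (nat (suc T)) (nat>0 T) (begin
              nat (suc T) * (nat (2 ℕ.* suc D) * x)
                ≡⟨ eq₁ (nat (suc T)) (nat (2 ℕ.* suc D)) x ⟩
              nat (2 ℕ.* suc D) * (nat (suc T) * x)
                ≡⟨ trans (cong (nat (2 ℕ.* suc D) *_) (nat-÷ j (suc T) n)) (sym (nat-* (2 ℕ.* suc D) j)) ⟩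
              nat (2 ℕ.* suc D ℕ.* j)
                ≤⟨ ≤-cert (nat (2 ℕ.* suc D ℕ.* suc T) - nat (2 ℕ.* suc D ℕ.* j ℕ.+ suc T)) (diff≥0 (nat-mono h))
                     (trans (eq₂ (nat (2 ℕ.* suc D ℕ.* suc T)) (nat (2 ℕ.* suc D ℕ.* j)) (nat (suc T)))
                       (cong (λ z → nat (2 ℕ.* suc D ℕ.* j) + (nat (2 ℕ.* suc D ℕ.* suc T) - z))
                         (sym (nat-+ (2 ℕ.* suc D ℕ.* j) (suc T))))) ⟩
              nat (2 ℕ.* suc D ℕ.* suc T) - nat (suc T)
                ≡⟨ cong₂ _-_ (nat-* (2 ℕ.* suc D) (suc T)) (sym (trans (eq₃ (nat (suc D)) (inv D) (nat (suc T)))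
                     (trans (cong (_* nat (suc T)) (nat-inv D)) (*-identityˡ (nat (suc T)))))) ⟩
              nat (2 ℕ.* suc D) * nat (suc T) - nat 2 * nat (suc D) * (½ * inv D) * nat (suc T)
                ≡⟨ cong (λ z → nat (2 ℕ.* suc D) * nat (suc T) - z * (½ * inv D) * nat (suc T)) (sym (nat-* 2 (suc D))) ⟩
              nat (2 ℕ.* suc D) * nat (suc T) - nat (2 ℕ.* suc D) * (½ * inv D) * nat (suc T)
                ≡⟨ eq₄ (nat (2 ℕ.* suc D)) (nat (suc T)) (½ * inv D) ⟩
              nat (suc T) * (nat (2 ℕ.* suc D) * θ) ∎))
            where
            open ≤-Reasoning
            x : ℚ
            x = seq (j ÷ suc T) n
            eq₁ : ∀ a b c → a * (b * c) ≡ b * (a * c)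
            eq₁ = solve-∀ ℚ-ring
            eq₂ : ∀ a b c → a - c ≡ b + (a - (b + c))
            eq₂ = solve-∀ ℚ-ring
            eq₃ : ∀ s i t → (1ℚ + (1ℚ + 0ℚ)) * s * (½ * i) * t ≡ s * i * t
            eq₃ = solve-∀ ℚ-ring
            eq₄ : ∀ a t h → a * t - a * h * t ≡ t * (a * (1ℚ - h))
            eq₄ = solve-∀ ℚ-ring

          -- Either j satisfies the bound and j / T ≤ θ, or f never takes the value j and its level
          -- set has probability zero.
          termwise : ∀ j → j ℕ.≤ T → ∀ ε → 0ℚ < ε → Ev λ n → c j n * p j n ≤ θ * p j n + ε
          termwise j j≤T ε ε>0 with 2 ℕ.* suc D ℕ.* j ℕ.+ T ℕP.≤? 2 ℕ.* suc D ℕ.* T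
          ... | yes good = ev-map (λ n h → ≤-cert ((θ - c j n) * (p j n + ε - 0ℚ) + (1ℚ - θ + c j n) * ε)
                (+≥0 (*≥0 (diff≥0 (c≤θ T j n good)) (diff≥0 h))
                     (*≥0 (+≥0 (diff≥0 θ≤1) (c≥0 T j n)) (<⇒≤ ε>0)))
                (eq θ (c j n) (p j n) ε))
              (ℙr-nonneg (event j) ε ε>0)
            where
            eq : ∀ θ c p e → θ * p + e ≡ c * p + ((θ - c) * (p + e - 0ℚ) + (1ℚ - θ + c) * e)
            eq = solve-∀ ℚ-ring
          ... | no bad = ev-map (λ n h → ≤-cert (ε - (c j n - θ) * p j n)
                (diff≥0 (≤-trans (p≤∣p∣ ((c j n - θ) * p j n)) (≤-trans (∣*∣≤ {c j n - θ} {p j n} (gap≤1 n) h) (≤-reflexive (*-identityˡ ε)))))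
                (eq θ (c j n) (p j n) ε))
              (empty-event j (λ ω e → bad (subst Good e (bound ω))) ε ε>0)
            where
            eq : ∀ θ c p e → θ * p + e ≡ c * p + (e - (c - θ) * p)
            eq = solve-∀ ℚ-ring
            eq₁ : ∀ c θ → 1ℚ ≡ c - θ + (1ℚ - c + θ)
            eq₁ = solve-∀ ℚ-ring
            eq₂ : ∀ c θ → 1ℚ ≡ - (c - θ) + (c + (1ℚ - θ))
            eq₂ = solve-∀ ℚ-ring
            gap≤1 : ∀ n → ∣ c j n - θ ∣ ≤ 1ℚ
            gap≤1 n = ∣∣≤-intro (≤-cert (1ℚ - c j n + θ) (+≥0 (diff≥0 (c≤1 T j n j≤T)) θ≥0) (eq₁ (c j n) θ))
                                (≤-cert (c j n + (1ℚ - θ)) (+≥0 (c≥0 T j n) (diff≥0 θ≤1)) (eq₂ (c j n) θ))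

          partial : ∀ i → i ℕ.≤ suc T → ∀ ε → 0ℚ < ε → Ev λ n → ∑ i (λ j → c j n * p j n) ≤ θ * ∑ i (λ j → p j n) + ε
          partial zero    l ε ε>0 = ev-all λ n → ≤-cert ε (<⇒≤ ε>0) (eq θ ε)
            where
            eq : ∀ θ e → θ * 0ℚ + e ≡ 0ℚ + e
            eq = solve-∀ ℚ-ring
          partial (suc i) l ε ε>0 = ev-zip (λ n a b → ≤-trans (+-mono-≤ a b) (≤-reflexive (eq θ (∑ i (λ j → p j n)) (p i n) ε)))
            (partial i (ℕP.≤-trans (ℕP.n≤1+n i) l) (½ * ε) (halve ε>0)) (termwise i (ℕ.s≤s⁻¹ l) (½ * ε) (halve ε>0))
            where
            eq : ∀ θ x y e → θ * x + ½ * e + (θ * y + ½ * e) ≡ θ * (x + y) + e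
            eq = solve-∀ ℚ-ring

        mean-bound : ∀ ε → 0ℚ < ε → Ev λ n →
          seq (ℝ.sum (suc T) λ j → (j ÷ T) ℝ.* ℙr _ (event j)) n ≤ 1ℚ - ½ * inv D + ε
        mean-bound ε ε>0 = ev-zip (λ n a b → ≤-trans (≤-reflexive (seq-sum (suc T) (λ j → (j ÷ T) ℝ.* ℙr _ (event j)) n))
            (≤-cert (θ * ∑ (suc T) (λ j → p j n) + ½ * ε - ∑ (suc T) (λ j → c j n * p j n)
                     + θ * (1ℚ + ½ * ε - ∑ (suc T) (λ j → p j n)) + (1ℚ - θ) * (½ * ε))
              (+≥0 (+≥0 (diff≥0 a) (*≥0 θ≥0 (diff≥0 b))) (*≥0 (diff≥0 θ≤1) (<⇒≤ (halve ε>0))))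
              (eq θ (∑ (suc T) (λ j → c j n * p j n)) (∑ (suc T) (λ j → p j n)) ε)))
          (partial (suc T) ℕP.≤-refl (½ * ε) (halve ε>0)) (total-probability (½ * ε) (halve ε>0))
          where
          eq : ∀ θ x y e → θ + e ≡ x + (θ * y + ½ * e - x + θ * (1ℚ + ½ * e - y) + (1ℚ - θ) * (½ * e))
          eq = solve-∀ ℚ-ring

  ∪-absorbs : ∀ {n} (A : Subset n) x → x ∈ˢ A → A ∪ ⁅ x ⁆ ≡ A
  ∪-absorbs (true  ∷ A) zero    here      = cong (true ∷_) (∪-identityʳ A)
  ∪-absorbs (true  ∷ A) (suc x) (there h) = cong (true ∷_) (∪-absorbs A x h)
  ∪-absorbs (false ∷ A) (suc x) (there h) = cong (false ∷_) (∪-absorbs A x h)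

  -- Canonicality with fixed support yields the locality of each cell, trivially so for x already in
  -- A. Equal encodings of successful sets yield equal decoder outputs, hence equal sets, for each
  -- ω.
  sketch-bound : ∀ {k M d n′ pr} (S : Sketch k M (suc d) (suc (suc n′) , pr)) → ∀ {ℓ} D C Y → 1 ℕ.≤ Y →
    (∀ i → lookup (Sketch.size S) i ℕ.≤ Y ℕ.* suc (suc n′) ℕ.^ ℓ) → Y ℕ.^ M ℕ.* Y ℕ.^ M ℕ.≤ C ℕ.* suc (suc n′) →
    threshold ℓ M D d C ℕ.≤ suc n′ → ∀ {a b} → 0ℚ ≤ b →
    (∀ q → Probability q → draws q (suc d) (cap ℓ) 0 ≤ a + b * q) → nat M * a + b * nat k ≤ nat (suc d) * (1ℚ - inv D) →
    ∀ ε → 0ℚ < ε → Ev λ n → seq (Sketch.Succ S) n ≤ 1ℚ - ½ * inv D + ε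
  sketch-bound {n′ = n′} S D C Y Y≥1 size≤ Y²≤ t≤n b≥0 line loss = mean-bound space successes total
    (λ ω → length-filter (λ A → Dec ω (Enc ω A) (Enc ω ⊥) ≟ᵒ (A , ⊥)) (subsetsOfSize (suc n′) _)) successes-event D
    (λ ω → success-bound n′ size (Enc ω) (support ω) (support-size ω) (local ω)
      (λ A → Dec ω (Enc ω A) (Enc ω ⊥) ≟ᵒ (A , ⊥))
      (λ {A} {B} okA okB e → ,-injectiveˡ (trans (sym okA) (trans (cong (λ σ → Dec ω σ (Enc ω ⊥)) e) okB)))
      D _ C Y Y≥1 size≤ Y²≤ t≤n b≥0 line loss)
    where
    open Sketch S
    local : ∀ ω A x i → lookup (support ω x) i ≡ false → cell (Enc ω (A ∪ ⁅ x ⁆)) i ≡ cell (Enc ω A) i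
    local ω A x i e with x ∈? A
    ... | yes x∈A = cong (λ B → cell (Enc ω B) i) (∪-absorbs A x x∈A)
    ... | no  x∉A = trans (cong (λ σ → cell σ i) (canonical ω A x x∉A)) (fixed-support ω x (Enc ω A) i
          λ i∈ → contradiction (trans (sym ([]=⇒lookup i∈)) e) λ ())

-- The asymptotic lower bound on the cost.

module LowerBound where

  open import Data.Rational.Base hiding (_÷_)
  open import Data.Rational.Properties
  open import Data.Vec.Base using (lookup)
  open Rationals
  open ExponentialSums
  open SignChanges
  open RationalRoot
  open RealSequences
  open RealRoot
  open BinomialMeans using (draws; Probability)
  open SupportingLine using (supporting-line; cap)
  open FixedRandomness using (threshold)
  open RealPowers
  open RandomSketches

  module Lower (k ℓ : ℕ) (2≤k : 2 ℕ.≤ k) (1≤ℓ : 1 ℕ.≤ ℓ) where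
    open Excess k ℓ 2≤k 1≤ℓ
    open RealExcess k ℓ 2≤k 1≤ℓ

    1≤powerFactor : ∀ N → 1 ℕ.≤ powerFactor ℓ N
    1≤powerFactor N = ℕP.*-mono-≤ (ℕP.m^n>0 3 N) (ℕP.m^n>0 2 (suc (N ℕ.* ℓ)))

    -- slackFactor M bounds Y^{2M} / V for the slack Y of integer-slack.
    slackFactor : ℕ → ℕ
    slackFactor M = 2 ℕ.^ suc (M ℕ.+ M) ℕ.* powerFactor ℓ (suc (M ℕ.+ M))

    module _ (𝒜 : Family k ℓ) where
      open Family 𝒜 renaming (M to cells; r to slack)

      success-below : ∀ D d → (∃ λ a → ∃ λ b → 0ℚ ≤ b ×
          (∀ q → Probability q → draws q (suc d) (cap ℓ) 0 ≤ a + b * q) ×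
          nat (cells (suc d)) * a + b * nat k ≤ nat (suc d) * (1ℚ - inv D)) →
        ∃ λ N → ∀ V → N ℕ.≤ proj₁ V → ∀ ε → 0ℚ < ε → Ev λ n → seq (Succ (suc d) V) n ≤ 1ℚ - ½ * inv D + ε
      success-below D d (a , b , b≥0 , line , loss) = N , below
        where
        M E : ℕ
        M = cells (suc d)
        -- An exponent error of at most 1 / (2M + 1) per cell keeps the joint slack of M cells below
        -- √V up to a constant.
        E = M ℕ.+ M
        small : ∃ λ N → ∀ V → N ℕ.≤ proj₁ V → ℝ.0ℝ ℝ.- fromℚ (inv E) ℝ.< slack (suc d) V × slack (suc d) V ℝ.< ℝ.0ℝ ℝ.+ fromℚ (inv E)
        small = r→0 (suc d) (inv E) (inv>0 E)
        t : ℕ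
        t = threshold ℓ M D d (slackFactor M)
        N : ℕ
        -- 3 is for `power-bound`; moreover V ≥ 3 + t puts the number V - 1 of nonzero residues
        -- above the threshold t.
        N = proj₁ small ℕ.+ (3 ℕ.+ t)
        below : ∀ V → N ℕ.≤ proj₁ V → ∀ ε → 0ℚ < ε → Ev λ n → seq (Succ (suc d) V) n ≤ 1ℚ - ½ * inv D + ε
        below V@(zero , _)        N≤V = contradiction (ℕP.≤-trans (ℕP.m≤n+m (3 ℕ.+ t) (proj₁ small)) N≤V) λ ()
        below V@(suc zero , _)    N≤V = contradiction (ℕP.≤-trans (ℕP.m≤n+m (3 ℕ.+ t) (proj₁ small)) N≤V) λ { (ℕ.s≤s ()) }
        below V@(suc (suc n) , _) N≤V = sketch-bound (sketch (suc d) V) {ℓ} D (slackFactor M) (proj₁ Y) (proj₁ (proj₂ Y))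
          (λ i → proj₁ (proj₂ (proj₂ Y)) (lookup (Sketch.size (sketch (suc d) V)) i) (size-bound i))
          (proj₂ (proj₂ (proj₂ Y))) (ℕP.≤-trans (ℕP.m≤n+m t 2) (ℕ.s≤s⁻¹ V≥)) b≥0 line loss
          where
          p : ℕ
          p = suc (suc n)
          V≥ : 3 ℕ.+ t ℕ.≤ p
          V≥ = ℕP.≤-trans (ℕP.m≤n+m (3 ℕ.+ t) (proj₁ small)) N≤V
          r-small : Ev λ n → ∣ seq (slack (suc d) V) n ∣ ≤ inv E
          r-small = let ((δ , δ>0 , lo) , (δ′ , δ′>0 , hi)) = proj₂ small V (ℕP.≤-trans (ℕP.m≤m+n (proj₁ small) (3 ℕ.+ t)) N≤V) in
            ev-zip (λ n l h → ∣∣≤-intro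
              (≤-cert (0ℚ + inv E - (seq (slack (suc d) V) n + δ′) + δ′) (+≥0 (diff≥0 h) (<⇒≤ δ′>0)) (eq₁ (inv E) (seq (slack (suc d) V) n) δ′))
              (≤-cert (seq (slack (suc d) V) n - (0ℚ + - inv E + δ) + δ) (+≥0 (diff≥0 l) (<⇒≤ δ>0)) (eq₂ (inv E) (seq (slack (suc d) V) n) δ)))
              lo hi
            where
            eq₁ : ∀ i r d → i ≡ r + (0ℚ + i - (r + d) + d)
            eq₁ = solve-∀ ℚ-ring
            eq₂ : ∀ i r d → i ≡ - r + (r - (0ℚ + - i + d) + d)
            eq₂ = solve-∀ ℚ-ring
          Y = integer-slack {ℓ} {p} {M} {powerFactor ℓ (suc E)} (ℕ.s≤s ℕ.z≤n) (1≤powerFactor (suc E))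
          size-bound : ∀ i → lookup (Sketch.size (sketch (suc d) V)) i ℕ.^ suc E ℕ.≤ powerFactor ℓ (suc E) ℕ.* p ℕ.^ suc (suc E ℕ.* ℓ)
          size-bound i = let (z , isPower , s≤z) = size≤ (suc d) V i in
            power-bound {ℓ} {p} {lookup (Sketch.size (sketch (suc d) V)) i} {slack (suc d) V} {z} E 1≤ℓ
              (ℕP.≤-trans (ℕP.m≤m+n 3 t) V≥) isPower s≤z r-small

      -- With so few cells, the success probability would stay below 1 - 1 / (2 (D + 1)) up to any
      -- error for all large V, with the same D for every large d, against the limit 1.
      cells-bound : WHPSuccessful → ∀ t → 0ℚ < t → ∀ L → m ℕ.≤ suc (suc L) → H t (suc (suc L)) < 0ℚ →
        ∃ λ d₀ → ∀ d → d₀ ℕ.≤ d → ¬ nat (cells (suc d)) * t ≤ nat k * nat (suc d)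
      cells-bound (s , liminf , s→1) t t>0 L m≤ H<0 =
        let (D , d₁ , support) = supporting-line k ℓ 2≤k 1≤ℓ t t>0 L m≤ H<0
            -- The success bound is 1 - 4ε up to another ε, while passing to the two limits leaves
            -- at least 1 - 2ε.
            ε = ½ * (½ * (½ * inv D))
            ε>0 = halve (halve (halve (inv>0 D)))
            (d₂ , s≥) = s→1 ε ε>0
        in d₁ ℕ.+ d₂ , λ d l small →
          let (N₁ , above) = proj₁ (liminf (suc d)) ε ε>0
              (N₂ , below) = success-below D d (support d (ℕP.≤-trans (ℕP.m≤m+n d₁ d₂) l) (cells (suc d)) small)
              -- The upper half of the lower limit supplies a prime beyond both thresholds.
              (V , V≥ , _) = proj₂ (liminf (suc d)) 1ℚ 0<1 (N₁ ℕ.+ N₂)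
              ((δ , δ>0 , s-lower) , _) = s≥ (suc d) (ℕP.m≤n⇒m≤1+n (ℕP.≤-trans (ℕP.m≤n+m d₂ d₁) l))
              (δ′ , δ′>0 , succ-lower) = above V (ℕP.≤-trans (ℕP.m≤m+n N₁ N₂) V≥)
              (n , h) = ev-zip₃ (λ n a b c → a , b , c) s-lower succ-lower (below V (ℕP.≤-trans (ℕP.m≤n+m N₂ N₁) V≥) ε ε>0)
              (a , b , c) = h n ℕP.≤-refl
          in impossible (inv D) (seq (s (suc d)) n) (seq (Succ (suc d) V) n) δ δ′ (inv>0 D) δ>0 δ′>0 a b c
        where
        impossible : ∀ i s x δ δ′ → 0ℚ < i → 0ℚ < δ → 0ℚ < δ′ → let ε = ½ * (½ * (½ * i)) in
          1ℚ + - ε + δ ≤ s → s + - ε + δ′ ≤ x → ¬ x ≤ 1ℚ - ½ * i + ε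
        impossible i s x δ δ′ i>0 δ>0 δ′>0 h₁ h₂ h₃ = <-irrefl refl (<-≤-trans (*>0 (*>0 (*>0 0<½ 0<½) 0<½) i>0)
          (≤-cert (s - (1ℚ + - ε + δ) + (x - (s + - ε + δ′)) + (1ℚ - ½ * i + ε - x) + δ + δ′)
            (+≥0 (+≥0 (+≥0 (+≥0 (diff≥0 h₁) (diff≥0 h₂)) (diff≥0 h₃)) (<⇒≤ δ>0)) (<⇒≤ δ′>0)) (eq i s x δ δ′)))
          where
          ε : ℚ
          ε = ½ * (½ * (½ * i))
          eq : ∀ i s x d d′ → 0ℚ ≡ ½ * ½ * ½ * i + (s - (1ℚ + - (½ * (½ * (½ * i))) + d)
               + (x - (s + - (½ * (½ * (½ * i))) + d′)) + (1ℚ - ½ * i + ½ * (½ * (½ * i)) - x) + d + d′)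
          eq = solve-∀ ℚ-ring

      private
        -- With c₀ = kℓ / t and t ≤ r + 2η, the product c₀ r falls short of kℓ by at most 2η c₀ ≤ ε
        -- / 4; dividing by r ≥ ½ at most doubles this.
        ratio-bound : ∀ {c₀ c r R η ε} → 0ℚ < r → r * R ≡ nat k → ½ ≤ r → c₀ ≤ c → 0ℚ ≤ c₀ →
          nat ℓ * nat k ≤ c₀ * (r + (η + η)) → c₀ * (η + η) ≤ ½ * (½ * ε) → 0ℚ ≤ ε → nat ℓ * R - ε + ½ * ε ≤ c
        ratio-bound {c₀} {c} {r} {R} {η} {ε} r>0 rR r≥½ c₀≤c c₀≥0 h small ε≥0 = *-cancelˡ-≤ r r>0 (begin
          r * (nat ℓ * R - ε + ½ * ε)
            ≡⟨ trans (eq₁ r (nat ℓ) R ε) (cong (λ z → nat ℓ * z - ½ * ε * r) rR) ⟩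
          nat ℓ * nat k - ½ * ε * r
            ≤⟨ ≤-cert (c₀ * (r + (η + η)) - nat ℓ * nat k + (½ * (½ * ε) - c₀ * (η + η)) + ½ * ε * (r - ½) + r * (c - c₀))
                 (+≥0 (+≥0 (+≥0 (diff≥0 h) (diff≥0 small)) (*≥0 (*≥0 (<⇒≤ 0<½) ε≥0) (diff≥0 r≥½)))
                      (*≥0 (<⇒≤ r>0) (diff≥0 c₀≤c)))
                 (eq₂ r (nat ℓ * nat k) c₀ c η ε) ⟩
          r * c ∎)
          where
          open ≤-Reasoning
          eq₁ : ∀ r l R e → r * (l * R - e + ½ * e) ≡ l * (r * R) - ½ * e * r
          eq₁ = solve-∀ ℚ-ring
          eq₂ : ∀ r K a c h e → r * c ≡ K - ½ * e * r + (a * (r + (h + h)) - K + (½ * (½ * e) - a * (h + h)) + ½ * e * (r - ½) + r * (c - a))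
          eq₂ = solve-∀ ℚ-ring

      -- Slightly beyond the root, at t = root n₀ + η, the series is negative. So `cells-bound`
      -- gives M t > k d and the ratio is at least kℓ / t, which is close to ℓ / ρ.
      liminf-cost : WHPSuccessful → Limℕ.liminf≥ (λ d → cost d ÷ d) (fromℕ ℓ ℝ.* recip ρ ρ>0)
      liminf-cost whp ε ε>0 = suc d₀ , λ { (suc d) (ℕ.s≤s l) → ½ * ε , halve ε>0 , n₀ , λ n l′ →
          subst (λ y → y * seq (recip ρ ρ>0) n - ε + ½ * ε ≤ seq (cost (suc d) ÷ suc d) n) (sym (seq-fromℕ ℓ n))
            (bound d (many d l) n l′) }
        where
        -- c₀ ≤ 2 ℓ k because t ≥ ½, so that c₀ (η + η) ≤ 4 ℓ k η.
        4K : ℚ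
        4K = nat 4 * (nat ℓ * nat k)
        4K>0 : 0ℚ < 4K
        4K>0 = *>0 (nat>0 3) (*>0 (<-≤-trans 0<1 1≤nat-ℓ) 0<nat-k)
        scale : ∃ λ η → 0ℚ < η × 4K * η ≡ ½ * (½ * ε)
        scale = quotient 4K (½ * (½ * ε)) 4K>0 (halve (halve ε>0))
        η : ℚ
        η = proj₁ scale
        η>0 : 0ℚ < η
        η>0 = proj₁ (proj₂ scale)
        close : ∃ λ N → ∀ n n′ → N ℕ.≤ n → N ℕ.≤ n′ → ∣ root n - root n′ ∣ < η
        close = root-cauchy η η>0
        -- The summand m makes the truncation depth at least m, beyond which all coefficients are
        -- nonpositive.
        n₀ : ℕ
        n₀ = proj₁ close ℕ.+ m
        t : ℚ
        t = root n₀ + η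
        t>0 : 0ℚ < t
        t>0 = +>0 (0<root n₀) (<⇒≤ η>0)
        H<0 : H t (suc (suc (level n₀))) < 0ℚ
        H<0 = negative-beyond excess-signChange (0<root n₀) (<-cert η η>0 refl) (level n₀) (H-root n₀)
        bounds : ∃ λ d₀ → ∀ d → d₀ ℕ.≤ d → ¬ nat (cells (suc d)) * t ≤ nat k * nat (suc d)
        bounds = cells-bound whp t t>0 (level n₀) (ℕP.≤-trans (ℕP.m≤n+m m (proj₁ close)) (n≤depth n₀)) H<0
        d₀ : ℕ
        d₀ = proj₁ bounds
        many : ∀ d → d₀ ℕ.≤ d → nat k * nat (suc d) ≤ nat (cells (suc d)) * t
        many d l = <⇒≤ (≰⇒> (proj₂ bounds d l))
        c₀s : ∃ λ c₀ → 0ℚ < c₀ × t * c₀ ≡ nat ℓ * nat k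
        c₀s = quotient t (nat ℓ * nat k) t>0 (*>0 (<-≤-trans 0<1 1≤nat-ℓ) 0<nat-k)
        c₀ : ℚ
        c₀ = proj₁ c₀s
        c₀>0 : 0ℚ < c₀
        c₀>0 = proj₁ (proj₂ c₀s)
        shift : ℕ
        shift = proj₁ (proj₂ (proj₂ ρ>0))
        bound : ∀ d → nat k * nat (suc d) ≤ nat (cells (suc d)) * t → ∀ n → n₀ ℕ.≤ n →
          nat ℓ * seq (recip ρ ρ>0) n - ε + ½ * ε ≤ seq (cost (suc d) ÷ suc d) n
        bound d h n l = ratio-bound {c₀} {seq (cost (suc d) ÷ suc d) n} {r} {seq (recip ρ ρ>0) n} {η} {ε} (0<root (shift ℕ.+ n)) rR≡k
          (root≥½ (shift ℕ.+ n)) c₀≤ (<⇒≤ c₀>0)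
          (subst (_≤ c₀ * (r + (η + η))) (trans (*-comm c₀ t) (proj₂ (proj₂ c₀s))) (*-monoˡ c₀ (<⇒≤ c₀>0) t≤))
          small (<⇒≤ ε>0)
          where
          r : ℚ
          r = root (shift ℕ.+ n)
          rR≡k : r * seq (recip ρ ρ>0) n ≡ nat k
          rR≡k = trans (cong (_* seq (recip ρ ρ>0) n) (sym (kκ-cancel r)))
            (trans (*-assoc (nat k) (κ * r) (seq (recip ρ ρ>0) n)) (trans (cong (nat k *_) (recip-seq ρ ρ>0 n)) (*-identityʳ (nat k))))
          t≤ : t ≤ r + (η + η)
          t≤ = ≤-cert (r + η - root n₀) (diff≥0 (∣∣≤⇒≤ (root n₀) r (<⇒≤ (proj₂ close n₀ (shift ℕ.+ n)
              (ℕP.m≤m+n (proj₁ close) m) (ℕP.≤-trans (ℕP.≤-trans (ℕP.m≤m+n (proj₁ close) m) l) (ℕP.m≤n+m n shift))))))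
            (eq (root n₀) r η)
            where
            eq : ∀ x r h → r + (h + h) ≡ x + h + (r + h - x)
            eq = solve-∀ ℚ-ring
          c₀≤2K : c₀ ≤ (1ℚ + 1ℚ) * (nat ℓ * nat k)
          c₀≤2K = *-cancelˡ-≤ ½ 0<½ (≤-trans (*-monoʳ {½} {t} c₀ (<⇒≤ c₀>0)
              (≤-trans (root≥½ n₀) (≤-cert {root n₀} η (<⇒≤ η>0) refl)))
            (≤-reflexive (trans (proj₂ (proj₂ c₀s)) (eq (nat ℓ * nat k)))))
            where
            eq : ∀ x → x ≡ ½ * ((1ℚ + 1ℚ) * x)
            eq = solve-∀ ℚ-ring
          small : c₀ * (η + η) ≤ ½ * (½ * ε)
          small = ≤-trans (*-monoʳ (η + η) (+≥0 (<⇒≤ η>0) (<⇒≤ η>0)) c₀≤2K)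
            (≤-reflexive (trans (eq (nat ℓ * nat k) η) (proj₂ (proj₂ scale))))
            where
            eq : ∀ x h → (1ℚ + 1ℚ) * x * (h + h) ≡ (1ℚ + (1ℚ + (1ℚ + (1ℚ + 0ℚ)))) * x * h
            eq = solve-∀ ℚ-ring
          x : ℚ
          x = seq (cost (suc d) ÷ suc d) n
          c₀≤ : c₀ ≤ x
          c₀≤ = *-cancelˡ-≤ (nat (suc d)) (nat>0 d) (*-cancelˡ-≤ t t>0 (begin
            t * (nat (suc d) * c₀)                  ≡⟨ eq₁ t (nat (suc d)) c₀ ⟩
            nat (suc d) * (t * c₀)                  ≡⟨ cong (nat (suc d) *_) (proj₂ (proj₂ c₀s)) ⟩
            nat (suc d) * (nat ℓ * nat k)           ≡⟨ eq₂ (nat (suc d)) (nat ℓ) (nat k) ⟩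
            nat ℓ * (nat k * nat (suc d))           ≤⟨ *-monoˡ (nat ℓ) (nat≥0 ℓ) h ⟩
            nat ℓ * (nat (cells (suc d)) * t)       ≡⟨ eq₃ (nat ℓ) (nat (cells (suc d))) t ⟩
            t * (nat ℓ * nat (cells (suc d)))       ≡⟨ cong (t *_) (sym (trans (nat-÷ (cost (suc d)) (suc d) n) (nat-* ℓ (cells (suc d))))) ⟩
            t * (nat (suc d) * x)                   ∎))
            where
            open ≤-Reasoning
            eq₁ : ∀ t d c → t * (d * c) ≡ d * (t * c)
            eq₁ = solve-∀ ℚ-ring
            eq₂ : ∀ d l k → d * (l * k) ≡ l * (k * d)
            eq₂ = solve-∀ ℚ-ring
            eq₃ : ∀ l M t → l * (M * t) ≡ t * (l * M)
            eq₃ = solve-∀ ℚ-ring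

open import Defs
open import Data.Nat.Base using (ℕ) renaming (_≤_ to _≤ℕ_)
open import Data.Product.Base using (Σ; _×_; _,_)

theorem3 : (k ℓ : ℕ) → 2 ≤ℕ k → 1 ≤ℕ ℓ →
    Σ ℝ λ ρ → Σ (0ℝ < ρ) λ ρ>0 →
    ρ < fromℕ ℓ ×
    IsRoot k ℓ ρ ×
    ((ρ′ : ℝ) → 0ℝ < ρ′ → IsRoot k ℓ ρ′ → ρ′ ≈ ρ) ×
    1ℝ < fromℕ ℓ * recip ρ ρ>0 ×
    ((𝒜 : Family k ℓ) → Family.WHPSuccessful 𝒜 →
    Limℕ.liminf≥ (λ d → Family.cost 𝒜 d ÷ d) (fromℕ ℓ * recip ρ ρ>0))
theorem3 k ℓ 2≤k 1≤ℓ = ρ , ρ>0 , ρ<ℓ , ρ-isRoot , ρ-unique , 1<ℓ/ρ , liminf-cost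
  where
  open RealRoot.RealExcess k ℓ 2≤k 1≤ℓ
  open LowerBound.Lower k ℓ 2≤k 1≤ℓ
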